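{- The generating functions $M_{\mathrm I}^+(x,y;t)$ and $M_{\mathrm{II}}^+(x,y;t)$ of Motzkin N-meanders of type I and type II, respectively, are algebraic. In particular, the generating function $M^+(x,y;t)=M_{\mathrm I}^+(x,y;t)+M_{\mathrm{II}}^+(x,y;t)$ of Motzkin N-meanders, and the N-excursion generating functions $M_{\mathrm I}^+(0,y;t)$, $M_{\mathrm{II}}^+(0,y;t)$, are algebraic.
   Context: An N-step is a non-empty finite set of integers. Motzkin N-walks are finite sequences $w=(s_1,\dots,s_n)$ of N-steps from $S_M=\{\{ -1\},\{0\},\{1\},\{ -1,0\},\{ -1,1\},\{0,1\},\{ -1,0,1\}\}$, starting at $0$, with length $|w|=n$. A classical walk $(v_1,\dots,v_n)$ of integers with positions $\omega_k=\sum_{i\le k}v_i$ is compatible with $w$ if $v_i\in s_i$ for all $i$; it is a meander if $\omega_k\ge 0$ for all $k$. An N-meander is an N-walk compatible with at least one meander; its reachable points are the endpoints $\omega_n$ of all compatible meanders, with minimum $\min^+(w)$ and maximum $\max^+(w)$. A set $R$ of reachable points with minimum $a$ and maximum $b$ is of type I if $R=\{a+i: i=0,1,\dots,b-a\}$ and $b-a\ge1$, and of type II if $R=\{a+2i: i=0,1,\dots,(b-a)/2\}$. An N-meander is of type I/II if its set of reachable points is. Then $M_{\mathrm I}^+(x,y;t)=\sum_w x^{\min^+(w)}y^{\max^+(w)}t^{|w|}$ over Motzkin N-meanders $w$ of type I, and $M_{\mathrm{II}}^+$ likewise for type II (unweighted). -}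

module Defs where

open import Data.Nat as ℕ using (ℕ; zero; suc; _<_; _≤_; _∸_)
open import Data.Integer as ℤ using (ℤ; +_; 0ℤ; 1ℤ; -1ℤ)
open import Data.List using (List; []; _∷_; length)
open import Data.List.Membership.Propositional using (_∈_)
open import Data.List.Relation.Unary.All using (All)
open import Data.List.Relation.Unary.Unique.Propositional using (Unique)
open import Data.List.Relation.Binary.Pointwise using (Pointwise)
open import Data.Product using (Σ; ∃; ∃-syntax; _×_; _,_)
open import Data.Bool using (if_then_else_)
open import Relation.Nullary using (¬_; does)
open import Relation.Binary.PropositionalEquality using (_≡_)
open import Function.Bundles using (_⇔_)

data MStep : Set where
  s₋ s₀ s₊ s₋₀ s₋₊ s₀₊ s₋₀₊ : MStep

elems : MStep → List ℤ
elems s₋   = -1ℤ ∷ []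
elems s₀   = 0ℤ ∷ []
elems s₊   = 1ℤ ∷ []
elems s₋₀  = -1ℤ ∷ 0ℤ ∷ []
elems s₋₊  = -1ℤ ∷ 1ℤ ∷ []
elems s₀₊  = 0ℤ ∷ 1ℤ ∷ []
elems s₋₀₊ = -1ℤ ∷ 0ℤ ∷ 1ℤ ∷ []

_∈ₛ_ : ℤ → MStep → Set
v ∈ₛ s = v ∈ elems s

NWalk : Set
NWalk = List MStep

positionsFrom : ℤ → List ℤ → List ℤ
positionsFrom acc []       = []
positionsFrom acc (v ∷ vs) = (acc ℤ.+ v) ∷ positionsFrom (acc ℤ.+ v) vs

endpointFrom : ℤ → List ℤ → ℤ
endpointFrom acc []       = acc
endpointFrom acc (v ∷ vs) = endpointFrom (acc ℤ.+ v) vs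

endpoint : List ℤ → ℤ
endpoint = endpointFrom 0ℤ

-- meander: all positions ω_k ≥ 0 (ω_0 = 0 trivially)
Meander : List ℤ → Set
Meander v = All (ℤ._≤_ 0ℤ) (positionsFrom 0ℤ v)

Compatible : NWalk → List ℤ → Set
Compatible w v = Pointwise (λ s x → x ∈ₛ s) w v

Reachable : NWalk → ℤ → Set
Reachable w k = ∃[ v ] (Compatible w v × Meander v × endpoint v ≡ k)

NMeander : NWalk → Set
NMeander w = ∃[ v ] (Compatible w v × Meander v)

IsMin⁺ : NWalk → ℤ → Set
IsMin⁺ w a = Reachable w a × (∀ k → Reachable w k → a ℤ.≤ k)

IsMax⁺ : NWalk → ℤ → Set
IsMax⁺ w b = Reachable w b × (∀ k → Reachable w k → k ℤ.≤ b)

TypeI : NWalk → ℕ → ℕ → Set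
TypeI w a b =
  NMeander w × IsMin⁺ w (+ a) × IsMax⁺ w (+ b) ×
  (∀ k → Reachable w k ⇔ (∃[ i ] (k ≡ + a ℤ.+ + i × i ≤ b ∸ a))) ×
  1 ≤ b ∸ a

TypeII : NWalk → ℕ → ℕ → Set
TypeII w a b =
  NMeander w × IsMin⁺ w (+ a) × IsMax⁺ w (+ b) ×
  (∀ k → Reachable w k ⇔ (∃[ i ] (k ≡ + a ℤ.+ + (2 ℕ.* i) × 2 ℕ.* i ≤ b ∸ a)))

-- Coefficient arrays of generating functions.
-- A trivariate series Σ c(n,a,b) x^a y^b t^n is represented by c : ℕ → ℕ → ℕ → ℤ
-- with arguments (n , a , b) = (exponent of t , of x , of y).

Series : Set
Series = ℕ → ℕ → ℕ → ℤ

IsCounting : (NWalk → ℕ → ℕ → Set) → (ℕ → ℕ → ℕ → ℕ) → Set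
IsCounting P F = ∀ n a b → Σ (List NWalk) λ L →
  Unique L × (∀ w → (w ∈ L) ⇔ (length w ≡ n × P w a b)) × length L ≡ F n a b

Σ< : ℕ → (ℕ → ℤ) → ℤ
Σ< zero    f = 0ℤ
Σ< (suc n) f = Σ< n f ℤ.+ f n

_⊛_ : Series → Series → Series
(F ⊛ G) n a b =
  Σ< (suc n) λ n₁ → Σ< (suc a) λ a₁ → Σ< (suc b) λ b₁ →
    F n₁ a₁ b₁ ℤ.* G (n ∸ n₁) (a ∸ a₁) (b ∸ b₁)

one : Series
one zero zero zero = 1ℤ
one _    _    _    = 0ℤ

_^ₛ_ : Series → ℕ → Series
F ^ₛ zero  = one
F ^ₛ suc m = F ⊛ (F ^ₛ m)

shift : ℕ → ℕ → ℕ → Series → Series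
shift i j k F n a b =
  if does (k ℕ.≤? n) then (if does (i ℕ.≤? a) then (if does (j ℕ.≤? b)
    then F (n ∸ k) (a ∸ i) (b ∸ j) else 0ℤ) else 0ℤ) else 0ℤ

evalPoly : ℕ → (ℕ → ℕ → ℕ → ℕ → ℤ) → Series → Series
evalPoly D P F n a b =
  Σ< D λ i → Σ< D λ j → Σ< D λ k → Σ< D λ m →
    P i j k m ℤ.* shift i j k (F ^ₛ m) n a b

-- F is algebraic over ℚ(x,y,t): it is annihilated by a non-zero polynomial
-- P ∈ ℤ[x,y,t,Z] (equivalently ℚ[x,y,t,Z], clearing denominators)
Algebraic : Series → Set
Algebraic F = ∃[ D ] ∃[ P ]
  (∃[ i ] ∃[ j ] ∃[ k ] ∃[ m ] (i < D × j < D × k < D × m < D × ¬ (P i j k m ≡ 0ℤ))) ×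
  (∀ n a b → evalPoly D P F n a b ≡ 0ℤ)

toSeries : (ℕ → ℕ → ℕ → ℕ) → Series
toSeries F n a b = + F n a b

_⊕_ : Series → Series → Series
(F ⊕ G) n a b = F n a b ℤ.+ G n a b

atX0 : Series → Series
atX0 F n zero    b = F n 0 b
atX0 F n (suc a) b = 0ℤ

{-# OPTIONS --safe #-}
-- The set of reachable points evolves deterministically: one step sends a set of type I or II to another such set
-- (or to the empty set), depending only on its minimum, maximum and type. With weights x^min y^max this gives two
-- functional equations, with kernels κII and κI quadratic in u = x y, in which the unknown boundary series are free
-- of x. Forgetting the minimum (x = 1) yields two equations in one catalytic variable, which determine the
-- coefficients of {0} and {0,1}. Each kernel has a small root r, a power series divisible by t; modulo u - r the
-- functional equation becomes (u - r) h = f with f free of x, which forces f = 0. So all the series are obtained from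
-- four quadratic power series by ring operations and division. Such a series f is algebraic: u f = v with u, v in a
-- ring generated over the polynomials by four integral elements, where any sufficiently large family is linearly
-- dependent over the polynomials; a dependency between u^(n-1), u^(n-2) v, ..., v^(n-1) is an equation for f.
module Submission where

open import Defs
open import Level using (0ℓ)
open import Algebra.Bundles using (CommutativeRing; AbelianGroup)
import Algebra.Construct.Pointwise
import Algebra.Properties.AbelianGroup
import Algebra.Properties.Ring
import Algebra.Properties.Semiring.Mult.TCOptimised
import Algebra.Solver.Ring
open import Algebra.Solver.Ring.AlmostCommutativeRing using (fromCommutativeRing; _-Raw-AlmostCommutative⟶_)
open import Data.Bool using (Bool; true; false; _∨_; _∧_; T; if_then_else_)
open import Data.Bool.ListAction using (any)
open import Data.Bool.Properties as Boolₚ using (T?; T-∧)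
open import Data.Integer as ℤ using (ℤ; +_; -[1+_]; 0ℤ; 1ℤ; -1ℤ)
import Data.Integer.Properties as ℤₚ
open import Data.List as List using (List; []; _∷_; length; filter; cartesianProductWith)
import Data.List.Properties as Listₚ
open import Data.List.Membership.Propositional using (_∈_; lose; find)
open import Data.List.Membership.Propositional.Properties
  using (∈-cartesianProductWith⁺; ∈-cartesianProductWith⁻; ∈-filter⁺; ∈-filter⁻)
open import Data.List.Membership.Propositional.Properties.WithK using (unique∧set⇒bag)
open import Data.List.Relation.Binary.BagAndSetEquality using (∼bag⇒↭)
open import Data.List.Relation.Binary.Permutation.Propositional.Properties using (↭-length)
open import Data.List.Relation.Binary.Pointwise using ([]; _∷_)
open import Data.List.Relation.Unary.All as ListAll using ([]; _∷_)
open import Data.List.Relation.Unary.AllPairs using ([]; _∷_)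
open import Data.List.Relation.Unary.Any using (here; there)
import Data.List.Relation.Unary.Any.Properties as Anyₚ
open import Data.List.Relation.Unary.Unique.Propositional using (Unique)
import Data.List.Relation.Unary.Unique.Propositional.Properties as Uniqueₚ
open import Data.Maybe using (Maybe; just; nothing)
open import Data.Nat as ℕ using (ℕ; zero; suc; _∸_; z≤n; s≤s; _≡ᵇ_)
open import Data.Nat.ListAction using (sum)
import Data.Nat.Properties as ℕₚ
open import Data.Product using (∃; ∃-syntax; _×_; _,_; proj₁; proj₂)
open import Data.Sum using (_⊎_; inj₁; inj₂; [_,_]′)
open import Data.Unit using (⊤; tt)
open import Data.Vec as Vec using (Vec; []; _∷_; _++_)
open import Data.Vec.Relation.Unary.All as All using (All; []; _∷_)
import Data.Vec.Relation.Unary.All.Properties as Allₚ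
open import Data.Vec.Relation.Unary.Any using (Any; here; there)
open import Function using (_∘_)
open import Function.Bundles using (_⇔_; mk⇔; Equivalence)
import Relation.Binary.Reasoning.Setoid
open import Relation.Binary.PropositionalEquality as ≡ using (_≡_)
open import Relation.Nullary using (¬_; Dec; yes; no; does; contradiction)
open import Relation.Nullary.Decidable using (¬?)

-- Annihilating a kernel in u = x y would mean setting x = r/y, which is not a power series. So the
-- equations are multiplied by powers of y until their right-hand sides contain x only through u,
-- and substitution is replaced by congruence modulo u - r. This is why exactly their coefficients
-- enter as extra unknowns. The auxiliary equations mark the maximum by x instead of y, so that one
-- notion of being free of x and one kernel argument serve all four kernels. On the algebraic side,
-- equality of power series is undecidable, so constructively there is no field of fractions in
-- which to do linear algebra. Division means cancelling a non-zero-divisor, and zero is tested only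
-- among polynomials.

Ring : Set₁
Ring = CommutativeRing 0ℓ 0ℓ

-- Polynomial identities with integer coefficients in a commutative ring.

module IntegerCoefficients (R : Ring) where
  open CommutativeRing R
  open Algebra.Properties.Ring ring
  open Algebra.Properties.AbelianGroup +-abelianGroup using (⁻¹-∙-comm)
  open Algebra.Properties.Semiring.Mult.TCOptimised semiring renaming (_×_ to _·_) using (×-homo-+; ×1-homo-*; 1+×)
  open Relation.Binary.Reasoning.Setoid setoid

  ⟦_⟧ℤ : ℤ → Carrier
  ⟦ + n ⟧ℤ      = n · 1#
  ⟦ -[1+ n ] ⟧ℤ = - (suc n · 1#)

  private
    cancel-1# : ∀ a b → a + - b ≈ (1# + a) + - (1# + b)
    cancel-1# a b = begin
      a + - b                     ≈⟨ +-congʳ (+-identityˡ a) ⟨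
      (0# + a) + - b              ≈⟨ +-congʳ (+-congʳ (-‿inverseʳ 1#)) ⟨
      ((1# + - 1#) + a) + - b     ≈⟨ +-congʳ (+-assoc _ _ _) ⟩
      (1# + (- 1# + a)) + - b     ≈⟨ +-congʳ (+-congˡ (+-comm _ _)) ⟩
      (1# + (a + - 1#)) + - b     ≈⟨ +-congʳ (+-assoc _ _ _) ⟨
      ((1# + a) + - 1#) + - b     ≈⟨ +-assoc _ _ _ ⟩
      (1# + a) + (- 1# + - b)     ≈⟨ +-congˡ (⁻¹-∙-comm 1# b) ⟩
      (1# + a) + - (1# + b)       ∎

    ⊖-homo : ∀ m n → ⟦ m ℤ.⊖ n ⟧ℤ ≈ m · 1# + - (n · 1#)
    ⊖-homo zero    zero    = sym (-‿inverseʳ 0#)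
    ⊖-homo zero    (suc n) = sym (+-identityˡ _)
    ⊖-homo (suc m) zero    = sym (trans (+-congˡ -0#≈0#) (+-identityʳ _))
    ⊖-homo (suc m) (suc n) = begin
      ⟦ suc m ℤ.⊖ suc n ⟧ℤ                  ≡⟨ ≡.cong ⟦_⟧ℤ (ℤₚ.[1+m]⊖[1+n]≡m⊖n m n) ⟩
      ⟦ m ℤ.⊖ n ⟧ℤ                          ≈⟨ ⊖-homo m n ⟩
      m · 1# + - (n · 1#)                   ≈⟨ cancel-1# _ _ ⟩
      (1# + m · 1#) + - (1# + n · 1#)       ≈⟨ +-cong (1+× m 1#) (-‿cong (1+× n 1#)) ⟨
      suc m · 1# + - (suc n · 1#)           ∎

  ℤ-+-homo : ∀ i j → ⟦ i ℤ.+ j ⟧ℤ ≈ ⟦ i ⟧ℤ + ⟦ j ⟧ℤ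
  ℤ-+-homo (+ m)      (+ n)      = ×-homo-+ 1# m n
  ℤ-+-homo (+ m)      -[1+ n ]   = ⊖-homo m (suc n)
  ℤ-+-homo -[1+ m ]   (+ n)      = trans (⊖-homo n (suc m)) (+-comm _ _)
  ℤ-+-homo -[1+ m ]   -[1+ n ]   = begin
    - (suc (suc (m ℕ.+ n)) · 1#)         ≡⟨ ≡.cong (λ k → - (suc k · 1#)) (≡.sym (ℕₚ.+-suc m n)) ⟩
    - ((suc m ℕ.+ suc n) · 1#)           ≈⟨ -‿cong (×-homo-+ 1# (suc m) (suc n)) ⟩
    - (suc m · 1# + suc n · 1#)          ≈⟨ ⁻¹-∙-comm _ _ ⟨
    - (suc m · 1#) + - (suc n · 1#)      ∎

  ℤ-neg-homo : ∀ i → ⟦ ℤ.- i ⟧ℤ ≈ - ⟦ i ⟧ℤ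
  ℤ-neg-homo (+ zero)  = sym -0#≈0#
  ℤ-neg-homo (+ suc n) = refl
  ℤ-neg-homo -[1+ n ]  = sym (-‿involutive _)

  private
    *-homo⁺ : ∀ m j → ⟦ + m ℤ.* j ⟧ℤ ≈ ⟦ + m ⟧ℤ * ⟦ j ⟧ℤ
    *-homo⁺ m (+ n)    = trans (reflexive (≡.cong ⟦_⟧ℤ (≡.sym (ℤₚ.pos-* m n)))) (×1-homo-* m n)
    *-homo⁺ m -[1+ n ] = begin
      ⟦ + m ℤ.* -[1+ n ] ⟧ℤ         ≡⟨ ≡.cong ⟦_⟧ℤ (≡.sym (ℤₚ.neg-distribʳ-* (+ m) (+ suc n))) ⟩
      ⟦ ℤ.- (+ m ℤ.* + suc n) ⟧ℤ    ≈⟨ ℤ-neg-homo (+ m ℤ.* + suc n) ⟩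
      - ⟦ + m ℤ.* + suc n ⟧ℤ        ≈⟨ -‿cong (*-homo⁺ m (+ suc n)) ⟩
      - (⟦ + m ⟧ℤ * ⟦ + suc n ⟧ℤ)   ≈⟨ -‿distribʳ-* _ _ ⟩
      ⟦ + m ⟧ℤ * - ⟦ + suc n ⟧ℤ     ∎

  ℤ-*-homo : ∀ i j → ⟦ i ℤ.* j ⟧ℤ ≈ ⟦ i ⟧ℤ * ⟦ j ⟧ℤ
  ℤ-*-homo (+ m)    j = *-homo⁺ m j
  ℤ-*-homo -[1+ m ] j = begin
    ⟦ -[1+ m ] ℤ.* j ⟧ℤ          ≡⟨ ≡.cong ⟦_⟧ℤ (≡.sym (ℤₚ.neg-distribˡ-* (+ suc m) j)) ⟩
    ⟦ ℤ.- (+ suc m ℤ.* j) ⟧ℤ     ≈⟨ ℤ-neg-homo (+ suc m ℤ.* j) ⟩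
    - ⟦ + suc m ℤ.* j ⟧ℤ         ≈⟨ -‿cong (*-homo⁺ (suc m) j) ⟩
    - (⟦ + suc m ⟧ℤ * ⟦ j ⟧ℤ)    ≈⟨ -‿distribˡ-* _ _ ⟩
    - ⟦ + suc m ⟧ℤ * ⟦ j ⟧ℤ      ∎

  ℤ⟶R : CommutativeRing.rawRing ℤₚ.+-*-commutativeRing -Raw-AlmostCommutative⟶ fromCommutativeRing R
  ℤ⟶R = record
    { ⟦_⟧ = ⟦_⟧ℤ ; +-homo = ℤ-+-homo ; *-homo = ℤ-*-homo ; -‿homo = ℤ-neg-homo
    ; 0-homo = refl ; 1-homo = refl }

  private
    weakDec : ∀ i j → Maybe (⟦ i ⟧ℤ ≈ ⟦ j ⟧ℤ)
    weakDec i j with i ℤₚ.≟ j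
    ... | yes ≡.refl = just refl
    ... | no _       = nothing

  open Algebra.Solver.Ring (CommutativeRing.rawRing ℤₚ.+-*-commutativeRing)
    (fromCommutativeRing R) ℤ⟶R weakDec public
    using (solve; _:=_; _:+_; _:*_; _:-_; :-_; con)

-- Formal power series in one variable over a commutative ring.

module PowerSeries (R : Ring) where
  private module R = CommutativeRing R
  open R using (_+_; _*_; 0#; 1#; _≈_)
  open IntegerCoefficients R using (solve; _:=_; _:+_; _:*_)
  open Relation.Binary.Reasoning.Setoid R.setoid

  PS : Set
  PS = ℕ → R.Carrier

  private module Pointwise = AbelianGroup (Algebra.Construct.Pointwise.abelianGroup ℕ R.+-abelianGroup)

  infix 4 _≋_
  _≋_ : PS → PS → Set
  f ≋ g = ∀ n → f n ≈ g n

  tail : PS → PS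
  tail f n = f (suc n)

  const : R.Carrier → PS
  const c zero    = c
  const c (suc _) = 0#

  z· : PS → PS
  z· f zero    = 0#
  z· f (suc n) = f n

  var : PS
  var = z· (const 1#)

  infixl 7 _✶_
  -- Recursion along f = f 0 + z · tail f, under which the ring laws become structural inductions.
  -- The convolution sum is recovered in `cauchy`.
  _✶_ : PS → PS → PS
  (f ✶ g) zero    = f 0 * g 0
  (f ✶ g) (suc n) = f 0 * g (suc n) + (tail f ✶ g) n

  infixl 6 _⊞_
  _⊞_ : PS → PS → PS
  (f ⊞ g) n = f n + g n

  infixr 7 _∙_
  _∙_ : R.Carrier → PS → PS
  (c ∙ f) n = c * f n

  ✶-cong : ∀ {f f′ g g′} → f ≋ f′ → g ≋ g′ → f ✶ g ≋ f′ ✶ g′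
  ✶-cong p q zero    = R.*-cong (p 0) (q 0)
  ✶-cong p q (suc n) = R.+-cong (R.*-cong (p 0) (q (suc n))) (✶-cong (λ k → p (suc k)) q n)

  ✶-distribʳ : ∀ h f g → (f ⊞ g) ✶ h ≋ (f ✶ h) ⊞ (g ✶ h)
  ✶-distribʳ h f g zero    = R.distribʳ (h 0) (f 0) (g 0)
  ✶-distribʳ h f g (suc n) = R.trans (R.+-congˡ (✶-distribʳ h (tail f) (tail g) n))
    (solve 5 (λ a b c d e → (a :+ b) :* c :+ (d :+ e) := (a :* c :+ d) :+ (b :* c :+ e)) R.refl
      (f 0) (g 0) (h (suc n)) ((tail f ✶ h) n) ((tail g ✶ h) n))

  ∙-✶-assoc : ∀ c f g → (c ∙ f) ✶ g ≋ c ∙ (f ✶ g)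
  ∙-✶-assoc c f g zero    = R.*-assoc c (f 0) (g 0)
  ∙-✶-assoc c f g (suc n) = R.trans (R.+-congˡ (∙-✶-assoc c (tail f) g n))
    (solve 4 (λ c a b d → c :* a :* b :+ c :* d := c :* (a :* b :+ d)) R.refl c (f 0) (g (suc n)) ((tail f ✶ g) n))

  ✶-assoc : ∀ f g h → (f ✶ g) ✶ h ≋ f ✶ (g ✶ h)
  ✶-assoc f g h zero    = R.*-assoc (f 0) (g 0) (h 0)
  ✶-assoc f g h (suc n) = begin
    f 0 * g 0 * h (suc n) + ((f 0 ∙ tail g ⊞ tail f ✶ g) ✶ h) n
      ≈⟨ R.+-congˡ (✶-distribʳ h (f 0 ∙ tail g) (tail f ✶ g) n) ⟩
    f 0 * g 0 * h (suc n) + (((f 0 ∙ tail g) ✶ h) n + ((tail f ✶ g) ✶ h) n)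
      ≈⟨ R.+-congˡ (R.+-cong (∙-✶-assoc (f 0) (tail g) h n) (✶-assoc (tail f) g h n)) ⟩
    f 0 * g 0 * h (suc n) + (f 0 * (tail g ✶ h) n + (tail f ✶ (g ✶ h)) n)
      ≈⟨ solve 5 (λ a b c d e → a :* b :* c :+ (a :* d :+ e) := a :* (b :* c :+ d) :+ e) R.refl
           (f 0) (g 0) (h (suc n)) ((tail g ✶ h) n) ((tail f ✶ (g ✶ h)) n) ⟩
    f 0 * (g 0 * h (suc n) + (tail g ✶ h) n) + (tail f ✶ (g ✶ h)) n ∎

  -- The mirror image of the defining recursion, peeling the right factor; commutativity comes from
  -- comparing the two.
  ✶-suc : ∀ f g n → (f ✶ g) (suc n) ≈ f (suc n) * g 0 + (f ✶ tail g) n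
  ✶-suc f g zero    = R.+-comm _ _
  ✶-suc f g (suc n) = R.trans (R.+-congˡ (✶-suc (tail f) g n))
    (solve 3 (λ a b c → a :+ (b :+ c) := b :+ (a :+ c)) R.refl
      (f 0 * g (suc (suc n))) (f (suc (suc n)) * g 0) ((tail f ✶ tail g) n))

  ✶-comm : ∀ f g → f ✶ g ≋ g ✶ f
  ✶-comm f g zero    = R.*-comm _ _
  ✶-comm f g (suc n) = R.sym (R.trans (✶-suc g f n) (R.+-cong (R.*-comm _ _) (✶-comm g (tail f) n)))

  ✶-zeroˡ : ∀ {f} g → (∀ n → f n ≈ 0#) → ∀ n → (f ✶ g) n ≈ 0#
  ✶-zeroˡ g p zero    = R.trans (R.*-congʳ (p 0)) (R.zeroˡ _)
  ✶-zeroˡ g p (suc n) = R.trans (R.+-cong (R.trans (R.*-congʳ (p 0)) (R.zeroˡ _)) (✶-zeroˡ g (λ k → p (suc k)) n))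
    (R.+-identityˡ 0#)

  const-✶ : ∀ c g n → (const c ✶ g) n ≈ c * g n
  const-✶ c g zero    = R.refl
  const-✶ c g (suc n) = R.trans (R.+-congˡ (✶-zeroˡ g (λ _ → R.refl) n)) (R.+-identityʳ _)

  ✶-identityˡ : ∀ f → const 1# ✶ f ≋ f
  ✶-identityˡ f n = R.trans (const-✶ 1# f n) (R.*-identityˡ _)

  ring : Ring
  ring = record
    { Carrier = PS ; _≈_ = _≋_ ; _+_ = _⊞_ ; _*_ = _✶_ ; -_ = λ f n → R.- f n
    ; 0# = λ _ → 0# ; 1# = const 1#
    ; isCommutativeRing = record
      { isRing = record
        { +-isAbelianGroup = Pointwise.isAbelianGroup
        ; *-cong = ✶-cong
        ; *-assoc = ✶-assoc
        ; *-identity = ✶-identityˡ , λ f n → R.trans (✶-comm f (const 1#) n) (✶-identityˡ f n)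
        ; distrib = (λ h f g n → R.trans (✶-comm h (f ⊞ g) n) (R.trans (✶-distribʳ h f g n)
                       (R.+-cong (✶-comm f h n) (✶-comm g h n)))) , ✶-distribʳ
        }
      ; *-comm = ✶-comm
      }
    }

  var-✶ : ∀ f → var ✶ f ≋ z· f
  var-✶ f zero    = R.zeroˡ _
  var-✶ f (suc n) = R.trans (R.+-cong (R.zeroˡ _) (✶-identityˡ f n)) (R.+-identityˡ _)

  const-+ : ∀ a b → const (a + b) ≋ const a ⊞ const b
  const-+ a b zero    = R.refl
  const-+ a b (suc n) = R.sym (R.+-identityˡ 0#)

  const-* : ∀ a b → const (a * b) ≋ const a ✶ const b
  const-* a b zero    = R.refl
  const-* a b (suc n) = R.sym (R.trans (const-✶ a (const b) (suc n)) (R.zeroʳ a))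

  const-neg : ∀ a → const (R.- a) ≋ λ n → R.- const a n
  const-neg a zero    = R.refl
  const-neg a (suc n) = R.sym (Algebra.Properties.Ring.-0#≈0# R.ring)

  const-cong : ∀ {a b} → a ≈ b → const a ≋ const b
  const-cong p zero    = p
  const-cong p (suc n) = R.refl

  const-0 : const 0# ≋ λ _ → 0#
  const-0 zero    = R.refl
  const-0 (suc n) = R.refl

  ✶-vanish : ∀ f {g} n → (∀ k → k ℕ.≤ n → g k ≈ 0#) → (f ✶ g) n ≈ 0#
  ✶-vanish f zero    p = R.trans (R.*-congˡ (p 0 z≤n)) (R.zeroʳ _)
  ✶-vanish f (suc n) p = R.trans
    (R.+-cong (R.trans (R.*-congˡ (p (suc n) ℕₚ.≤-refl)) (R.zeroʳ _))
              (✶-vanish (tail f) n (λ k k≤n → p k (ℕₚ.m≤n⇒m≤1+n k≤n))))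
    (R.+-identityˡ 0#)

  infix 4 _≋⟨_⟩_
  _≋⟨_⟩_ : PS → ℕ → PS → Set
  f ≋⟨ k ⟩ g = ∀ n → n ℕ.< k → f n ≈ g n

  ✶-cong-< : ∀ {f f′ g g′} k → f ≋⟨ k ⟩ f′ → g ≋⟨ k ⟩ g′ → f ✶ g ≋⟨ k ⟩ f′ ✶ g′
  ✶-cong-< k p q zero    n<k = R.*-cong (p 0 n<k) (q 0 n<k)
  ✶-cong-< (suc k) p q (suc n) (s≤s n<k) = R.+-cong (R.*-cong (p 0 (s≤s z≤n)) (q (suc n) (s≤s n<k)))
    (✶-cong-< k (λ i i<k → p (suc i) (s≤s i<k)) (λ i i<k → q i (ℕₚ.m<n⇒m<1+n i<k)) n n<k)

  Contractive : (PS → PS) → Set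
  Contractive Φ = ∀ {f g} k → f ≋⟨ k ⟩ g → Φ f ≋⟨ suc k ⟩ Φ g

  iterate : (PS → PS) → ℕ → PS
  iterate Φ zero    = λ _ → 0#
  iterate Φ (suc k) = Φ (iterate Φ k)

  -- For contractive Φ all iterates from the (n+1)-st on agree in degree n, so this diagonal is the
  -- limit of the iteration.
  fix : (PS → PS) → PS
  fix Φ n = iterate Φ (suc n) n

  module _ {Φ} (contr : Contractive Φ) where
    private
      step : ∀ k → iterate Φ k ≋⟨ k ⟩ iterate Φ (suc k)
      step zero    n ()
      step (suc k) = contr k (step k)

      stable : ∀ n d → iterate Φ (suc n) n ≈ iterate Φ (d ℕ.+ suc n) n
      stable n zero    = R.refl
      stable n (suc d) = R.trans (stable n d) (step (d ℕ.+ suc n) n (ℕₚ.m≤n+m (suc n) d))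

      fix-approx : ∀ k → fix Φ ≋⟨ k ⟩ iterate Φ k
      fix-approx k n n<k = R.trans (stable n (k ∸ suc n))
        (R.reflexive (≡.cong (λ i → iterate Φ i n) (ℕₚ.m∸n+n≡m n<k)))

    fix-≋ : fix Φ ≋ Φ (fix Φ)
    fix-≋ n = R.sym (contr n (fix-approx n) n (ℕₚ.n<1+n n))

-- Non-zero-divisors, subrings, and polynomials inside power series.

module _ (R : Ring) where
  open CommutativeRing R

  -- Replaces invertibility: denominators such as t, x and y are not units of the power series ring,
  -- but multiplication by them is injective.
  record Cancellable (f : Carrier) : Set where
    constructor cancellable
    field cancel : ∀ g → f * g ≈ 0# → g ≈ 0#

  record Subring : Set₁ where
    field
      Mem     : Carrier → Set
      mem-0   : Mem 0#
      mem-1   : Mem 1#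
      mem-+   : ∀ {a b} → Mem a → Mem b → Mem (a + b)
      mem-*   : ∀ {a b} → Mem a → Mem b → Mem (a * b)
      mem-neg : ∀ {a} → Mem a → Mem (- a)

    mem-- : ∀ {a b} → Mem a → Mem b → Mem (a - b)
    mem-- p q = mem-+ p (mem-neg q)

  -- The coefficients of linear relations are drawn from such a subring. The zero test is confined
  -- to it, because it exists for polynomials but not for power series.
  record Subdomain : Set₁ where
    field
      subring   : Subring
    open Subring subring public
    field
      1≉0       : ¬ 1# ≈ 0#
      zero?     : ∀ {a} → Mem a → Dec (a ≈ 0#)
      no-zero-divisors : ∀ {a b} → Mem a → Mem b → a * b ≈ 0# → a ≈ 0# ⊎ b ≈ 0#

open Cancellable

module CancellableProperties (R : Ring) where
  open CommutativeRing R
  open Relation.Binary.Reasoning.Setoid setoid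

  cancellable-resp : ∀ {a b} → a ≈ b → Cancellable R a → Cancellable R b
  cancellable-resp p c = cancellable λ g q → cancel c g (trans (*-congʳ p) q)

  cancellable-1 : Cancellable R 1#
  cancellable-1 = cancellable λ g p → trans (sym (*-identityˡ g)) p

  cancellable-* : ∀ {a b} → Cancellable R a → Cancellable R b → Cancellable R (a * b)
  cancellable-* {a} {b} ca cb = cancellable λ g p → cancel cb g (cancel ca (b * g) (trans (sym (*-assoc a b g)) p))

  cancellable-neg : ∀ {a} → Cancellable R a → Cancellable R (- a)
  cancellable-neg {a} c = cancellable λ g p → cancel c g (begin
    a * g          ≈⟨ -‿involutive _ ⟨
    - - (a * g)    ≈⟨ -‿cong (-‿distribˡ-* a g) ⟩
    - (- a * g)    ≈⟨ -‿cong p ⟩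
    - 0#           ≈⟨ -0#≈0# ⟩
    0#             ∎)
    where open Algebra.Properties.Ring ring

module PowerSeriesProperties (R : Ring) where
  private module R = CommutativeRing R
  open R using (0#)
  open PowerSeries R

  private
    -- Once g 0 vanishes, `✶-suc` shows that f annihilates tail g as well, so the induction can keep
    -- f fixed.
    cancel-head : ∀ {f g} → Cancellable R (f 0) → (f ✶ g ≋ λ _ → 0#) → g ≋ λ _ → 0#
    cancel-head {f} {g} c p zero    = cancel c (g 0) (p 0)
    cancel-head {f} {g} c p (suc n) = cancel-head {f} {tail g} c q n
      where
      q : f ✶ tail g ≋ λ _ → 0#
      q k = R.trans (R.sym (R.+-identityˡ _)) (R.trans (R.+-congʳ (R.sym
              (R.trans (R.*-congˡ (cancel c (g 0) (p 0))) (R.zeroʳ _))))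
            (R.trans (R.sym (✶-suc f g k)) (p (suc k))))

  cancellable-head : ∀ {f} → Cancellable R (f 0) → Cancellable ring f
  cancellable-head c = cancellable λ g → cancel-head c

  cancellable-var : Cancellable ring var
  cancellable-var = cancellable λ g p n → R.trans (R.sym (var-✶ g (suc n))) (p (suc n))

  cancellable-const : ∀ {c} → Cancellable R c → Cancellable ring (const c)
  cancellable-const {c} cc = cancellable λ g p n → cancel cc (g n) (R.trans (R.sym (const-✶ c g n)) (p n))

module PowerSeriesSubring (R : Ring) (Q : Subring R) where
  private module R = CommutativeRing R
  open PowerSeries R
  open Subring Q

  ✶-mem : ∀ {f g} → (∀ n → Mem (f n)) → (∀ n → Mem (g n)) → ∀ n → Mem ((f ✶ g) n)
  ✶-mem p q zero    = mem-* (p 0) (q 0)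
  ✶-mem p q (suc n) = mem-+ (mem-* (p 0) (q (suc n))) (✶-mem (λ k → p (suc k)) q n)

  const-mem : ∀ {c} → Mem c → ∀ n → Mem (const c n)
  const-mem p zero    = p
  const-mem p (suc n) = mem-0

  var-mem : ∀ n → Mem (var n)
  var-mem zero    = mem-0
  var-mem (suc n) = const-mem mem-1 n

  record Coefficientwise (f : PS) : Set where
    constructor coefficientwise
    field coefficients : ∀ n → Mem (f n)
  open Coefficientwise

  series : Subring ring
  series = record
    { Mem = Coefficientwise
    ; mem-0 = coefficientwise λ n → mem-0
    ; mem-1 = coefficientwise (const-mem mem-1)
    ; mem-+ = λ p q → coefficientwise λ n → mem-+ (coefficients p n) (coefficients q n)
    ; mem-* = λ p q → coefficientwise (✶-mem (coefficients p) (coefficients q))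
    ; mem-neg = λ p → coefficientwise λ n → mem-neg (coefficients p n)
    }

module PowerSeriesSubdomain (R : Ring) (P : Subdomain R) where
  private module R = CommutativeRing R
  open R using (0#; _≈_)
  open PowerSeries R
  open Subdomain P
  open PowerSeriesSubring R subring using (✶-mem; const-mem; var-mem)
  private module S = CommutativeRing ring

  Bounded : ℕ → PS → Set
  Bounded D f = ∀ n → D ℕ.≤ n → f n ≈ 0#

  -- The degree bound is data: it makes the zero test a finite inspection and later bounds the sums
  -- in `evalPoly`.
  record IsPolynomial (f : PS) : Set where
    constructor polynomial
    field
      members : ∀ n → Mem (f n)
      bound   : ℕ
      bounded : Bounded bound f

  private
    ✶-bounded : ∀ {f g} D E → Bounded D f → Bounded E g → Bounded (D ℕ.+ E) (f ✶ g)
    ✶-bounded {f} {g} zero E p q n _ = ✶-zeroˡ g (λ k → p k z≤n) n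
    ✶-bounded {f} {g} (suc D) E p q (suc n) (s≤s D+E≤n) = R.trans
      (R.+-cong (R.trans (R.*-congˡ (q (suc n) (ℕₚ.≤-trans (ℕₚ.m≤n+m E D) (ℕₚ.m≤n⇒m≤1+n D+E≤n)))) (R.zeroʳ _))
                (✶-bounded D E (λ k D≤k → p (suc k) (s≤s D≤k)) q n D+E≤n))
      (R.+-identityˡ 0#)

    zero-dec : ∀ {f} D → (∀ n → Mem (f n)) → Bounded D f → Dec (f ≋ λ _ → 0#)
    zero-dec zero    p b = yes (λ n → b n z≤n)
    zero-dec (suc D) p b with zero? (p 0)
    ... | no ¬q = no (λ q → ¬q (q 0))
    ... | yes q with zero-dec D (λ n → p (suc n)) (λ n D≤n → b (suc n) (s≤s D≤n))
    ...   | yes r = yes λ { zero → q ; (suc n) → r n }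
    ...   | no ¬r = no (λ r → ¬r (λ n → r (suc n)))

    drop-head : ∀ {f g} → f 0 ≈ 0# → f ✶ g ≋ (λ _ → 0#) → tail f ✶ g ≋ λ _ → 0#
    drop-head p q n = R.trans (R.sym (R.+-identityˡ _))
      (R.trans (R.+-congʳ (R.sym (R.trans (R.*-congʳ p) (R.zeroˡ _)))) (q (suc n)))

    cons-zero : ∀ {f} → f 0 ≈ 0# → tail f ≋ (λ _ → 0#) → f ≋ λ _ → 0#
    cons-zero p q zero    = p
    cons-zero p q (suc n) = q n

    -- Induction on both degree bounds. A vanishing head is dropped from its factor, and two
    -- non-zero heads contradict the lowest coefficient of the product.
    nzd : ∀ {f g} D E → (∀ n → Mem (f n)) → (∀ n → Mem (g n)) → Bounded D f → Bounded E g →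
          f ✶ g ≋ (λ _ → 0#) → (f ≋ λ _ → 0#) ⊎ (g ≋ λ _ → 0#)
    nzd zero E p q b c r = inj₁ (λ n → b n z≤n)
    nzd (suc D) zero p q b c r = inj₂ (λ n → c n z≤n)
    nzd {f} {g} (suc D) (suc E) p q b c r with zero? (p 0)
    ... | yes f₀≈0 with nzd D (suc E) (λ n → p (suc n)) q (λ n D≤n → b (suc n) (s≤s D≤n)) c (drop-head f₀≈0 r)
    ...   | inj₁ s = inj₁ (cons-zero f₀≈0 s)
    ...   | inj₂ s = inj₂ s
    nzd {f} {g} (suc D) (suc E) p q b c r | no f₀≉0 with zero? (q 0)
    ... | no g₀≉0 with no-zero-divisors (p 0) (q 0) (r 0)
    ...   | inj₁ s with () ← f₀≉0 s
    ...   | inj₂ s with () ← g₀≉0 s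
    nzd {f} {g} (suc D) (suc E) p q b c r | no f₀≉0 | yes g₀≈0
      with nzd (suc D) E p (λ n → q (suc n)) b (λ n E≤n → c (suc n) (s≤s E≤n))
             (S.trans (✶-comm f (tail g)) (drop-head g₀≈0 (S.trans (✶-comm g f) r)))
    ... | inj₁ s = inj₁ s
    ... | inj₂ s = inj₂ (cons-zero g₀≈0 s)

  const-polynomial : ∀ {c} → Mem c → IsPolynomial (const c)
  const-polynomial p = polynomial (const-mem p) 1 λ { (suc n) _ → R.refl }

  var-polynomial : IsPolynomial var
  var-polynomial = polynomial var-mem 2 λ { (suc zero) (s≤s ()) ; (suc (suc n)) _ → R.refl }

  polynomials : Subdomain ring
  polynomials = record
    { subring = record
      { Mem = IsPolynomial
      ; mem-0 = polynomial (λ _ → mem-0) 0 λ _ _ → R.refl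
      ; mem-1 = const-polynomial mem-1
      ; mem-+ = λ { (polynomial p D b) (polynomial q E c) → polynomial (λ n → mem-+ (p n) (q n)) (D ℕ.⊔ E) λ n m≤n →
          R.trans (R.+-cong (b n (ℕₚ.m⊔n≤o⇒m≤o D E m≤n)) (c n (ℕₚ.m⊔n≤o⇒n≤o D E m≤n))) (R.+-identityˡ 0#) }
      ; mem-* = λ { (polynomial p D b) (polynomial q E c) → polynomial (✶-mem p q) (D ℕ.+ E) (✶-bounded D E b c) }
      ; mem-neg = λ { (polynomial p D b) → polynomial (λ n → mem-neg (p n)) D λ n D≤n →
          R.trans (R.-‿cong (b n D≤n)) (Algebra.Properties.Ring.-0#≈0# R.ring) } }
    ; 1≉0 = λ e → 1≉0 (e 0)
    ; zero? = λ { (polynomial p D b) → zero-dec D p b }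
    ; no-zero-divisors = λ { (polynomial p D b) (polynomial q E c) → nzd D E p q b c }
    }

-- Linear dependence, quadratic extensions, and algebraicity of fractions.

module AlgebraicExtensions (S : Ring) (P : Subdomain S) where
  open CommutativeRing S
  open Subdomain P
  open IntegerCoefficients S using (solve; _:=_; _:+_; _:*_; _:-_; :-_; con)
  open CancellableProperties S
  open Relation.Binary.Reasoning.Setoid setoid

  comb : ∀ {n} → Vec Carrier n → Vec Carrier n → Carrier
  comb []       []       = 0#
  comb (c ∷ cs) (v ∷ vs) = c * v + comb cs vs

  comb-++ : ∀ {m n} (cs vs : Vec Carrier m) (ds ws : Vec Carrier n) →
            comb (cs ++ ds) (vs ++ ws) ≈ comb cs vs + comb ds ws
  comb-++ []       []       ds ws = sym (+-identityˡ _)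
  comb-++ (c ∷ cs) (v ∷ vs) ds ws = trans (+-congˡ (comb-++ cs vs ds ws)) (sym (+-assoc _ _ _))

  comb-scaleˡ : ∀ {n} d (cs vs : Vec Carrier n) → comb (Vec.map (d *_) cs) vs ≈ d * comb cs vs
  comb-scaleˡ d []       []       = sym (zeroʳ d)
  comb-scaleˡ d (c ∷ cs) (v ∷ vs) = trans (+-congˡ (comb-scaleˡ d cs vs))
    (solve 4 (λ d c v k → d :* c :* v :+ d :* k := d :* (c :* v :+ k)) refl d c v (comb cs vs))

  comb-scaleʳ : ∀ {n} d (cs vs : Vec Carrier n) → comb cs (Vec.map (d *_) vs) ≈ d * comb cs vs
  comb-scaleʳ d []       []       = sym (zeroʳ d)
  comb-scaleʳ d (c ∷ cs) (v ∷ vs) = trans (+-congˡ (comb-scaleʳ d cs vs))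
    (solve 4 (λ d c v k → c :* (d :* v) :+ d :* k := d :* (c :* v :+ k)) refl d c v (comb cs vs))

  NonZero : ∀ {n} → Vec Carrier n → Set
  NonZero = Any (λ c → ¬ c ≈ 0#)

  Dependent : ∀ {n} → Vec Carrier n → Set
  Dependent {n} vs = ∃ λ (cs : Vec Carrier n) → All Mem cs × NonZero cs × comb cs vs ≈ 0#

  mem-≉0-* : ∀ {a b} → Mem a → Mem b → ¬ a ≈ 0# → ¬ b ≈ 0# → ¬ a * b ≈ 0#
  mem-≉0-* p q a≉0 b≉0 e = [ a≉0 , b≉0 ]′ (no-zero-divisors p q e)

  nonZero-scale : ∀ {n d} {cs : Vec Carrier n} → Mem d → All Mem cs → ¬ d ≈ 0# → NonZero cs →
                  NonZero (Vec.map (d *_) cs)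
  nonZero-scale p (q ∷ qs) d≉0 (here c≉0) = here (mem-≉0-* p q d≉0 c≉0)
  nonZero-scale p (q ∷ qs) d≉0 (there nz) = there (nonZero-scale p qs d≉0 nz)

  nonZero-++ˡ : ∀ {m n} {cs : Vec Carrier m} {ds : Vec Carrier n} → NonZero cs → NonZero (cs ++ ds)
  nonZero-++ˡ (here p)  = here p
  nonZero-++ˡ (there p) = there (nonZero-++ˡ p)

  nonZero-++ʳ : ∀ {m n} (cs : Vec Carrier m) {ds : Vec Carrier n} → NonZero ds → NonZero (cs ++ ds)
  nonZero-++ʳ []       p = p
  nonZero-++ʳ (c ∷ cs) p = there (nonZero-++ʳ cs p)

  all-scale : ∀ {n d} {cs : Vec Carrier n} → Mem d → All Mem cs → All Mem (Vec.map (d *_) cs)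
  all-scale p []       = []
  all-scale p (q ∷ qs) = mem-* p q ∷ all-scale p qs

  -- Instead of a basis, a finite extension carries a bound on the size of independent families.
  record FiniteExtension : Set₁ where
    field
      _∈    : Carrier → Set
      ∈-mem : ∀ {a} → Mem a → a ∈
      ∈-+   : ∀ {a b} → a ∈ → b ∈ → (a + b) ∈
      ∈-*   : ∀ {a b} → a ∈ → b ∈ → (a * b) ∈
      size  : ℕ
      dependent : (vs : Vec Carrier size) → All _∈ vs → Dependent vs

  -- Two elements v, w satisfy w v - v w = 0, a non-trivial relation unless w = 0; in that case w
  -- alone is a relation. Hence the bound 2.
  base : FiniteExtension
  base = record { _∈ = Mem ; ∈-mem = λ p → p ; ∈-+ = mem-+ ; ∈-* = mem-* ; size = 2 ; dependent = dep }
    where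
    dep : (vs : Vec Carrier 2) → All Mem vs → Dependent vs
    dep (v ∷ w ∷ []) (p ∷ q ∷ []) with zero? q
    ... | no w≉0 = w ∷ - v ∷ [] , q ∷ mem-neg p ∷ [] , here w≉0 ,
      solve 2 (λ v w → w :* v :+ (:- v :* w :+ con 0ℤ) := con 0ℤ) refl v w
    ... | yes w≈0 = 0# ∷ 1# ∷ [] , mem-0 ∷ mem-1 ∷ [] , there (here 1≉0) ,
      trans (solve 2 (λ v w → con 0ℤ :* v :+ (con 1ℤ :* w :+ con 0ℤ) := w) refl v w) w≈0

  module _ (A : FiniteExtension) {β p q : Carrier} (p-mem : Mem p) (q-mem : Mem q)
           (β² : β * β ≈ p * β + q) where
    private
      open FiniteExtension A

      _∈β : Carrier → Set
      f ∈β = ∃[ a ] ∃[ b ] (a ∈ × b ∈ × f ≈ a + b * β)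

      ∈β-* : ∀ {f g} → f ∈β → g ∈β → (f * g) ∈β
      ∈β-* {f} {g} (a , b , a∈ , b∈ , e) (a′ , b′ , a′∈ , b′∈ , e′) =
        a * a′ + q * (b * b′) , (a * b′ + b * a′) + p * (b * b′) ,
        ∈-+ (∈-* a∈ a′∈) (∈-* (∈-mem q-mem) (∈-* b∈ b′∈)) ,
        ∈-+ (∈-+ (∈-* a∈ b′∈) (∈-* b∈ a′∈)) (∈-* (∈-mem p-mem) (∈-* b∈ b′∈)) , (begin
          f * g
            ≈⟨ *-cong e e′ ⟩
          (a + b * β) * (a′ + b′ * β)
            ≈⟨ solve 5 (λ a b a′ b′ β → (a :+ b :* β) :* (a′ :+ b′ :* β) :=
                 (a :* a′ :+ (a :* b′ :+ b :* a′) :* β) :+ b :* b′ :* (β :* β)) refl a b a′ b′ β ⟩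
          (a * a′ + (a * b′ + b * a′) * β) + b * b′ * (β * β)
            ≈⟨ +-congˡ (*-congˡ β²) ⟩
          (a * a′ + (a * b′ + b * a′) * β) + b * b′ * (p * β + q)
            ≈⟨ solve 6 (λ aa ab bb β p q → (aa :+ ab :* β) :+ bb :* (p :* β :+ q) :=
                 (aa :+ q :* bb) :+ (ab :+ p :* bb) :* β) refl (a * a′) (a * b′ + b * a′) (b * b′) β p q ⟩
          (a * a′ + q * (b * b′)) + ((a * b′ + b * a′) + p * (b * b′)) * β ∎)

      components : ∀ {n} (vs : Vec Carrier n) → All _∈β vs → ∃[ as ] ∃[ bs ] (All _∈ as × All _∈ bs ×
                   (∀ cs → comb cs vs ≈ comb cs as + comb cs bs * β))
      components [] [] = [] , [] , [] , [] , λ { [] → sym (trans (+-identityˡ _) (zeroˡ β)) }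
      components (v ∷ vs) ((a , b , a∈ , b∈ , e) ∷ es) with components vs es
      ... | as , bs , as∈ , bs∈ , eq = a ∷ as , b ∷ bs , a∈ ∷ as∈ , b∈ ∷ bs∈ , λ { (c ∷ cs) →
        trans (+-cong (*-congˡ e) (eq cs))
          (solve 6 (λ a b c β k l → c :* (a :+ b :* β) :+ (k :+ l :* β) := (c :* a :+ k) :+ (c :* b :+ l) :* β)
            refl a b c β (comb cs as) (comb cs bs)) }

      comb-∈ : ∀ {n} {cs vs : Vec Carrier n} → All Mem cs → All _∈ vs → comb cs vs ∈
      comb-∈ []       []       = ∈-mem mem-0
      comb-∈ (p ∷ ps) (q ∷ qs) = ∈-+ (∈-* (∈-mem p) q) (comb-∈ ps qs)

      -- A linear way to spread m coefficients over m k vectors that keeps them non-trivial and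
      -- produces only multiples of β. A dependency among the m images thus lifts to one among the m
      -- k vectors.
      record Collapse {m k} (vs : Vec Carrier (m ℕ.* k)) : Set where
        field
          coeffs    : Vec Carrier m → Vec Carrier (m ℕ.* k)
          coeffs-mem : ∀ {ds} → All Mem ds → All Mem (coeffs ds)
          coeffs-nonZero : ∀ {ds} → All Mem ds → NonZero ds → NonZero (coeffs ds)
          images    : Vec Carrier m
          images-∈  : All _∈ images
          collapse  : ∀ ds → comb (coeffs ds) vs ≈ comb ds images * β

      -- A dependency among the A-components of each block of k vectors leaves one multiple of β per block.
      collapseBlocks : ∀ {m} (vss : Vec (Vec Carrier size) m) → All (All _∈β) vss →
                       Collapse {m} {size} (Vec.concat vss)
      collapseBlocks [] [] = record
        { coeffs = λ ds → ds ; coeffs-mem = λ p → p ; coeffs-nonZero = λ _ p → p ; images = [] ; images-∈ = []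
        ; collapse = λ { [] → sym (zeroˡ β) } }
      collapseBlocks (vs ∷ vss) (vs∈ ∷ vss∈) with components vs vs∈ | collapseBlocks vss vss∈
      ... | as , bs , as∈ , bs∈ , eq | rest with dependent as as∈
      ... | cs , cs-mem , cs-nz , cs-as≈0 = record
        { coeffs = λ { (d ∷ ds) → Vec.map (d *_) cs ++ coeffs ds }
        ; coeffs-mem = λ { (p ∷ ps) → Allₚ.++⁺ (all-scale p cs-mem) (coeffs-mem ps) }
        ; coeffs-nonZero = λ { (p ∷ ps) (here d≉0) → nonZero-++ˡ (nonZero-scale p cs-mem d≉0 cs-nz)
                             ; {d ∷ _} (p ∷ ps) (there nz) → nonZero-++ʳ (Vec.map (d *_) cs) (coeffs-nonZero ps nz) }
        ; images = comb cs bs ∷ images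
        ; images-∈ = comb-∈ cs-mem bs∈ ∷ images-∈
        ; collapse = λ { (d ∷ ds) → begin
            comb (Vec.map (d *_) cs ++ coeffs ds) (vs ++ Vec.concat vss)
              ≈⟨ comb-++ (Vec.map (d *_) cs) vs (coeffs ds) (Vec.concat vss) ⟩
            comb (Vec.map (d *_) cs) vs + comb (coeffs ds) (Vec.concat vss)
              ≈⟨ +-cong (comb-scaleˡ d cs vs) (collapse ds) ⟩
            d * comb cs vs + comb ds images * β
              ≈⟨ +-congʳ (*-congˡ (trans (eq cs) (trans (+-congʳ cs-as≈0) (+-identityˡ _)))) ⟩
            d * (comb cs bs * β) + comb ds images * β
              ≈⟨ solve 4 (λ d k β l → d :* (k :* β) :+ l :* β := (d :* k :+ l) :* β) refl
                   d (comb cs bs) β (comb ds images) ⟩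
            (d * comb cs bs + comb ds images) * β ∎ }
        }
        where open Collapse rest

      -- The `size` blocks of `size` vectors leave `size` multiples of β, whose cofactors lie in the
      -- smaller extension and are therefore dependent there.
      dependentβ : (vs : Vec Carrier (size ℕ.* size)) → All _∈β vs → Dependent vs
      dependentβ vs vs∈ with Vec.group size size vs
      ... | vss , ≡.refl = found (dependent images images-∈)
        where
        open Collapse (collapseBlocks vss (Allₚ.concat⁻ vss vs∈))
        found : Dependent images → Dependent (Vec.concat vss)
        found (ds , ds-mem , ds-nz , e) = coeffs ds , coeffs-mem ds-mem , coeffs-nonZero ds-mem ds-nz ,
          trans (collapse ds) (trans (*-congʳ e) (zeroˡ β))

    adjoin : FiniteExtension
    adjoin = record
      { _∈ = _∈β
      ; ∈-mem = λ {a} p → a , 0# , ∈-mem p , ∈-mem mem-0 , sym (trans (+-congˡ (zeroˡ β)) (+-identityʳ a))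
      ; ∈-+ = λ { (a , b , a∈ , b∈ , e) (a′ , b′ , a′∈ , b′∈ , e′) → a + a′ , b + b′ , ∈-+ a∈ a′∈ , ∈-+ b∈ b′∈ ,
          trans (+-cong e e′) (solve 5 (λ a b a′ b′ β → (a :+ b :* β) :+ (a′ :+ b′ :* β) :=
            (a :+ a′) :+ (b :+ b′) :* β) refl a b a′ b′ β) }
      ; ∈-* = ∈β-*
      ; size = size ℕ.* size
      ; dependent = dependentβ
      }

    ∈-adjoin : ∀ {a} → FiniteExtension._∈ A a → FiniteExtension._∈ adjoin a
    ∈-adjoin {a} p = a , 0# , p , ∈-mem mem-0 , sym (trans (+-congˡ (zeroˡ β)) (+-identityʳ a))

    generator-∈ : FiniteExtension._∈ adjoin β
    generator-∈ = 0# , 1# , ∈-mem mem-0 , ∈-mem mem-1 , sym (trans (+-identityˡ _) (*-identityˡ β))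

  power : Carrier → ℕ → Carrier
  power u zero    = 1#
  power u (suc n) = u * power u n

  horner : ∀ {n} → Vec Carrier n → Carrier → Carrier
  horner []       f = 0#
  horner (c ∷ cs) f = c + f * horner cs f

  RootOfPolynomial : Carrier → Set
  RootOfPolynomial f = ∃ λ n → ∃ λ (cs : Vec Carrier n) → All Mem cs × NonZero cs × horner cs f ≈ 0#

  module Fractions (A : FiniteExtension) where
    open FiniteExtension A

    Fraction : Carrier → Set
    Fraction f = ∃[ u ] ∃[ v ] (u ∈ × v ∈ × Cancellable S u × u * f ≈ v)

    fraction-resp : ∀ {f g} → f ≈ g → Fraction f → Fraction g
    fraction-resp e (u , v , u∈ , v∈ , c , eq) = u , v , u∈ , v∈ , c , trans (*-congˡ (sym e)) eq

    ∈⇒fraction : ∀ {a} → a ∈ → Fraction a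
    ∈⇒fraction {a} p = 1# , a , ∈-mem mem-1 , p , cancellable-1 , *-identityˡ a

    mem⇒fraction : ∀ {a} → Mem a → Fraction a
    mem⇒fraction p = ∈⇒fraction (∈-mem p)

    fraction-+ : ∀ {f g} → Fraction f → Fraction g → Fraction (f + g)
    fraction-+ {f} {g} (u , v , u∈ , v∈ , c , e) (u′ , v′ , u′∈ , v′∈ , c′ , e′) =
      u * u′ , u′ * v + u * v′ , ∈-* u∈ u′∈ , ∈-+ (∈-* u′∈ v∈) (∈-* u∈ v′∈) , cancellable-* c c′ ,
      trans (solve 4 (λ u u′ f g → u :* u′ :* (f :+ g) := u′ :* (u :* f) :+ u :* (u′ :* g)) refl u u′ f g)
            (+-cong (*-congˡ e) (*-congˡ e′))

    fraction-* : ∀ {f g} → Fraction f → Fraction g → Fraction (f * g)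
    fraction-* {f} {g} (u , v , u∈ , v∈ , c , e) (u′ , v′ , u′∈ , v′∈ , c′ , e′) =
      u * u′ , v * v′ , ∈-* u∈ u′∈ , ∈-* v∈ v′∈ , cancellable-* c c′ ,
      trans (solve 4 (λ u u′ f g → u :* u′ :* (f :* g) := (u :* f) :* (u′ :* g)) refl u u′ f g) (*-cong e e′)

    fraction-neg : ∀ {f} → Fraction f → Fraction (- f)
    fraction-neg {f} F = fraction-resp (solve 1 (λ f → :- con 1ℤ :* f := :- f) refl f)
      (fraction-* (mem⇒fraction (mem-neg mem-1)) F)

    -- The numerator v of g turns into a denominator; it may do so because it equals u g, a product
    -- of cancellable elements.
    fraction-÷ : ∀ {f g h} → Fraction g → Fraction h → Cancellable S g → g * f ≈ h → Fraction f
    fraction-÷ {f} {g} {h} (u , v , u∈ , v∈ , c , e) (u′ , v′ , u′∈ , v′∈ , c′ , e′) cg eq =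
      v * u′ , u * v′ , ∈-* v∈ u′∈ , ∈-* u∈ v′∈ , cancellable-* (cancellable-resp e (cancellable-* c cg)) c′ , (begin
        v * u′ * f           ≈⟨ *-congʳ (*-congʳ e) ⟨
        u * g * u′ * f       ≈⟨ solve 4 (λ u g u′ f → u :* g :* u′ :* f := u :* (u′ :* (g :* f))) refl u g u′ f ⟩
        u * (u′ * (g * f))   ≈⟨ *-congˡ (*-congˡ eq) ⟩
        u * (u′ * h)         ≈⟨ *-congˡ e′ ⟩
        u * v′               ∎)

    fractions : Subring S
    fractions = record
      { Mem = Fraction ; mem-0 = mem⇒fraction mem-0 ; mem-1 = mem⇒fraction mem-1
      ; mem-+ = fraction-+ ; mem-* = fraction-* ; mem-neg = fraction-neg }

    private
      -- The family u^(n-1), u^(n-2) v, …, v^(n-1).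
      monomials : Carrier → Carrier → ∀ n → Vec Carrier n
      monomials u v zero    = []
      monomials u v (suc n) = power u n ∷ Vec.map (v *_) (monomials u v n)

      power-∈ : ∀ {u} → u ∈ → ∀ n → power u n ∈
      power-∈ p zero    = ∈-mem mem-1
      power-∈ p (suc n) = ∈-* p (power-∈ p n)

      all-map : ∀ {v n} {ws : Vec Carrier n} → v ∈ → All _∈ ws → All _∈ (Vec.map (v *_) ws)
      all-map p []       = []
      all-map p (q ∷ qs) = ∈-* p q ∷ all-map p qs

      monomials-∈ : ∀ {u v} → u ∈ → v ∈ → ∀ n → All _∈ (monomials u v n)
      monomials-∈ p q zero    = []
      monomials-∈ p q (suc n) = power-∈ p n ∷ all-map q (monomials-∈ p q n)

      power-cancellable : ∀ {u} → Cancellable S u → ∀ n → Cancellable S (power u n)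
      power-cancellable c zero    = cancellable-1
      power-cancellable c (suc n) = cancellable-* c (power-cancellable c n)

      -- The monomials have degree n - 1 in u and v. The additional factor u raises both sides to
      -- degree n, so no predecessor appears and n = 0 is included.
      homogenize : ∀ {u v f} → u * f ≈ v → ∀ {n} (cs : Vec Carrier n) →
                   comb cs (monomials u v n) * u ≈ power u n * horner cs f
      homogenize {u} {v} {f} e [] = trans (zeroˡ u) (sym (zeroʳ 1#))
      homogenize {u} {v} {f} e {suc n} (c ∷ cs) = begin
        (c * power u n + comb cs (Vec.map (v *_) (monomials u v n))) * u
          ≈⟨ *-congʳ (+-congˡ (comb-scaleʳ v cs (monomials u v n))) ⟩
        (c * power u n + v * comb cs (monomials u v n)) * u
          ≈⟨ solve 5 (λ c w v k u → (c :* w :+ v :* k) :* u := u :* (c :* w) :+ v :* (k :* u)) refl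
               c (power u n) v (comb cs (monomials u v n)) u ⟩
        u * (c * power u n) + v * (comb cs (monomials u v n) * u)
          ≈⟨ +-congˡ (*-cong (sym e) (homogenize e cs)) ⟩
        u * (c * power u n) + u * f * (power u n * horner cs f)
          ≈⟨ solve 5 (λ u c w f h → u :* (c :* w) :+ u :* f :* (w :* h) := u :* w :* (c :+ f :* h)) refl
               u c (power u n) f (horner cs f) ⟩
        u * power u n * (c + f * horner cs f) ∎

    fraction⇒root : ∀ {f} → Fraction f → RootOfPolynomial f
    fraction⇒root {f} (u , v , u∈ , v∈ , c , e) with dependent (monomials u v size) (monomials-∈ u∈ v∈ size)
    ... | cs , cs-mem , nz , comb≈0 = size , cs , cs-mem , nz , Cancellable.cancel (power-cancellable c size) (horner cs f)
      (trans (sym (homogenize e cs)) (trans (*-congʳ comb≈0) (zeroˡ u)))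

-- The deterministic evolution of sets of reachable points.

-- I a d stands for the set {a, a+1, …, a+d+1} and II a d for {a, a+2, …, a+2d}.
data State : Set where
  dead : State
  I II : ℕ → ℕ → State

init : State
init = II 0 0

double : ℕ → ℕ
double zero    = zero
double (suc d) = suc (suc (double d))

-- Negative points are cut off. Hence the minimum of a type II set jumps from 0 to 1 under `s₋` and
-- `s₋₊`, since -1 is the only point lost. The irregular entries are those at {0} and {0,1}, where
-- the result is empty or the singleton {0}, which counts as type II.
move : MStep → State → State
move s₋ dead = dead
move s₋ (II (suc a) d) = II a d
move s₋ (II 0 (suc d)) = II 1 d
move s₋ (II 0 0) = dead
move s₋ (I (suc a) d) = I a d
move s₋ (I 0 (suc d)) = I 0 d
move s₋ (I 0 0) = II 0 0
move s₀ dead = dead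
move s₀ (II a d) = II a d
move s₀ (I a d) = I a d
move s₊ dead = dead
move s₊ (II a d) = II (suc a) d
move s₊ (I a d) = I (suc a) d
move s₋₀ dead = dead
move s₋₀ (II (suc a) d) = I a (double d)
move s₋₀ (II 0 0) = II 0 0
move s₋₀ (II 0 (suc d)) = I 0 (suc (double d))
move s₋₀ (I (suc a) d) = I a (suc d)
move s₋₀ (I 0 d) = I 0 d
move s₋₊ dead = dead
move s₋₊ (II (suc a) d) = II a (suc d)
move s₋₊ (II 0 d) = II 1 d
move s₋₊ (I (suc a) d) = I a (suc (suc d))
move s₋₊ (I 0 d) = I 0 (suc d)
move s₀₊ dead = dead
move s₀₊ (II a d) = I a (double d)
move s₀₊ (I a d) = I a (suc d)
move s₋₀₊ dead = dead
move s₋₀₊ (II (suc a) d) = I a (suc (double d))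
move s₋₀₊ (II 0 d) = I 0 (double d)
move s₋₀₊ (I (suc a) d) = I a (suc (suc d))
move s₋₀₊ (I 0 d) = I 0 (suc d)

step : State → MStep → State
step σ s = move s σ

-- Weights on states and the effect of one step on them.

module Weights (R : Ring) (x y : CommutativeRing.Carrier R) where
  open CommutativeRing R
  open IntegerCoefficients R using (solve; _:=_; _:+_; _:*_; _:-_; con)

  pow : Carrier → ℕ → Carrier
  pow b zero    = 1#
  pow b (suc n) = b * pow b n

  pow-double : ∀ b d → pow b (double d) ≈ pow (b * b) d
  pow-double b zero    = refl
  pow-double b (suc d) = trans (sym (*-assoc b b _)) (*-congˡ (pow-double b d))

  -- The transfer operator in transposed form, acting on weights instead of distributions: iterated
  -- n times and evaluated at a state, it sums the weight of the final state over all walks of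
  -- length n.
  transfer : (State → Carrier) → State → Carrier
  transfer w σ = w (step σ s₋) + w (step σ s₀) + w (step σ s₊) + w (step σ s₋₀) + w (step σ s₋₊) + w (step σ s₀₊) + w (step σ s₋₀₊)

  -- Weights x^min y^max on the sets of either type, with a subscript 0 for the restriction to min = 0,
  -- and the indicators of {0} and {0,1}; the last two weigh by x^max.
  wI wI₀ wII wII₀ w[0] w[01] wMax wMaxII : State → Carrier
  wI dead      = 0#
  wI (I a d)   = pow (x * y) a * (y * pow y d)
  wI (II a d)  = 0#
  wI₀ (I 0 d)  = y * pow y d
  wI₀ _        = 0#
  wII dead     = 0#
  wII (I a d)  = 0#
  wII (II a d) = pow (x * y) a * pow (y * y) d
  wII₀ (II 0 d) = pow (y * y) d
  wII₀ _        = 0#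
  w[0] (II 0 0) = 1#
  w[0] _        = 0#
  w[01] (I 0 0) = 1#
  w[01] _       = 0#
  wMax dead     = 0#
  wMax (I a d)  = pow x a * (x * pow x d)
  wMax (II a d) = pow x a * pow (x * x) d
  wMaxII (II a d) = pow x a * pow (x * x) d
  wMaxII _        = 0#

  private
    +-cong₇ : ∀ {c₁ c₂ c₃ c₄ c₅ c₆ c₇ d₁ d₂ d₃ d₄ d₅ d₆ d₇} →
      c₁ ≈ d₁ → c₂ ≈ d₂ → c₃ ≈ d₃ → c₄ ≈ d₄ → c₅ ≈ d₅ → c₆ ≈ d₆ → c₇ ≈ d₇ →
      c₁ + c₂ + c₃ + c₄ + c₅ + c₆ + c₇ ≈ d₁ + d₂ + d₃ + d₄ + d₅ + d₆ + d₇
    +-cong₇ e₁ e₂ e₃ e₄ e₅ e₆ e₇ =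
      +-cong (+-cong (+-cong (+-cong (+-cong (+-cong e₁ e₂) e₃) e₄) e₅) e₆) e₇

  -- The maximum moves by the maximum of the step. One step has maximum -1, two have 0 and four have
  -- 1, whence 1 + 2x + 4x² after multiplication by x. The only deviation is {0}, which `s₋` kills.
  transfer-wMax : ∀ σ → x * transfer wMax σ ≈ (1# + (x + x) + (x * x + x * x + x * x + x * x)) * wMax σ - w[0] σ
  transfer-wMax dead = solve 1 (λ x → x :* (con 0ℤ :+ con 0ℤ :+ con 0ℤ :+ con 0ℤ :+ con 0ℤ :+ con 0ℤ :+ con 0ℤ)
    := (con 1ℤ :+ (x :+ x) :+ (x :* x :+ x :* x :+ x :* x :+ x :* x)) :* con 0ℤ :- con 0ℤ) refl x
  transfer-wMax (I zero zero) = solve 1 (λ x → let p = con 1ℤ ; q = con 1ℤ in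
    x :* (con 1ℤ :* con 1ℤ :+ p :* (x :* q) :+ (x :* p) :* (x :* q) :+ p :* (x :* q) :+ p :* (x :* (x :* q)) :+ p :* (x :* (x :* q)) :+ p :* (x :* (x :* q)))
    := (con 1ℤ :+ (x :+ x) :+ (x :* x :+ x :* x :+ x :* x :+ x :* x)) :* (p :* (x :* q)) :- con 0ℤ) refl x
  transfer-wMax (I zero (suc d)) = solve 2 (λ x r → let p = con 1ℤ ; q = x :* r in
    x :* (p :* (x :* r) :+ p :* (x :* q) :+ (x :* p) :* (x :* q) :+ p :* (x :* q) :+ p :* (x :* (x :* q)) :+ p :* (x :* (x :* q)) :+ p :* (x :* (x :* q)))
    := (con 1ℤ :+ (x :+ x) :+ (x :* x :+ x :* x :+ x :* x :+ x :* x)) :* (p :* (x :* q)) :- con 0ℤ) refl x (pow x d)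
  transfer-wMax (I (suc a) d) = solve 3 (λ x r q → let p = x :* r in
    x :* (r :* (x :* q) :+ p :* (x :* q) :+ (x :* p) :* (x :* q) :+ r :* (x :* (x :* q)) :+ r :* (x :* (x :* (x :* q))) :+ p :* (x :* (x :* q)) :+ r :* (x :* (x :* (x :* q))))
    := (con 1ℤ :+ (x :+ x) :+ (x :* x :+ x :* x :+ x :* x :+ x :* x)) :* (p :* (x :* q)) :- con 0ℤ) refl x (pow x a) (pow x d)
  transfer-wMax (II zero zero) = solve 1 (λ x → let o = con 1ℤ in
    x :* (con 0ℤ :+ o :* o :+ (x :* o) :* o :+ o :* o :+ (x :* o) :* o :+ o :* (x :* o) :+ o :* (x :* o))
    := (con 1ℤ :+ (x :+ x) :+ (x :* x :+ x :* x :+ x :* x :+ x :* x)) :* (o :* o) :- o) refl x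
  transfer-wMax (II zero (suc d)) = trans
    (*-congˡ (+-cong₇ refl refl refl (*-congˡ (*-congˡ (*-congˡ (pow-double x d)))) refl
       (*-congˡ (*-congˡ (pow-double x (suc d)))) (*-congˡ (*-congˡ (pow-double x (suc d))))))
    (solve 2 (λ x r → let o = con 1ℤ ; q = x :* x :* r in
    x :* ((x :* o) :* r :+ o :* q :+ (x :* o) :* q :+ o :* (x :* (x :* r)) :+ (x :* o) :* q :+ o :* (x :* q) :+ o :* (x :* q))
    := (con 1ℤ :+ (x :+ x) :+ (x :* x :+ x :* x :+ x :* x :+ x :* x)) :* (o :* q) :- con 0ℤ) refl x (pow (x * x) d))
  transfer-wMax (II (suc a) d) = trans
    (*-congˡ (+-cong₇ refl refl refl (*-congˡ (*-congˡ (pow-double x d))) refl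
       (*-congˡ (*-congˡ (pow-double x d))) (*-congˡ (*-congˡ (*-congˡ (pow-double x d))))))
    (solve 3 (λ x r q → let p = x :* r in
    x :* (r :* q :+ p :* q :+ (x :* p) :* q :+ r :* (x :* q) :+ r :* (x :* x :* q) :+ p :* (x :* q) :+ r :* (x :* (x :* q)))
    := (con 1ℤ :+ (x :+ x) :+ (x :* x :+ x :* x :+ x :* x :+ x :* x)) :* (p :* q) :- con 0ℤ) refl x (pow x a) (pow (x * x) d))

  -- Type II is regularly kept by `s₋`, `s₀`, `s₊` and `s₋₊`, which gives 1 + x + 2x². The
  -- corrections are {0} fixed by `s₋₀`, {0,1} sent to {0} by `s₋`, and {0} killed by `s₋`.
  transfer-wMaxII : ∀ σ → x * transfer wMaxII σ ≈ (1# + x + (x * x + x * x)) * wMaxII σ + x * (w[0] σ + w[01] σ) - w[0] σ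
  transfer-wMaxII dead = solve 1 (λ x → let z = con 0ℤ in x :* (z :+ z :+ z :+ z :+ z :+ z :+ z)
    := (con 1ℤ :+ x :+ (x :* x :+ x :* x)) :* z :+ x :* (z :+ z) :- z) refl x
  transfer-wMaxII (I zero zero) = solve 1 (λ x → let z = con 0ℤ ; o = con 1ℤ in x :* (o :* o :+ z :+ z :+ z :+ z :+ z :+ z)
    := (con 1ℤ :+ x :+ (x :* x :+ x :* x)) :* z :+ x :* (z :+ o) :- z) refl x
  transfer-wMaxII (I zero (suc d)) = transfer-wMaxII dead
  transfer-wMaxII (I (suc a) d) = transfer-wMaxII dead
  transfer-wMaxII (II zero zero) = solve 1 (λ x → let z = con 0ℤ ; o = con 1ℤ in
    x :* (z :+ o :* o :+ (x :* o) :* o :+ o :* o :+ (x :* o) :* o :+ z :+ z)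
    := (con 1ℤ :+ x :+ (x :* x :+ x :* x)) :* (o :* o) :+ x :* (o :+ z) :- o) refl x
  transfer-wMaxII (II zero (suc d)) = solve 2 (λ x r → let z = con 0ℤ ; o = con 1ℤ ; q = x :* x :* r in
    x :* ((x :* o) :* r :+ o :* q :+ (x :* o) :* q :+ z :+ (x :* o) :* q :+ z :+ z)
    := (con 1ℤ :+ x :+ (x :* x :+ x :* x)) :* (o :* q) :+ x :* (z :+ z) :- z) refl x (pow (x * x) d)
  transfer-wMaxII (II (suc a) d) = solve 3 (λ x r q → let z = con 0ℤ ; p = x :* r in
    x :* (r :* q :+ p :* q :+ (x :* p) :* q :+ z :+ r :* (x :* x :* q) :+ z :+ z)
    := (con 1ℤ :+ x :+ (x :* x :+ x :* x)) :* (p :* q) :+ x :* (z :+ z) :- z) refl x (pow x a) (pow (x * x) d)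

  -- Away from 0 the four parity-preserving steps contribute 1, u, u² and y², with u = x y. At
  -- minimum 0 the steps `s₋` and `s₋₊` lead to minimum 1 instead of -1, an extra factor x² on 1 +
  -- y². The corrections at {0} and {0,1} are as for `transfer-wMaxII`, where the dying {0} has been
  -- counted with weight x².
  transfer-wII : ∀ σ → (x * y) * transfer wII σ ≈
    (1# + x * y + (x * y) * (x * y) + y * y) * wII σ + (1# + y * y) * (x * x - 1#) * wII₀ σ
    + x * y * (w[0] σ + w[01] σ) - x * x * w[0] σ
  transfer-wII dead = solve 2 (λ x y → let z = con 0ℤ in (x :* y) :* (z :+ z :+ z :+ z :+ z :+ z :+ z) :=
    (con 1ℤ :+ x :* y :+ (x :* y) :* (x :* y) :+ y :* y) :* z :+ (con 1ℤ :+ y :* y) :* (x :* x :- con 1ℤ) :* z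
    :+ x :* y :* (z :+ z) :- x :* x :* z) refl x y
  transfer-wII (I zero zero) = solve 2 (λ x y → let z = con 0ℤ ; o = con 1ℤ in (x :* y) :* (o :* o :+ z :+ z :+ z :+ z :+ z :+ z) :=
    (con 1ℤ :+ x :* y :+ (x :* y) :* (x :* y) :+ y :* y) :* z :+ (con 1ℤ :+ y :* y) :* (x :* x :- con 1ℤ) :* z
    :+ x :* y :* (z :+ o) :- x :* x :* z) refl x y
  transfer-wII (I zero (suc d)) = transfer-wII dead
  transfer-wII (I (suc a) d) = transfer-wII dead
  transfer-wII (II zero zero) = solve 2 (λ x y → let z = con 0ℤ ; o = con 1ℤ in
    (x :* y) :* (z :+ o :* o :+ (x :* y :* o) :* o :+ o :* o :+ (x :* y :* o) :* o :+ z :+ z) :=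
    (con 1ℤ :+ x :* y :+ (x :* y) :* (x :* y) :+ y :* y) :* (o :* o) :+ (con 1ℤ :+ y :* y) :* (x :* x :- con 1ℤ) :* o
    :+ x :* y :* (o :+ z) :- x :* x :* o) refl x y
  transfer-wII (II zero (suc d)) = solve 3 (λ x y r → let z = con 0ℤ ; o = con 1ℤ ; q = y :* y :* r in
    (x :* y) :* ((x :* y :* o) :* r :+ o :* q :+ (x :* y :* o) :* q :+ z :+ (x :* y :* o) :* q :+ z :+ z) :=
    (con 1ℤ :+ x :* y :+ (x :* y) :* (x :* y) :+ y :* y) :* (o :* q) :+ (con 1ℤ :+ y :* y) :* (x :* x :- con 1ℤ) :* q
    :+ x :* y :* (z :+ z) :- x :* x :* z) refl x y (pow (y * y) d)
  transfer-wII (II (suc a) d) = solve 4 (λ x y r q → let z = con 0ℤ ; p = x :* y :* r in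
    (x :* y) :* (r :* q :+ p :* q :+ (x :* y :* p) :* q :+ z :+ r :* (y :* y :* q) :+ z :+ z) :=
    (con 1ℤ :+ x :* y :+ (x :* y) :* (x :* y) :+ y :* y) :* (p :* q) :+ (con 1ℤ :+ y :* y) :* (x :* x :- con 1ℤ) :* z
    :+ x :* y :* (z :+ z) :- x :* x :* z) refl x y (pow (x * y) a) (pow (y * y) d)

  -- From type I all seven steps contribute, from type II the three that mix parities. At minimum 0
  -- the steps containing -1 leave the minimum at 0 instead of -1, hence the factors x - 1. The last
  -- term removes {0} under `s₋₀` and {0,1} under `s₋`: the general pattern would count both results
  -- as type I with minimum and maximum 0, although they are singletons.
  transfer-wI : ∀ σ → (x * y) * transfer wI σ ≈
    (1# + y + (y * y + y * y) + x * y * (1# + y) + (x * y) * (x * y)) * wI σ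
    + (x - 1#) * (1# + y + (y * y + y * y)) * wI₀ σ
    + (y + y * y + x * (y * y)) * wII σ + (x - 1#) * (y + y * y) * wII₀ σ
    - x * y * (w[0] σ + w[01] σ)
  transfer-wI dead = solve 2 (λ x y → let z = con 0ℤ ; o = con 1ℤ in (x :* y) :* (z :+ z :+ z :+ z :+ z :+ z :+ z) :=
    (o :+ y :+ (y :* y :+ y :* y) :+ x :* y :* (o :+ y) :+ (x :* y) :* (x :* y)) :* z
    :+ (x :- o) :* (o :+ y :+ (y :* y :+ y :* y)) :* z
    :+ (y :+ y :* y :+ x :* (y :* y)) :* z :+ (x :- o) :* (y :+ y :* y) :* z :- x :* y :* (z :+ z)) refl x y
  transfer-wI (I zero zero) = solve 2 (λ x y → let z = con 0ℤ ; o = con 1ℤ ; p = o ; q = o in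
    (x :* y) :* (z :+ p :* (y :* q) :+ (x :* y :* p) :* (y :* q) :+ p :* (y :* q) :+ p :* (y :* (y :* q))
      :+ p :* (y :* (y :* q)) :+ p :* (y :* (y :* q))) :=
    (o :+ y :+ (y :* y :+ y :* y) :+ x :* y :* (o :+ y) :+ (x :* y) :* (x :* y)) :* (p :* (y :* q))
    :+ (x :- o) :* (o :+ y :+ (y :* y :+ y :* y)) :* (y :* q)
    :+ (y :+ y :* y :+ x :* (y :* y)) :* z :+ (x :- o) :* (y :+ y :* y) :* z :- x :* y :* (z :+ o)) refl x y
  transfer-wI (I zero (suc d)) = solve 3 (λ x y r → let z = con 0ℤ ; o = con 1ℤ ; p = o ; q = y :* r in
    (x :* y) :* (p :* (y :* r) :+ p :* (y :* q) :+ (x :* y :* p) :* (y :* q) :+ p :* (y :* q) :+ p :* (y :* (y :* q))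
      :+ p :* (y :* (y :* q)) :+ p :* (y :* (y :* q))) :=
    (o :+ y :+ (y :* y :+ y :* y) :+ x :* y :* (o :+ y) :+ (x :* y) :* (x :* y)) :* (p :* (y :* q))
    :+ (x :- o) :* (o :+ y :+ (y :* y :+ y :* y)) :* (y :* q)
    :+ (y :+ y :* y :+ x :* (y :* y)) :* z :+ (x :- o) :* (y :+ y :* y) :* z :- x :* y :* (z :+ z)) refl x y (pow y d)
  transfer-wI (I (suc a) d) = solve 4 (λ x y r q → let z = con 0ℤ ; o = con 1ℤ ; p = x :* y :* r in
    (x :* y) :* (r :* (y :* q) :+ p :* (y :* q) :+ (x :* y :* p) :* (y :* q) :+ r :* (y :* (y :* q))
      :+ r :* (y :* (y :* (y :* q))) :+ p :* (y :* (y :* q)) :+ r :* (y :* (y :* (y :* q)))) :=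
    (o :+ y :+ (y :* y :+ y :* y) :+ x :* y :* (o :+ y) :+ (x :* y) :* (x :* y)) :* (p :* (y :* q))
    :+ (x :- o) :* (o :+ y :+ (y :* y :+ y :* y)) :* z
    :+ (y :+ y :* y :+ x :* (y :* y)) :* z :+ (x :- o) :* (y :+ y :* y) :* z :- x :* y :* (z :+ z)) refl
    x y (pow (x * y) a) (pow y d)
  transfer-wI (II zero zero) = solve 2 (λ x y → let z = con 0ℤ ; o = con 1ℤ in
    (x :* y) :* (z :+ z :+ z :+ z :+ z :+ o :* (y :* o) :+ o :* (y :* o)) :=
    (o :+ y :+ (y :* y :+ y :* y) :+ x :* y :* (o :+ y) :+ (x :* y) :* (x :* y)) :* z
    :+ (x :- o) :* (o :+ y :+ (y :* y :+ y :* y)) :* z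
    :+ (y :+ y :* y :+ x :* (y :* y)) :* (o :* o) :+ (x :- o) :* (y :+ y :* y) :* o :- x :* y :* (o :+ z)) refl x y
  transfer-wI (II zero (suc d)) = trans
    (*-congˡ (+-cong₇ refl refl refl (*-congˡ (*-congˡ (*-congˡ (pow-double y d)))) refl
       (*-congˡ (*-congˡ (pow-double y (suc d)))) (*-congˡ (*-congˡ (pow-double y (suc d))))))
    (solve 3 (λ x y r → let z = con 0ℤ ; o = con 1ℤ ; q = y :* y :* r in
    (x :* y) :* (z :+ z :+ z :+ o :* (y :* (y :* r)) :+ z :+ o :* (y :* q) :+ o :* (y :* q)) :=
    (o :+ y :+ (y :* y :+ y :* y) :+ x :* y :* (o :+ y) :+ (x :* y) :* (x :* y)) :* z
    :+ (x :- o) :* (o :+ y :+ (y :* y :+ y :* y)) :* z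
    :+ (y :+ y :* y :+ x :* (y :* y)) :* (o :* q) :+ (x :- o) :* (y :+ y :* y) :* q :- x :* y :* (z :+ z)) refl
    x y (pow (y * y) d))
  transfer-wI (II (suc a) d) = trans
    (*-congˡ (+-cong₇ refl refl refl (*-congˡ (*-congˡ (pow-double y d))) refl
       (*-congˡ (*-congˡ (pow-double y d))) (*-congˡ (*-congˡ (*-congˡ (pow-double y d))))))
    (solve 4 (λ x y r q → let z = con 0ℤ ; o = con 1ℤ ; p = x :* y :* r in
    (x :* y) :* (z :+ z :+ z :+ r :* (y :* q) :+ z :+ p :* (y :* q) :+ r :* (y :* (y :* q))) :=
    (o :+ y :+ (y :* y :+ y :* y) :+ x :* y :* (o :+ y) :+ (x :* y) :* (x :* y)) :* z
    :+ (x :- o) :* (o :+ y :+ (y :* y :+ y :* y)) :* z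
    :+ (y :+ y :* y :+ x :* (y :* y)) :* (p :* q) :+ (x :- o) :* (y :+ y :* y) :* z :- x :* y :* (z :+ z)) refl
    x y (pow (x * y) a) (pow (y * y) d))

-- The kernel method for quadratic kernels.

module Congruence (R : Ring) (d : CommutativeRing.Carrier R) where
  open CommutativeRing R
  open IntegerCoefficients R using (solve; _:=_; _:+_; _:*_; _:-_; :-_; con)

  infix 4 _~_
  _~_ : Carrier → Carrier → Set
  f ~ g = ∃ λ q → f ≈ g + d * q

  ~-reflexive : ∀ {f g} → f ≈ g → f ~ g
  ~-reflexive {f} {g} e = 0# , trans e (solve 2 (λ g d → g := g :+ d :* con 0ℤ) refl g d)

  ~-refl : ∀ {f} → f ~ f
  ~-refl = ~-reflexive refl

  ~-+ : ∀ {f g f′ g′} → f ~ g → f′ ~ g′ → f + f′ ~ g + g′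
  ~-+ {g = g} {g′ = g′} (q , e) (q′ , e′) = q + q′ , trans (+-cong e e′)
    (solve 5 (λ g g′ d q q′ → (g :+ d :* q) :+ (g′ :+ d :* q′) := (g :+ g′) :+ d :* (q :+ q′)) refl g g′ d q q′)

  ~-neg : ∀ {f g} → f ~ g → - f ~ - g
  ~-neg {g = g} (q , e) = - q , trans (-‿cong e)
    (solve 3 (λ g d q → :- (g :+ d :* q) := :- g :+ d :* (:- q)) refl g d q)

  ~-* : ∀ {f g f′ g′} → f ~ g → f′ ~ g′ → f * f′ ~ g * g′
  ~-* {g = g} {g′ = g′} (q , e) (q′ , e′) = q * (g′ + d * q′) + g * q′ , trans (*-cong e e′)
    (solve 5 (λ g g′ d q q′ → (g :+ d :* q) :* (g′ :+ d :* q′) :=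
      g :* g′ :+ d :* (q :* (g′ :+ d :* q′) :+ g :* q′)) refl g g′ d q q′)

  multiple : ∀ {f g h} → f ≈ d * h → f ~ g → ∃ λ q → d * q ≈ g
  multiple {f} {g} {h} e (q , e′) = h - q , trans
    (solve 4 (λ d h q g → d :* (h :- q) := (d :* h) :- d :* q) refl d h q g)
    (trans (+-congʳ (trans (sym e) e′)) (solve 3 (λ d q g → (g :+ d :* q) :- d :* q := g) refl d q g))

module Kernels (R : Ring) where
  open CommutativeRing R
  open IntegerCoefficients R using (solve; _:=_; _:+_; _:*_; _:-_; :-_; con)
  open Relation.Binary.Reasoning.Setoid setoid

  quadratic : Carrier → Carrier → Carrier → Carrier → Carrier
  quadratic γ δ ε v = γ + δ * v + ε * (v * v)

  module _ {t γ δ ε r : Carrier} (root : r ≈ t * quadratic γ δ ε r) where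
    kernel-factor : ∀ u → u - t * quadratic γ δ ε u ≈ (u - r) * (1# - t * δ - t * ε * (u + r))
    kernel-factor u = begin
      u - t * quadratic γ δ ε u
        ≈⟨ solve 6 (λ u r t γ δ ε → u :- t :* (γ :+ δ :* u :+ ε :* (u :* u)) :=
             (u :- r) :* (con 1ℤ :- t :* δ :- t :* ε :* (u :+ r)) :+ (r :- t :* (γ :+ δ :* r :+ ε :* (r :* r)))) refl u r t γ δ ε ⟩
      (u - r) * (1# - t * δ - t * ε * (u + r)) + (r - t * quadratic γ δ ε r)
        ≈⟨ +-congˡ (+-congʳ root) ⟩
      (u - r) * (1# - t * δ - t * ε * (u + r)) + (t * quadratic γ δ ε r - t * quadratic γ δ ε r)
        ≈⟨ trans (+-congˡ (-‿inverseʳ _)) (+-identityʳ _) ⟩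
      (u - r) * (1# - t * δ - t * ε * (u + r)) ∎

    -- The quadratic equation of r has leading coefficient t ε. Scaling r by it makes the equation
    -- monic, which `adjoin` requires.
    scaled-root : (t * ε * r) * (t * ε * r) ≈ (1# - t * δ) * (t * ε * r) + - (t * ε * (t * γ))
    scaled-root = begin
      (t * ε * r) * (t * ε * r)
        ≈⟨ solve 5 (λ t γ δ ε r → (t :* ε :* r) :* (t :* ε :* r) :=
             t :* ε :* (t :* (γ :+ δ :* r :+ ε :* (r :* r)) :- t :* γ :- t :* δ :* r)) refl t γ δ ε r ⟩
      t * ε * (t * quadratic γ δ ε r - t * γ - t * δ * r)
        ≈⟨ *-congˡ (+-congʳ (+-congʳ root)) ⟨
      t * ε * (r - t * γ - t * δ * r)
        ≈⟨ solve 5 (λ t γ δ ε r → t :* ε :* (r :- t :* γ :- t :* δ :* r) :=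
             (con 1ℤ :- t :* δ) :* (t :* ε :* r) :+ :- (t :* ε :* (t :* γ))) refl t γ δ ε r ⟩
      (1# - t * δ) * (t * ε * r) + - (t * ε * (t * γ)) ∎

    -- The substitution step of the kernel method: the kernel is a multiple of u - r, so the
    -- left-hand side vanishes modulo u - r, and g will be n with r in place of u.
    reduce-mod-root : ∀ {u k f g n} → k ≈ quadratic γ δ ε u → (u - t * k) * f ≈ n →
      Congruence._~_ R (u - r) n g → ∃ λ h → (u - r) * h ≈ g
    reduce-mod-root {u} {f = f} ek e n~g = Congruence.multiple R (u - r)
      (trans (sym e) (trans (*-congʳ (trans (+-congˡ (-‿cong (*-congˡ ek))) (kernel-factor u))) (*-assoc _ _ f))) n~g

  quadratic-mem : ∀ (Q : Subring R) {γ δ ε v} → let open Subring Q in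
                  Mem γ → Mem δ → Mem ε → Mem v → Mem (quadratic γ δ ε v)
  quadratic-mem Q p q r s = mem-+ (mem-+ p (mem-* q s)) (mem-* r (mem-* s s))
    where open Subring Q

module Roots (R : Ring) where
  private module R = CommutativeRing R
  open PowerSeries R
  private module PSR = CommutativeRing ring
  open Kernels ring using (quadratic; quadratic-mem)

  module _ (γ δ ε : PS) where
    private
      Φ : PS → PS
      Φ f = var ✶ quadratic γ δ ε f

      contractive : Contractive Φ
      contractive {f} {g} k p zero n<k = R.trans (var-✶ (quadratic γ δ ε f) 0) (R.sym (var-✶ (quadratic γ δ ε g) 0))
      contractive {f} {g} k p (suc n) (s≤s n<k) = R.trans (var-✶ (quadratic γ δ ε f) (suc n)) (R.trans
        (R.+-cong (R.+-congˡ {γ n} (✶-cong-< {δ} {δ} k (λ _ _ → R.refl) p n n<k))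
                  (✶-cong-< {ε} {ε} k (λ _ _ → R.refl) (✶-cong-< k p p) n n<k))
        (R.sym (var-✶ (quadratic γ δ ε g) (suc n))))

    root : PS
    root = fix Φ

    root-≋ : root ≋ var ✶ quadratic γ δ ε root
    root-≋ = fix-≋ contractive

    root-head : root 0 R.≈ R.0#
    root-head = var-✶ (quadratic γ δ ε (λ _ → R.0#)) 0

    root-mem : (Q : Subring R) → let open PowerSeriesSubring R Q in
               Coefficientwise γ → Coefficientwise δ → Coefficientwise ε → Coefficientwise root
    root-mem Q γ-mem δ-mem ε-mem = coefficientwise λ n → Coefficientwise.coefficients (iterates (suc n)) n
      where
      open PowerSeriesSubring R Q
      open Subring series
      iterates : ∀ k → Coefficientwise (iterate Φ k)
      iterates zero    = mem-0
      iterates (suc k) = mem-* (coefficientwise var-mem) (quadratic-mem series γ-mem δ-mem ε-mem (iterates k))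

module _ (R : Ring) (Q : Subring R) where
  private
    module R = CommutativeRing R
    module S = CommutativeRing (PowerSeries.ring R)
  open PowerSeriesSubring R Q using (Coefficientwise)

  -- With Q read as the elements free of x: a multiple of u - r that is free of x must vanish. This
  -- is the conclusion normally drawn from setting u = r.
  KernelRoot : R.Carrier → Set
  KernelRoot u = ∀ {r h c} → Coefficientwise r → r 0 R.≈ R.0# → Coefficientwise c →
                 (PowerSeries.const R u S.- r) S.* h S.≈ c → c S.≈ S.0#

module KernelMethod (B : Ring) where
  private
    module B = CommutativeRing B
    module X = PowerSeries B
    module S = PowerSeries X.ring
    module XR = CommutativeRing X.ring
    module SR = CommutativeRing S.ring

  record Constant (c : X.PS) : Set where
    constructor constant
    field tail-zero : ∀ a → c (suc a) B.≈ B.0#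
  open Constant

  private
    δ : S.PS → S.PS
    δ f n a = f n (suc a)

    ✶-constant : ∀ {c} h → Constant c → ∀ a → (c X.✶ h) (suc a) B.≈ (c X.✶ X.tail h) a
    ✶-constant {c} h p a = B.trans (B.trans (B.+-congˡ (X.✶-zeroˡ h (tail-zero p) a)) (B.+-identityʳ _))
      (B.sym (B.trans (X.✶-cong c≋ (λ _ → B.refl) a) (X.const-✶ (c 0) (X.tail h) a)))
      where
      c≋ : c X.≋ X.const (c 0)
      c≋ zero    = B.refl
      c≋ (suc a) = tail-zero p a

  constants : Subring X.ring
  constants = record
    { Mem = Constant
    ; mem-0 = constant λ a → B.refl
    ; mem-1 = constant λ a → B.refl
    ; mem-+ = λ p q → constant λ a → B.trans (B.+-cong (tail-zero p a) (tail-zero q a)) (B.+-identityˡ B.0#)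
    ; mem-* = λ {f} {g} p q → constant λ a → B.trans (✶-constant g p a)
        (B.trans (X.✶-comm f (X.tail g) a) (X.✶-zeroˡ f (tail-zero q) a))
    ; mem-neg = λ p → constant λ a → B.trans (B.-‿cong (tail-zero p a)) (Algebra.Properties.Ring.-0#≈0# B.ring)
    }

  open PowerSeriesSubring X.ring constants

  private
    ✶-coefficientwise : ∀ {f} g → (∀ n → Constant (f n)) → ∀ n a → (f S.✶ g) n (suc a) B.≈ (f S.✶ δ g) n a
    ✶-coefficientwise g p zero    a = ✶-constant (g 0) (p 0) a
    ✶-coefficientwise g p (suc n) a = B.+-cong (✶-constant (g (suc n)) (p 0) a)
      (✶-coefficientwise g (λ k → p (suc k)) n a)

  -- Comparing coefficients of x^(a+1) in (m x - r) h = c gives m h = r (h shifted by x); since t divides r,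
  -- h vanishes modulo every power of t.
  kernel-root : ∀ {u m} → (∀ f → u X.✶ f X.≋ X.z· (m X.∙ f)) → Cancellable B m → KernelRoot X.ring constants u
  kernel-root {u} {m} u-shift m-canc {r} {h} {c} r-free r₀ c-free e =
    SR.trans (SR.sym e) (SR.trans (SR.*-congˡ {S.const u SR.- r} h≈0) (SR.zeroʳ (S.const u SR.- r)))
    where
    open IntegerCoefficients B using (solve; _:=_; _:+_; _:-_)
    open Relation.Binary.Reasoning.Setoid B.setoid

    shifted : ∀ n a → m B.* h n a B.≈ (r S.✶ δ h) n a
    shifted n a = begin
      m B.* h n a
        ≈⟨ u-shift (h n) (suc a) ⟨
      (u X.✶ h n) (suc a)
        ≈⟨ S.const-✶ u h n (suc a) ⟨
      (S.const u S.✶ h) n (suc a)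
        ≈⟨ SR.trans split (SR.+-congʳ {r SR.* h} e) n (suc a) ⟩
      c n (suc a) B.+ (r S.✶ h) n (suc a)
        ≈⟨ B.trans (B.+-congʳ (tail-zero (Coefficientwise.coefficients c-free n) a)) (B.+-identityˡ _) ⟩
      (r S.✶ h) n (suc a)
        ≈⟨ ✶-coefficientwise h (Coefficientwise.coefficients r-free) n a ⟩
      (r S.✶ δ h) n a ∎
      where
      split : S.const u SR.* h SR.≈ (S.const u SR.- r) SR.* h SR.+ r SR.* h
      split = solveS 3 (λ u r h → u :*ₛ h :=ₛ (u :-ₛ r) :*ₛ h :+ₛ r :*ₛ h) SR.refl (S.const u) r h
        where open IntegerCoefficients S.ring using () renaming
                (solve to solveS; _:=_ to _:=ₛ_; _:+_ to _:+ₛ_; _:*_ to _:*ₛ_; _:-_ to _:-ₛ_)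

    vanish≤ : ∀ n k → k ℕ.≤ n → h k XR.≈ XR.0#
    vanish-at : ∀ n → h n XR.≈ XR.0#
    vanish-at zero a = Cancellable.cancel m-canc (h 0 a) (B.trans (shifted 0 a) (X.✶-zeroˡ (δ h 0) r₀ a))
    vanish-at (suc n) a = Cancellable.cancel m-canc (h (suc n) a) (B.trans (shifted (suc n) a) (B.trans
      (B.+-cong (X.✶-zeroˡ (δ h (suc n)) r₀ a)
                (S.✶-vanish (S.tail r) {δ h} n (λ k k≤n b → vanish≤ n k k≤n (suc b)) a))
      (B.+-identityˡ B.0#)))
    vanish≤ zero    zero    _ = vanish-at zero
    vanish≤ (suc n) k k≤sn = [ (λ k<sn → vanish≤ n k (ℕₚ.≤-pred k<sn))
                             , (λ k≡sn → ≡.subst (λ i → h i XR.≈ XR.0#) (≡.sym k≡sn) (vanish-at (suc n))) ]′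
                             (ℕₚ.m≤n⇒m<n∨m≡n k≤sn)

    h≈0 : h SR.≈ SR.0#
    h≈0 n = vanish-at n

-- Generating functions of weights and their functional equations.

module GeneratingFunctions (R : Ring) (x y : CommutativeRing.Carrier R) where
  private
    module R = CommutativeRing R
    module RI = IntegerCoefficients R
  open PowerSeries R
  open Weights R x y
  open CommutativeRing ring hiding (ring)
  open IntegerCoefficients ring using (solve; _:=_; _:+_; _:*_; _:-_; :-_; con)
  open Kernels ring using (quadratic)

  Weight : Set
  Weight = State → R.Carrier

  transfer^ : ℕ → Weight → Weight
  transfer^ zero    w = w
  transfer^ (suc n) w = transfer (transfer^ n w)

  gen : Weight → PS
  gen w n = transfer^ n w init

  transfer-related : (Q : R.Carrier → R.Carrier → Set) → (∀ {a a′ b b′} → Q a a′ → Q b b′ → Q (a R.+ b) (a′ R.+ b′)) →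
              ∀ {w v} → (∀ σ → Q (w σ) (v σ)) → ∀ σ → Q (transfer w σ) (transfer v σ)
  transfer-related Q Q-+ q σ = Q-+ (Q-+ (Q-+ (Q-+ (Q-+ (Q-+ (q _) (q _)) (q _)) (q _)) (q _)) (q _)) (q _)

  -- One induction that covers congruence, comparison of the coefficients at x = 0 and, when the
  -- second argument is ignored, closure in a subring.
  transfer^-related : (Q : R.Carrier → R.Carrier → Set) → (∀ {a a′ b b′} → Q a a′ → Q b b′ → Q (a R.+ b) (a′ R.+ b′)) →
               ∀ {w v} → (∀ σ → Q (w σ) (v σ)) → ∀ n σ → Q (transfer^ n w σ) (transfer^ n v σ)
  transfer^-related Q Q-+ q zero    = q
  transfer^-related Q Q-+ q (suc n) = transfer-related Q Q-+ (transfer^-related Q Q-+ q n)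

  transfer-cong : ∀ {w v} → (∀ σ → w σ R.≈ v σ) → ∀ σ → transfer w σ R.≈ transfer v σ
  transfer-cong = transfer-related R._≈_ R.+-cong

  transfer^-cong : ∀ n {w v} → (∀ σ → w σ R.≈ v σ) → ∀ σ → transfer^ n w σ R.≈ transfer^ n v σ
  transfer^-cong n p = transfer^-related R._≈_ R.+-cong p n

  -- `transfer^` splits off the first step of a walk, whereas the one-step identities apply to the
  -- last one.
  transfer^-suc : ∀ n w σ → transfer^ (suc n) w σ R.≈ transfer^ n (transfer w) σ
  transfer^-suc zero    w σ = R.refl
  transfer^-suc (suc n) w σ = transfer-cong (transfer^-suc n w) σ

  transfer^-+ : ∀ n w v σ → transfer^ n (λ τ → w τ R.+ v τ) σ R.≈ transfer^ n w σ R.+ transfer^ n v σ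
  transfer^-+ zero    w v σ = R.refl
  transfer^-+ (suc n) w v σ = R.trans (transfer-cong (transfer^-+ n w v) σ) (RI.solve 14
    (λ a b c d e f g a′ b′ c′ d′ e′ f′ g′ →
      (a RI.:+ a′) RI.:+ (b RI.:+ b′) RI.:+ (c RI.:+ c′) RI.:+ (d RI.:+ d′) RI.:+ (e RI.:+ e′) RI.:+ (f RI.:+ f′) RI.:+ (g RI.:+ g′)
      RI.:= (a RI.:+ b RI.:+ c RI.:+ d RI.:+ e RI.:+ f RI.:+ g) RI.:+ (a′ RI.:+ b′ RI.:+ c′ RI.:+ d′ RI.:+ e′ RI.:+ f′ RI.:+ g′))
    R.refl _ _ _ _ _ _ _ _ _ _ _ _ _ _)

  transfer^-* : ∀ n c w σ → transfer^ n (λ τ → c R.* w τ) σ R.≈ c R.* transfer^ n w σ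
  transfer^-* zero    c w σ = R.refl
  transfer^-* (suc n) c w σ = R.trans (transfer-cong (transfer^-* n c w) σ) (RI.solve 8
    (λ k a b c d e f g →
      k RI.:* a RI.:+ k RI.:* b RI.:+ k RI.:* c RI.:+ k RI.:* d RI.:+ k RI.:* e RI.:+ k RI.:* f RI.:+ k RI.:* g
      RI.:= k RI.:* (a RI.:+ b RI.:+ c RI.:+ d RI.:+ e RI.:+ f RI.:+ g))
    R.refl c _ _ _ _ _ _ _)

  gen-cong : ∀ {w v} → (∀ σ → w σ R.≈ v σ) → gen w ≈ gen v
  gen-cong p n = transfer^-cong n p init

  gen-+ : ∀ w v → gen (λ σ → w σ R.+ v σ) ≈ gen w + gen v
  gen-+ w v n = transfer^-+ n w v init

  gen-* : ∀ c w → gen (λ σ → c R.* w σ) ≈ const c * gen w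
  gen-* c w n = R.trans (transfer^-* n c w init) (R.sym (const-✶ c (gen w) n))

  gen-neg : ∀ w → gen (λ σ → R.- w σ) ≈ - gen w
  gen-neg w = trans (gen-cong (λ σ → RI.solve 1 (λ a → RI.:- a RI.:= RI.:- RI.con 1ℤ RI.:* a) R.refl (w σ)))
    (trans (gen-* (R.- R.1#) w) (trans (*-congʳ {gen w} (const-neg R.1#))
      (solve 1 (λ a → :- con 1ℤ :* a := :- a) refl (gen w))))

  gen-unfold : ∀ w → gen w ≈ const (w init) + var * gen (transfer w)
  gen-unfold w zero    = R.sym (R.trans (R.+-congˡ (var-✶ (gen (transfer w)) 0)) (R.+-identityʳ _))
  gen-unfold w (suc n) = R.trans (transfer^-suc n w init)
    (R.sym (R.trans (R.+-identityˡ _) (var-✶ (gen (transfer w)) (suc n))))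

  -- Turns an identity for a single step into a functional equation. The factor u clears the
  -- negative exponents caused by steps downwards.
  gen-kernel : ∀ u {w v} → (∀ σ → u R.* transfer w σ R.≈ v σ) → const u * gen w ≈ const (u R.* w init) + var * gen v
  gen-kernel u {w} {v} p = begin
    const u * gen w
      ≈⟨ *-congˡ {const u} (gen-unfold w) ⟩
    const u * (const (w init) + var * gen (transfer w))
      ≈⟨ solve 4 (λ u i t g → u :* (i :+ t :* g) := u :* i :+ t :* (u :* g)) refl
           (const u) (const (w init)) var (gen (transfer w)) ⟩
    const u * const (w init) + var * (const u * gen (transfer w))
      ≈⟨ +-cong (sym (const-* u (w init))) (*-congˡ {var} (trans (sym (gen-* u (transfer w))) (gen-cong p))) ⟩
    const (u R.* w init) + var * gen v ∎
    where open Relation.Binary.Reasoning.Setoid setoid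

  gen-closed : (Q : R.Carrier → Set) → (∀ {a b} → Q a → Q b → Q (a R.+ b)) →
               ∀ {w} → (∀ σ → Q (w σ)) → ∀ n → Q (gen w n)
  gen-closed Q Q-+ p n = transfer^-related (λ a _ → Q a) Q-+ {v = λ _ → R.0#} p n init

  infix 4 _↦_
  -- A small calculus for pushing `const` through ring expressions, used to compute the kernels.
  _↦_ : R.Carrier → PS → Set
  a ↦ f = const a ≈ f

  ↦-1 : R.1# ↦ 1#
  ↦-1 = refl

  ↦-const : ∀ {a} → a ↦ const a
  ↦-const = refl

  ↦-+ : ∀ {a b f g} → a ↦ f → b ↦ g → a R.+ b ↦ f + g
  ↦-+ {a} {b} p q = trans (const-+ a b) (+-cong p q)

  ↦-* : ∀ {a b f g} → a ↦ f → b ↦ g → a R.* b ↦ f * g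
  ↦-* {a} {b} p q = trans (const-* a b) (*-cong p q)

  ↦-- : ∀ {a b f g} → a ↦ f → b ↦ g → a R.- b ↦ f - g
  ↦-- {a} {b} p q = trans (const-+ a (R.- b)) (+-cong p (trans (const-neg b) (-‿cong q)))

  private
    gen-+≈ : ∀ {w v f g} → gen w ≈ f → gen v ≈ g → gen (λ σ → w σ R.+ v σ) ≈ f + g
    gen-+≈ {w} {v} p q = trans (gen-+ w v) (+-cong p q)

    gen--≈ : ∀ {w v f g} → gen w ≈ f → gen v ≈ g → gen (λ σ → w σ R.- v σ) ≈ f - g
    gen--≈ {w} {v} p q = trans (gen-+ w (λ σ → R.- v σ)) (+-cong p (trans (gen-neg v) (-‿cong q)))

    gen-*≈ : ∀ {c k w f} → c ↦ k → gen w ≈ f → gen (λ σ → c R.* w σ) ≈ k * f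
    gen-*≈ {c} {w = w} p q = trans (gen-* c w) (*-cong p q)

  t x̂ ŷ û : PS
  t = var
  x̂ = const x
  ŷ = const y
  û = const (x R.* y)

  û≈ : û ≈ x̂ * ŷ
  û≈ = const-* x y

  GI GI₀ GII GII₀ G[0] G[01] GMax GMaxII c : PS
  GI = gen wI
  GI₀ = gen wI₀
  GII = gen wII
  GII₀ = gen wII₀
  G[0] = gen w[0]
  G[01] = gen w[01]
  GMax = gen wMax
  GMaxII = gen wMaxII
  c = 1# + t * (G[0] + G[01])

  two four : PS
  two  = 1# + 1#
  four = two + two

  1+y² 1+y+2y² : PS
  1+y² = 1# + ŷ * ŷ
  1+y+2y² = 1# + ŷ + (ŷ * ŷ + ŷ * ŷ)

  private
    kernel-form : ∀ {u i k g n r} → u * g ≈ i + t * (k * g + n) → i + t * n ≈ r → (u - t * k) * g ≈ r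
    kernel-form {u} {i} {k} {g} {n} {r} e e′ = begin
      (u - t * k) * g                   ≈⟨ solve 4 (λ u t k g → (u :- t :* k) :* g := u :* g :- t :* (k :* g)) refl u t k g ⟩
      u * g - t * (k * g)               ≈⟨ +-congʳ e ⟩
      i + t * (k * g + n) - t * (k * g) ≈⟨ solve 4 (λ i t a n → i :+ t :* (a :+ n) :- t :* a := i :+ t :* n) refl i t (k * g) n ⟩
      i + t * n                         ≈⟨ e′ ⟩
      r                                 ∎
      where open Relation.Binary.Reasoning.Setoid setoid

  -- Here x marks the maximum. The right-hand side is linear in x, so the kernel root will turn out
  -- to be t `G[0]` itself.
  GMax-equation : (x̂ - t * quadratic 1# two four x̂) * GMax ≈ x̂ - t * G[0]
  GMax-equation = kernel-form
    (trans (gen-kernel x transfer-wMax) (+-cong (const-cong init-weight) (*-congˡ {t}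
      (trans (gen--≈ {λ σ → _ R.* wMax σ} {w[0]} (gen-*≈ {w = wMax} kernel refl) refl) refl))))
    (solve 3 (λ x t g → x :+ t :* (:- g) := x :- t :* g) refl x̂ t G[0])
    where
    init-weight : x R.* wMax init R.≈ x
    init-weight = RI.solve 1 (λ x → x RI.:* (RI.con 1ℤ RI.:* RI.con 1ℤ) RI.:= x) R.refl x
    kernel : _ ↦ quadratic 1# two four x̂
    kernel = trans (↦-+ (↦-+ ↦-1 (↦-+ ↦-const ↦-const))
        (↦-+ (↦-+ (↦-+ (↦-* ↦-const ↦-const) (↦-* ↦-const ↦-const)) (↦-* ↦-const ↦-const)) (↦-* ↦-const ↦-const)))
      (solve 1 (λ x → con 1ℤ :+ (x :+ x) :+ (x :* x :+ x :* x :+ x :* x :+ x :* x) :=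
        con 1ℤ :+ (con 1ℤ :+ con 1ℤ) :* x :+ (con 1ℤ :+ con 1ℤ :+ (con 1ℤ :+ con 1ℤ)) :* (x :* x)) refl x̂)

  -- At the kernel root r this becomes r c = t `G[0]`, from which `c` is found once `G[0]` is known.
  GMaxII-equation : (x̂ - t * quadratic 1# 1# two x̂) * GMaxII ≈ x̂ * c - t * G[0]
  GMaxII-equation = kernel-form
    (trans (gen-kernel x transfer-wMaxII) (+-cong (const-cong init-weight) (*-congˡ {t}
      (trans (gen--≈ {λ σ → _ R.* wMaxII σ R.+ x R.* (w[0] σ R.+ w[01] σ)} {w[0]}
        (gen-+≈ {λ σ → _ R.* wMaxII σ} {λ σ → x R.* (w[0] σ R.+ w[01] σ)} (gen-*≈ {w = wMaxII} kernel refl)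
          (gen-*≈ {w = λ σ → w[0] σ R.+ w[01] σ} ↦-const (gen-+ w[0] w[01]))) refl)
        (+-assoc _ _ _)))))
    (solve 4 (λ x t g f → x :+ t :* (x :* (g :+ f) :- g) := x :* (con 1ℤ :+ t :* (g :+ f)) :- t :* g) refl
      x̂ t G[0] G[01])
    where
    init-weight : x R.* wMaxII init R.≈ x
    init-weight = RI.solve 1 (λ x → x RI.:* (RI.con 1ℤ RI.:* RI.con 1ℤ) RI.:= x) R.refl x
    kernel : _ ↦ quadratic 1# 1# two x̂
    kernel = trans (↦-+ (↦-+ ↦-1 ↦-const) (↦-+ (↦-* ↦-const ↦-const) (↦-* ↦-const ↦-const)))
      (solve 1 (λ x → con 1ℤ :+ x :+ (x :* x :+ x :* x) :=
        con 1ℤ :+ con 1ℤ :* x :+ (con 1ℤ :+ con 1ℤ) :* (x :* x)) refl x̂)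

  GII-equation : (û - t * quadratic 1+y² 1# 1# û) * GII ≈
                 t * (1+y² * (x̂ * x̂ - 1#) * GII₀) + û * c - t * (x̂ * x̂ * G[0])
  GII-equation = kernel-form
    (trans (gen-kernel (x R.* y) transfer-wII) (+-cong (const-cong init-weight) (*-congˡ {t}
      (trans (gen--≈ {λ σ → _ R.* wII σ R.+ _ R.* wII₀ σ R.+ x R.* y R.* (w[0] σ R.+ w[01] σ)} {λ σ → x R.* x R.* w[0] σ}
        (gen-+≈ {λ σ → _ R.* wII σ R.+ _ R.* wII₀ σ} {λ σ → x R.* y R.* (w[0] σ R.+ w[01] σ)}
          (gen-+≈ {λ σ → _ R.* wII σ} {λ σ → _ R.* wII₀ σ} (gen-*≈ {w = wII} kernel refl)
            (gen-*≈ {w = wII₀} (↦-* (↦-+ ↦-1 (↦-* ↦-const ↦-const)) (↦-- (↦-* ↦-const ↦-const) ↦-1)) refl))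
          (gen-*≈ {w = λ σ → w[0] σ R.+ w[01] σ} ↦-const (gen-+ w[0] w[01])))
        (gen-*≈ {w = w[0]} (↦-* ↦-const ↦-const) refl))
        (solve 4 (λ a b c d → a :+ b :+ c :- d := a :+ (b :+ c :- d)) refl _ _ _ _)))))
    (solve 6 (λ u t b g f d → u :+ t :* (b :+ u :* (g :+ f) :- d) :=
        t :* b :+ u :* (con 1ℤ :+ t :* (g :+ f)) :- t :* d) refl
      û t (1+y² * (x̂ * x̂ - 1#) * GII₀) G[0] G[01] (x̂ * x̂ * G[0]))
    where
    init-weight : x R.* y R.* wII init R.≈ x R.* y
    init-weight = RI.solve 1 (λ u → u RI.:* (RI.con 1ℤ RI.:* RI.con 1ℤ) RI.:= u) R.refl (x R.* y)
    kernel : _ ↦ quadratic 1+y² 1# 1# û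
    kernel = trans (↦-+ (↦-+ (↦-+ ↦-1 ↦-const) (↦-* ↦-const ↦-const)) (↦-* ↦-const ↦-const))
      (solve 2 (λ u y → con 1ℤ :+ u :+ u :* u :+ y :* y :=
        (con 1ℤ :+ y :* y) :+ con 1ℤ :* u :+ con 1ℤ :* (u :* u)) refl û ŷ)

  GI-equation : (û - t * quadratic 1+y+2y² (1# + ŷ) 1# û) * GI ≈
                t * ((x̂ - 1#) * 1+y+2y² * GI₀ + (ŷ + ŷ * ŷ + x̂ * (ŷ * ŷ)) * GII + (x̂ - 1#) * (ŷ + ŷ * ŷ) * GII₀)
                - û * (c - 1#)
  GI-equation = kernel-form
    (trans (gen-kernel (x R.* y) transfer-wI) (+-cong (trans (const-cong init-weight) const-0) (*-congˡ {t}
      (trans (gen--≈ {λ σ → _ R.* wI σ R.+ _ R.* wI₀ σ R.+ _ R.* wII σ R.+ _ R.* wII₀ σ} {λ σ → x R.* y R.* (w[0] σ R.+ w[01] σ)}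
        (gen-+≈ {λ σ → _ R.* wI σ R.+ _ R.* wI₀ σ R.+ _ R.* wII σ} {λ σ → _ R.* wII₀ σ}
          (gen-+≈ {λ σ → _ R.* wI σ R.+ _ R.* wI₀ σ} {λ σ → _ R.* wII σ}
            (gen-+≈ {λ σ → _ R.* wI σ} {λ σ → _ R.* wI₀ σ} (gen-*≈ {w = wI} kernel refl)
              (gen-*≈ {w = wI₀} (↦-* (↦-- ↦-const ↦-1) (↦-+ (↦-+ ↦-1 ↦-const) y²+y²)) refl))
            (gen-*≈ {w = wII} (↦-+ (↦-+ ↦-const y²) (↦-* ↦-const y²)) refl))
          (gen-*≈ {w = wII₀} (↦-* (↦-- ↦-const ↦-1) (↦-+ ↦-const y²)) refl))
        (gen-*≈ {w = λ σ → w[0] σ R.+ w[01] σ} ↦-const (gen-+ w[0] w[01])))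
        (solve 5 (λ a b c d e → a :+ b :+ c :+ d :- e := a :+ (b :+ c :+ d :- e)) refl _ _ _ _ _)))))
    (solve 5 (λ u t b g f → con 0ℤ :+ t :* (b :- u :* (g :+ f)) := t :* b :- u :* (con 1ℤ :+ t :* (g :+ f) :- con 1ℤ)) refl
      û t _ G[0] G[01])
    where
    y² : y R.* y ↦ ŷ * ŷ
    y² = ↦-* ↦-const ↦-const
    y²+y² : y R.* y R.+ y R.* y ↦ ŷ * ŷ + ŷ * ŷ
    y²+y² = ↦-+ y² y²
    init-weight : x R.* y R.* wI init R.≈ R.0#
    init-weight = R.zeroʳ _
    kernel : _ ↦ quadratic 1+y+2y² (1# + ŷ) 1# û
    kernel = trans (↦-+ (↦-+ (↦-+ (↦-+ ↦-1 ↦-const) y²+y²) (↦-* ↦-const (↦-+ ↦-1 ↦-const))) (↦-* ↦-const ↦-const))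
      (solve 2 (λ u y → con 1ℤ :+ y :+ (y :* y :+ y :* y) :+ u :* (con 1ℤ :+ y) :+ u :* u :=
        (con 1ℤ :+ y :+ (y :* y :+ y :* y)) :+ (con 1ℤ :+ y) :* u :+ con 1ℤ :* (u :* u)) refl û ŷ)

-- Elimination of the boundary series from the two main equations.

module Elimination (R : Ring) (t x y u c F F₀ G G₀ G₀₀ : CommutativeRing.Carrier R) where
  open CommutativeRing R
  open IntegerCoefficients R using (solve; _:=_; _:+_; _:*_; _:-_; :-_; con)
  open Kernels R using (quadratic; quadratic-mem; reduce-mod-root)
  open Relation.Binary.Reasoning.Setoid setoid

  α β : Carrier
  α = 1# + y + (y * y + y * y)
  β = y + y * y

  -- N and L come from the functional equations for G and F, multiplied by y² and y to become polynomials in u = x y;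
  -- Φ is what remains of the equation for F after eliminating G.
  κ N L Φ : Carrier → Carrier
  κ v = v - t * quadratic (1# + y * y) 1# 1# v
  N v = t * ((1# + y * y) * ((v * v - y * y) * G₀)) + v * (y * y) * c - t * (v * v * G₀₀)
  L v = t * ((v - y) * (α * F₀)) + t * ((v - y) * (β * G₀)) - v * (y * (c - 1#))
  Φ v = κ v * L v + t * (1# + y + v) * N v

  module _ (Q : Subring R) where
    open Subring Q

    -- These closure facts are kept general because they serve several subrings: the series free of
    -- x, the polynomials and the fractions.
    α-mem : Mem y → Mem α
    α-mem y∈ = mem-+ (mem-+ mem-1 y∈) (mem-+ (mem-* y∈ y∈) (mem-* y∈ y∈))

    β-mem : Mem y → Mem β
    β-mem y∈ = mem-+ y∈ (mem-* y∈ y∈)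

    1+y²-mem : Mem y → Mem (1# + y * y)
    1+y²-mem y∈ = mem-+ mem-1 (mem-* y∈ y∈)

    module _ (t∈ : Mem t) (y∈ : Mem y) (c∈ : Mem c) (G₀∈ : Mem G₀) where
      κ-mem : ∀ {v} → Mem v → Mem (κ v)
      κ-mem v∈ = mem-- v∈ (mem-* t∈ (quadratic-mem Q (1+y²-mem y∈) mem-1 mem-1 v∈))

      N-mem : ∀ {v} → Mem G₀₀ → Mem v → Mem (N v)
      N-mem G₀₀∈ v∈ = mem--
        (mem-+ (mem-* t∈ (mem-* (1+y²-mem y∈) (mem-* (mem-- (mem-* v∈ v∈) (mem-* y∈ y∈)) G₀∈)))
               (mem-* (mem-* v∈ (mem-* y∈ y∈)) c∈))
        (mem-* t∈ (mem-* (mem-* v∈ v∈) G₀₀∈))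

      L′-mem : ∀ {v} → Mem v → Mem (t * ((v - y) * (β * G₀)) - v * (y * (c - 1#)))
      L′-mem v∈ = mem-- (mem-* t∈ (mem-* (mem-- v∈ y∈) (mem-* (β-mem y∈) G₀∈)))
        (mem-* v∈ (mem-* y∈ (mem-- c∈ mem-1)))

      L-mem : ∀ {v} → Mem F₀ → Mem v → Mem (L v)
      L-mem F₀∈ v∈ = mem--
        (mem-+ (mem-* t∈ (mem-* (mem-- v∈ y∈) (mem-* (α-mem y∈) F₀∈)))
               (mem-* t∈ (mem-* (mem-- v∈ y∈) (mem-* (β-mem y∈) G₀∈))))
        (mem-* v∈ (mem-* y∈ (mem-- c∈ mem-1)))

      Φ-mem : ∀ {v} → Mem G₀₀ → Mem F₀ → Mem v → Mem (Φ v)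
      Φ-mem G₀₀∈ F₀∈ v∈ = mem-+ (mem-* (κ-mem v∈) (L-mem F₀∈ v∈))
        (mem-* (mem-* t∈ (mem-+ (mem-+ mem-1 y∈) v∈)) (N-mem G₀₀∈ v∈))

  module _ (d : Carrier) where
    open Congruence R d

    N-~ : ∀ {v w} → v ~ w → N v ~ N w
    N-~ p = ~-+ (~-+ (~-* ~-refl (~-* ~-refl (~-* (~-+ (~-* p p) ~-refl) ~-refl))) (~-* (~-* p ~-refl) ~-refl))
      (~-neg (~-* ~-refl (~-* (~-* p p) ~-refl)))

    L-~ : ∀ {v w} → v ~ w → L v ~ L w
    L-~ p = ~-+ (~-+ (~-* ~-refl (~-* (~-+ p ~-refl) ~-refl)) (~-* ~-refl (~-* (~-+ p ~-refl) ~-refl)))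
      (~-neg (~-* p ~-refl))

    κ-~ : ∀ {v w} → v ~ w → κ v ~ κ w
    κ-~ p = ~-+ p (~-neg (~-* ~-refl (~-+ (~-+ ~-refl (~-* ~-refl p)) (~-* ~-refl (~-* p p)))))

    Φ-~ : ∀ {v w} → v ~ w → Φ v ~ Φ w
    Φ-~ p = ~-+ (~-* (κ-~ p) (L-~ p)) (~-* (~-* ~-refl (~-+ ~-refl p)) (N-~ p))

  private
    ~-difference : ∀ w → Congruence._~_ R (u - w) u w
    ~-difference w = 1# , solve 2 (λ u w → u := w :+ (u :- w) :* con 1ℤ) refl u w

    ~₀⇒≈ : ∀ {f g} → Congruence._~_ R 0# f g → f ≈ g
    ~₀⇒≈ {f} {g} (q , e) = trans e (solve 2 (λ g q → g :+ con 0ℤ :* q := g) refl g q)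

  module _ (u≈ : u ≈ x * y)
           (G-equation : κ u * G ≈ t * ((1# + y * y) * (x * x - 1#) * G₀) + u * c - t * (x * x * G₀₀)) where

    κG≈N : κ u * (y * y * G) ≈ N u
    κG≈N = begin
      κ u * (y * y * G)
        ≈⟨ solve 3 (λ k y g → k :* (y :* y :* g) := y :* y :* (k :* g)) refl (κ u) y G ⟩
      y * y * (κ u * G)
        ≈⟨ *-congˡ (trans G-equation (+-congʳ (+-congˡ (*-congʳ u≈)))) ⟩
      y * y * (t * ((1# + y * y) * (x * x - 1#) * G₀) + x * y * c - t * (x * x * G₀₀))
        ≈⟨ solve 6 (λ x y t c g₀ g₀₀ →
             y :* y :* (t :* ((con 1ℤ :+ y :* y) :* (x :* x :- con 1ℤ) :* g₀) :+ x :* y :* c :- t :* (x :* x :* g₀₀)) :=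
             t :* ((con 1ℤ :+ y :* y) :* (((x :* y) :* (x :* y) :- y :* y) :* g₀)) :+ x :* y :* (y :* y) :* c
               :- t :* ((x :* y) :* (x :* y) :* g₀₀)) refl x y t c G₀ G₀₀ ⟩
      N (x * y)
        ≈⟨ ~₀⇒≈ (N-~ 0# (Congruence.~-reflexive R 0# u≈)) ⟨
      N u ∎

    N-multiple : ∀ {z} → z ≈ t * quadratic (1# + y * y) 1# 1# z → ∃ λ h → (u - z) * h ≈ N z
    N-multiple {z} z-root = reduce-mod-root z-root {k = quadratic (1# + y * y) 1# 1# u} refl κG≈N
      (N-~ (u - z) (~-difference z))

    -- The equation for F contains G, which is not free of x and would not reduce to something free
    -- of x modulo u - w. Multiplying by `κ u` turns the term with G into one with `N u`.
    Φ-multiple : ∀ {w k} → w ≈ t * quadratic α (1# + y) 1# w → k ≈ quadratic α (1# + y) 1# u →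
      (u - t * k) * F ≈ t * ((x - 1#) * α * F₀ + (y + y * y + x * (y * y)) * G + (x - 1#) * β * G₀) - u * (c - 1#) →
      ∃ λ h → (u - w) * h ≈ Φ w
    Φ-multiple {w} {k} w-root k≈ F-equation = reduce-mod-root w-root k≈ κF≈Φ (Φ-~ (u - w) (~-difference w))
      where
      m : Carrier
      m = u - t * k
      yF : m * (y * F) ≈ L u + t * (1# + y + u) * (y * y * G)
      yF = begin
        m * (y * F)
          ≈⟨ solve 3 (λ m y f → m :* (y :* f) := y :* (m :* f)) refl m y F ⟩
        y * (m * F)
          ≈⟨ *-congˡ F-equation ⟩
        y * (t * ((x - 1#) * α * F₀ + (y + y * y + x * (y * y)) * G + (x - 1#) * β * G₀) - u * (c - 1#))
          ≈⟨ solve 10 (λ x y u t c a b f₀ g g₀ →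
               y :* (t :* ((x :- con 1ℤ) :* a :* f₀ :+ (y :+ y :* y :+ x :* (y :* y)) :* g :+ (x :- con 1ℤ) :* b :* g₀) :- u :* (c :- con 1ℤ)) :=
               t :* ((x :* y :- y) :* (a :* f₀)) :+ t :* ((x :* y :- y) :* (b :* g₀)) :- u :* (y :* (c :- con 1ℤ))
                 :+ t :* (con 1ℤ :+ y :+ x :* y) :* (y :* y :* g)) refl x y u t c α β F₀ G G₀ ⟩
        t * ((x * y - y) * (α * F₀)) + t * ((x * y - y) * (β * G₀)) - u * (y * (c - 1#)) + t * (1# + y + x * y) * (y * y * G)
          ≈⟨ +-cong (+-congʳ (+-cong (*-congˡ (*-congʳ (+-congʳ u≈))) (*-congˡ (*-congʳ (+-congʳ u≈)))))
                    (*-congʳ (*-congˡ (+-congˡ u≈))) ⟨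
        L u + t * (1# + y + u) * (y * y * G) ∎
      κF≈Φ : m * (κ u * (y * F)) ≈ Φ u
      κF≈Φ = begin
        m * (κ u * (y * F))
          ≈⟨ solve 3 (λ m k f → m :* (k :* f) := k :* (m :* f)) refl m (κ u) (y * F) ⟩
        κ u * (m * (y * F))
          ≈⟨ *-congˡ yF ⟩
        κ u * (L u + t * (1# + y + u) * (y * y * G))
          ≈⟨ solve 4 (λ k l s g → k :* (l :+ s :* g) := k :* l :+ s :* (k :* g)) refl
               (κ u) (L u) (t * (1# + y + u)) (y * y * G) ⟩
        κ u * L u + t * (1# + y + u) * (κ u * (y * y * G))
          ≈⟨ +-congˡ (*-congˡ κG≈N) ⟩
        Φ u ∎

  solve-G₀ : ∀ {z} → N z ≈ 0# → (t * ((1# + y * y) * (z * z - y * y))) * G₀ ≈ t * (z * z * G₀₀) - z * (y * y) * c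
  solve-G₀ {z} e = begin
    (t * ((1# + y * y) * (z * z - y * y))) * G₀
      ≈⟨ solve 6 (λ t y z c g₀ g₀₀ → (t :* ((con 1ℤ :+ y :* y) :* (z :* z :- y :* y))) :* g₀ :=
           (t :* ((con 1ℤ :+ y :* y) :* ((z :* z :- y :* y) :* g₀)) :+ z :* (y :* y) :* c :- t :* (z :* z :* g₀₀))
           :+ (t :* (z :* z :* g₀₀) :- z :* (y :* y) :* c)) refl t y z c G₀ G₀₀ ⟩
    N z + (t * (z * z * G₀₀) - z * (y * y) * c)
      ≈⟨ trans (+-congʳ e) (+-identityˡ _) ⟩
    t * (z * z * G₀₀) - z * (y * y) * c ∎

  -- At a root of the second kernel the first kernel takes the value t y (1 + y + w), so it shares
  -- the factor t (1 + y + w) with the other summand.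
  Φ-root : ∀ {w} → w ≈ t * quadratic α (1# + y) 1# w → Φ w ≈ (t * (1# + y + w)) * (y * L w + N w)
  Φ-root {w} e = begin
    κ w * L w + t * (1# + y + w) * N w
      ≈⟨ +-congʳ (*-congʳ (+-congʳ e)) ⟩
    (t * quadratic α (1# + y) 1# w - t * quadratic (1# + y * y) 1# 1# w) * L w + t * (1# + y + w) * N w
      ≈⟨ solve 5 (λ t y w l n →
           (t :* ((con 1ℤ :+ y :+ (y :* y :+ y :* y)) :+ (con 1ℤ :+ y) :* w :+ con 1ℤ :* (w :* w))
             :- t :* ((con 1ℤ :+ y :* y) :+ con 1ℤ :* w :+ con 1ℤ :* (w :* w))) :* l :+ t :* (con 1ℤ :+ y :+ w) :* n :=
           (t :* (con 1ℤ :+ y :+ w)) :* (y :* l :+ n)) refl t y w (L w) (N w) ⟩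
    (t * (1# + y + w)) * (y * L w + N w) ∎

  solve-F₀ : ∀ {w} → y * L w + N w ≈ 0# →
             (y * (t * ((w - y) * α))) * F₀ ≈ - (y * (t * ((w - y) * (β * G₀)) - w * (y * (c - 1#))) + N w)
  solve-F₀ {w} e = begin
    (y * (t * ((w - y) * α))) * F₀
      ≈⟨ solve 7 (λ t y w a f p n → (y :* (t :* ((w :- y) :* a))) :* f :=
           (y :* (t :* ((w :- y) :* (a :* f)) :+ p) :+ n) :- (y :* p :+ n)) refl t y w α F₀ P (N w) ⟩
    (y * (t * ((w - y) * (α * F₀)) + P) + N w) - (y * P + N w)
      ≈⟨ +-congʳ (trans (+-congʳ (*-congˡ (sym (+-assoc _ _ _)))) e) ⟩
    0# - (y * P + N w)
      ≈⟨ +-identityˡ _ ⟩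
    - (y * P + N w) ∎
    where
    P : Carrier
    P = t * ((w - y) * (β * G₀)) - w * (y * (c - 1#))

module Differences (R : Ring) where
  open CommutativeRing R
  open IntegerCoefficients R using (solve; _:=_; _:+_; _:*_; _:-_)
  open Kernels R using (quadratic; reduce-mod-root)

  difference-multiple : ∀ {t γ δ ε r u c s f} → r ≈ t * quadratic γ δ ε r →
    (u - t * quadratic γ δ ε u) * f ≈ u * c - s → ∃ λ h → (u - r) * h ≈ r * c - s
  difference-multiple {r = r} {u} {c} {s} root e = reduce-mod-root root refl e
    (c , solve 4 (λ u r c s → u :* c :- s := r :* c :- s :+ (u :- r) :* c) refl u r c s)

  difference-zero : ∀ {a b} → a - b ≈ 0# → a ≈ b
  difference-zero {a} {b} e = trans (solve 2 (λ a b → a := a :- b :+ b) refl a b) (trans (+-congʳ e) (+-identityˡ b))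

module FractionSolutions (R : Ring) (P : Subdomain R) (A : AlgebraicExtensions.FiniteExtension R P)
  (t x y u c F F₀ G G₀ G₀₀ : CommutativeRing.Carrier R) where
  open CommutativeRing R
  open Subdomain P
  open AlgebraicExtensions R P
  open Fractions A
  open Elimination R t x y u c F F₀ G G₀ G₀₀
  open Kernels R using (quadratic; quadratic-mem)

  open Subring fractions using () renaming (mem-1 to 1∈; mem-+ to _+∈_; mem-* to _*∈_; mem-- to _-∈_; mem-neg to -∈_)

  module _ (t-mem : Mem t) (x-mem : Mem x) (y-mem : Mem y) (u-mem : Mem u) where
    private
      t∈ : Fraction t
      t∈ = mem⇒fraction t-mem
      x∈ : Fraction x
      x∈ = mem⇒fraction x-mem
      y∈ : Fraction y
      y∈ = mem⇒fraction y-mem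
      u∈ : Fraction u
      u∈ = mem⇒fraction u-mem
      y²∈ : Fraction (y * y)
      y²∈ = y∈ *∈ y∈
      α∈ : Fraction α
      α∈ = α-mem fractions y∈
      1+y²∈ : Fraction (1# + y * y)
      1+y²∈ = 1+y²-mem fractions y∈

    fraction-G₀₀ : ∀ {r} → Fraction r → Cancellable R t → r ≈ t * G₀₀ → Fraction G₀₀
    fraction-G₀₀ r∈ t-canc e = fraction-÷ t∈ r∈ t-canc (sym e)

    fraction-c : ∀ {r} → Fraction r → Fraction G₀₀ → Cancellable R r → r * c ≈ t * G₀₀ → Fraction c
    fraction-c r∈ G₀₀∈ r-canc e = fraction-÷ r∈ (t∈ *∈ G₀₀∈) r-canc e

    module _ (G₀₀∈ : Fraction G₀₀) (c∈ : Fraction c) where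
      fraction-G₀ : ∀ {z} → Fraction z → Cancellable R (t * ((1# + y * y) * (z * z - y * y))) → N z ≈ 0# → Fraction G₀
      fraction-G₀ z∈ canc e = fraction-÷ (t∈ *∈ (1+y²∈ *∈ ((z∈ *∈ z∈) -∈ y²∈)))
        ((t∈ *∈ ((z∈ *∈ z∈) *∈ G₀₀∈)) -∈ ((z∈ *∈ y²∈) *∈ c∈)) canc (solve-G₀ e)

      module _ (G₀∈ : Fraction G₀) where
        fraction-F₀ : ∀ {w} → Fraction w → Cancellable R (y * (t * ((w - y) * α))) → y * L w + N w ≈ 0# → Fraction F₀
        fraction-F₀ w∈ canc e = fraction-÷ (y∈ *∈ (t∈ *∈ ((w∈ -∈ y∈) *∈ α∈)))
          (-∈ ((y∈ *∈ L′-mem fractions t∈ y∈ c∈ G₀∈ w∈) +∈ N-mem fractions t∈ y∈ c∈ G₀∈ G₀₀∈ w∈)) canc (solve-F₀ e)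

        fraction-G : Cancellable R (κ u) →
          κ u * G ≈ t * ((1# + y * y) * (x * x - 1#) * G₀) + u * c - t * (x * x * G₀₀) → Fraction G
        fraction-G canc e = fraction-÷ (κ-mem fractions t∈ y∈ c∈ G₀∈ u∈)
          (((t∈ *∈ ((1+y²∈ *∈ ((x∈ *∈ x∈) -∈ 1∈)) *∈ G₀∈)) +∈ (u∈ *∈ c∈)) -∈ (t∈ *∈ ((x∈ *∈ x∈) *∈ G₀₀∈))) canc e

        fraction-F : Fraction F₀ → Fraction G → Cancellable R (u - t * quadratic α (1# + y) 1# u) →
          (u - t * quadratic α (1# + y) 1# u) * F ≈
            t * ((x - 1#) * α * F₀ + (y + y * y + x * (y * y)) * G + (x - 1#) * β * G₀) - u * (c - 1#) → Fraction F
        fraction-F F₀∈ G∈ canc e = fraction-÷ (u∈ -∈ (t∈ *∈ quadratic-mem fractions α∈ (1∈ +∈ y∈) 1∈ u∈))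
          ((t∈ *∈ (((((x∈ -∈ 1∈) *∈ α∈) *∈ F₀∈) +∈ (((y∈ +∈ y²∈) +∈ (x∈ *∈ y²∈)) *∈ G∈)) +∈
            (((x∈ -∈ 1∈) *∈ β-mem fractions y∈) *∈ G₀∈))) -∈ (u∈ *∈ (c∈ -∈ 1∈))) canc e

-- Finite sums and the convolution form of the product.

module Sums (R : Ring) where
  open CommutativeRing R
  open IntegerCoefficients R using (solve; _:=_; _:+_)

  ∑ : ℕ → (ℕ → Carrier) → Carrier
  ∑ zero    f = 0#
  ∑ (suc n) f = ∑ n f + f n

  ∑-cong : ∀ n {f g} → (∀ i → f i ≈ g i) → ∑ n f ≈ ∑ n g
  ∑-cong zero    p = refl
  ∑-cong (suc n) p = +-cong (∑-cong n p) (p n)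

  ∑-zero : ∀ n {f} → (∀ i → f i ≈ 0#) → ∑ n f ≈ 0#
  ∑-zero zero    p = refl
  ∑-zero (suc n) p = trans (+-cong (∑-zero n p) (p n)) (+-identityˡ 0#)

  ∑-front : ∀ n f → ∑ (suc n) f ≈ f 0 + ∑ n (λ i → f (suc i))
  ∑-front zero    f = +-comm _ _
  ∑-front (suc n) f = trans (+-congʳ (∑-front n f)) (+-assoc _ _ _)

  ∑-+ : ∀ n f g → ∑ n (λ i → f i + g i) ≈ ∑ n f + ∑ n g
  ∑-+ zero    f g = sym (+-identityˡ 0#)
  ∑-+ (suc n) f g = trans (+-congʳ (∑-+ n f g))
    (solve 4 (λ a b c d → (a :+ b) :+ (c :+ d) := (a :+ c) :+ (b :+ d)) refl (∑ n f) (∑ n g) (f n) (g n))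

  ∑-swap : ∀ m n (f : ℕ → ℕ → Carrier) → ∑ m (λ i → ∑ n (f i)) ≈ ∑ n (λ j → ∑ m (λ i → f i j))
  ∑-swap zero    n f = sym (∑-zero n (λ _ → refl))
  ∑-swap (suc m) n f = trans (+-congʳ (∑-swap m n f)) (sym (∑-+ n (λ j → ∑ m (λ i → f i j)) (f m)))

  ∑-*ˡ : ∀ n c f → ∑ n (λ i → c * f i) ≈ c * ∑ n f
  ∑-*ˡ zero    c f = sym (zeroʳ c)
  ∑-*ˡ (suc n) c f = trans (+-congʳ (∑-*ˡ n c f)) (sym (distribˡ c (∑ n f) (f n)))

module HornerSums (R : Ring) (P : Subdomain R) where
  open CommutativeRing R
  open AlgebraicExtensions R P
  open Sums R
  open IntegerCoefficients R using (solve; _:=_; _:*_)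

  at : ∀ {n} → Vec Carrier n → ℕ → Carrier
  at []       m       = 0#
  at (c ∷ cs) zero    = c
  at (c ∷ cs) (suc m) = at cs m

  horner-∑ : ∀ f {n} D (cs : Vec Carrier n) → n ℕ.≤ D → horner cs f ≈ ∑ D (λ m → at cs m * power f m)
  horner-∑ f D [] _ = sym (∑-zero D (λ m → zeroˡ _))
  horner-∑ f (suc D) (c ∷ cs) (s≤s n≤D) = sym (begin
    ∑ (suc D) (λ m → at (c ∷ cs) m * power f m)
      ≈⟨ ∑-front D _ ⟩
    c * 1# + ∑ D (λ m → at cs m * (f * power f m))
      ≈⟨ +-cong (*-identityʳ c) (∑-cong D (λ m →
           solve 3 (λ a f p → a :* (f :* p) := f :* (a :* p)) refl (at cs m) f (power f m))) ⟩
    c + ∑ D (λ m → f * (at cs m * power f m))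
      ≈⟨ +-congˡ (∑-*ˡ D f _) ⟩
    c + f * ∑ D (λ m → at cs m * power f m)
      ≈⟨ +-congˡ (*-congˡ (horner-∑ f D cs n≤D)) ⟨
    c + f * horner cs f ∎)
    where open Relation.Binary.Reasoning.Setoid setoid

module CauchyProduct (R : Ring) where
  private module R = CommutativeRing R
  open R using (_+_; _*_; 0#; _≈_)
  open PowerSeries R
  open Sums R
  private module ∑ₚₛ = Sums ring

  ∑-eval : ∀ n h k → ∑ₚₛ.∑ n h k ≡ ∑ n (λ i → h i k)
  ∑-eval zero    h k = ≡.refl
  ∑-eval (suc n) h k = ≡.cong (_+ h n k) (∑-eval n h k)

  cauchy : ∀ f g n → (f ✶ g) n ≈ ∑ (suc n) (λ i → f i * g (n ∸ i))
  cauchy f g zero    = R.sym (R.+-identityˡ _)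
  cauchy f g (suc n) = R.trans (R.+-congˡ (cauchy (tail f) g n)) (R.sym (∑-front (suc n) (λ i → f i * g (suc n ∸ i))))

  translate : ℕ → PS → PS
  translate k g n = if does (k ℕ.≤? n) then g (n ∸ k) else 0#

  translate-suc : ∀ k g n → translate (suc k) g (suc n) ≡ translate k g n
  translate-suc zero    g n = ≡.refl
  translate-suc (suc k) g n = ≡.refl

  -- Multiplication by a polynomial as a sum of D translates, independent of n; `translate` is the
  -- one-variable form of `shift` and yields 0 where the index would be negative.
  cauchy-bounded : ∀ D f g n → (∀ k → D ℕ.≤ k → f k ≈ 0#) → (f ✶ g) n ≈ ∑ D (λ k → f k * translate k g n)
  cauchy-bounded zero f g n p = ✶-zeroˡ g (λ k → p k z≤n) n
  cauchy-bounded (suc D) f g zero p = R.sym (R.trans (∑-front D _)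
    (R.trans (R.+-congˡ (∑-zero D (λ i → R.zeroʳ _))) (R.+-identityʳ _)))
  cauchy-bounded (suc D) f g (suc n) p = R.trans
    (R.+-congˡ (R.trans (cauchy-bounded D (tail f) g n (λ k D≤k → p (suc k) (s≤s D≤k)))
      (∑-cong D (λ k → R.*-congˡ {f (suc k)} (R.reflexive (≡.sym (translate-suc k g n)))))))
    (R.sym (∑-front D (λ k → f k * translate k g (suc n))))

-- The tower ℤ[[y]][[x]][[t]] and the coefficient form of algebraicity.

ℤ-ring : Ring
ℤ-ring = ℤₚ.+-*-commutativeRing

ℤ-subdomain : Subdomain ℤ-ring
ℤ-subdomain = record
  { subring = record
      { Mem = λ _ → ⊤ ; mem-0 = tt ; mem-1 = tt ; mem-+ = λ _ _ → tt ; mem-* = λ _ _ → tt ; mem-neg = λ _ → tt }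
  ; 1≉0 = λ () ; zero? = λ {a} _ → a ℤₚ.≟ 0ℤ
  ; no-zero-divisors = λ {a} _ _ → ℤₚ.i*j≡0⇒i≡0∨j≡0 a }

-- ℤ[[y]], ℤ[[y]][[x]] and ℤ[[y]][[x]][[t]]; the carrier of the last one is Series.
module Y = PowerSeries ℤ-ring
module X = PowerSeries Y.ring
module S = PowerSeries X.ring
module YP = PowerSeriesSubdomain ℤ-ring ℤ-subdomain
module XP = PowerSeriesSubdomain Y.ring YP.polynomials
module SP = PowerSeriesSubdomain X.ring XP.polynomials

module Polynomials = Subdomain SP.polynomials
module SR = CommutativeRing S.ring

module PolynomialRoots where
  open AlgebraicExtensions S.ring SP.polynomials
  open HornerSums S.ring SP.polynomials using (at; horner-∑)

  private
    module ∑ℤ = Sums ℤ-ring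
    module ∑Y = Sums Y.ring
    module ∑X = Sums X.ring
    module ∑S = Sums S.ring
    module CY = CauchyProduct ℤ-ring
    module CX = CauchyProduct Y.ring
    module CS = CauchyProduct X.ring
    open ≡.≡-Reasoning

    Σ<≡∑ : ∀ n f → Σ< n f ≡ ∑ℤ.∑ n f
    Σ<≡∑ zero    f = ≡.refl
    Σ<≡∑ (suc n) f = ≡.cong (ℤ._+ f n) (Σ<≡∑ n f)

    Σ<-cong : ∀ n {f g} → (∀ i → f i ≡ g i) → Σ< n f ≡ Σ< n g
    Σ<-cong zero    p = ≡.refl
    Σ<-cong (suc n) p = ≡.cong₂ ℤ._+_ (Σ<-cong n p) (p n)

    Σ<-swap : ∀ m n (f : ℕ → ℕ → ℤ) → Σ< m (λ i → Σ< n (f i)) ≡ Σ< n (λ j → Σ< m (λ i → f i j))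
    Σ<-swap m n f = begin
      Σ< m (λ i → Σ< n (f i))                ≡⟨ Σ<-cong m (λ i → Σ<≡∑ n (f i)) ⟩
      Σ< m (λ i → ∑ℤ.∑ n (f i))              ≡⟨ Σ<≡∑ m _ ⟩
      ∑ℤ.∑ m (λ i → ∑ℤ.∑ n (f i))            ≡⟨ ∑ℤ.∑-swap m n f ⟩
      ∑ℤ.∑ n (λ j → ∑ℤ.∑ m (λ i → f i j))    ≡⟨ Σ<≡∑ n _ ⟨
      Σ< n (λ j → ∑ℤ.∑ m (λ i → f i j))      ≡⟨ Σ<-cong n (λ j → Σ<≡∑ m _) ⟨
      Σ< n (λ j → Σ< m (λ i → f i j))        ∎

    evalX : ∀ n h a b → ∑X.∑ n h a b ≡ Σ< n (λ i → h i a b)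
    evalX n h a b = ≡.trans (≡.cong (λ f → f b) (CX.∑-eval n h a)) (≡.trans (CY.∑-eval n (λ i → h i a) b) (≡.sym (Σ<≡∑ n _)))

    evalY : ∀ n h b → ∑Y.∑ n h b ≡ Σ< n (λ i → h i b)
    evalY n h b = ≡.trans (CY.∑-eval n h b) (≡.sym (Σ<≡∑ n _))

    evalS : ∀ n h k a b → ∑S.∑ n h k a b ≡ Σ< n (λ i → h i k a b)
    evalS n h k a b = ≡.trans (≡.cong (λ f → f a b) (CS.∑-eval n h k)) (evalX n (λ i → h i k) a b)

  ⊛≈✶ : ∀ F G → F ⊛ G SR.≈ F S.✶ G
  ⊛≈✶ F G n a b = ≡.sym (begin
    (F S.✶ G) n a b
      ≡⟨ CS.cauchy F G n a b ⟩
    ∑X.∑ (suc n) (λ i → F i X.✶ G (n ∸ i)) a b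
      ≡⟨ evalX (suc n) (λ i → F i X.✶ G (n ∸ i)) a b ⟩
    Σ< (suc n) (λ i → (F i X.✶ G (n ∸ i)) a b)
      ≡⟨ Σ<-cong (suc n) (λ i → begin
           (F i X.✶ G (n ∸ i)) a b
             ≡⟨ CX.cauchy (F i) (G (n ∸ i)) a b ⟩
           ∑Y.∑ (suc a) (λ j → F i j Y.✶ G (n ∸ i) (a ∸ j)) b
             ≡⟨ evalY (suc a) (λ j → F i j Y.✶ G (n ∸ i) (a ∸ j)) b ⟩
           Σ< (suc a) (λ j → (F i j Y.✶ G (n ∸ i) (a ∸ j)) b)
             ≡⟨ Σ<-cong (suc a) (λ j → ≡.trans (CY.cauchy (F i j) (G (n ∸ i) (a ∸ j)) b) (≡.sym (Σ<≡∑ (suc b) _))) ⟩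
           Σ< (suc a) (λ j → Σ< (suc b) (λ k → F i j k ℤ.* G (n ∸ i) (a ∸ j) (b ∸ k))) ∎) ⟩
    (F ⊛ G) n a b ∎)

  private
    BoundedBy : ℕ → Series → Set
    BoundedBy D c = ∀ k i j → D ℕ.≤ k ⊎ D ℕ.≤ i ⊎ D ℕ.≤ j → c k i j ≡ 0ℤ

    boundedBy-mono : ∀ {D E c} → D ℕ.≤ E → BoundedBy D c → BoundedBy E c
    boundedBy-mono D≤E p k i j (inj₁ q)        = p k i j (inj₁ (ℕₚ.≤-trans D≤E q))
    boundedBy-mono D≤E p k i j (inj₂ (inj₁ q)) = p k i j (inj₂ (inj₁ (ℕₚ.≤-trans D≤E q)))
    boundedBy-mono D≤E p k i j (inj₂ (inj₂ q)) = p k i j (inj₂ (inj₂ (ℕₚ.≤-trans D≤E q)))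

    -- The coefficients of an iterated polynomial carry bounds of their own; only finitely many
    -- coefficients matter, so a common bound exists.
    uniformly : {Q : ℕ → ℕ → Set} → (∀ {n D E} → D ℕ.≤ E → Q n D → Q n E) → (∀ n → ∃ (Q n)) →
                ∀ N → ∃ λ D → ∀ n → n ℕ.< N → Q n D
    uniformly mono q zero = 0 , λ n ()
    uniformly {Q} mono q (suc N) with uniformly {Q} mono q N | q N
    ... | D , p | E , r = D ℕ.⊔ E , bound
      where
      bound : ∀ n → n ℕ.< suc N → Q n (D ℕ.⊔ E)
      bound n n<sN with n ℕₚ.≟ N
      ... | yes ≡.refl = mono (ℕₚ.m≤n⊔m D E) r
      ... | no n≢N     = mono (ℕₚ.m≤m⊔n D E) (p n (ℕₚ.≤∧≢⇒< (ℕₚ.≤-pred n<sN) n≢N))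

    polynomial-boundedX : ∀ {c} → XP.IsPolynomial c → ∃ λ D → ∀ i j → D ℕ.≤ i ⊎ D ℕ.≤ j → c i j ≡ 0ℤ
    polynomial-boundedX {c} (XP.polynomial p D b)
      with uniformly {λ i E → ∀ j → E ℕ.≤ j → c i j ≡ 0ℤ} (λ D≤E q j E≤j → q j (ℕₚ.≤-trans D≤E E≤j)) (λ i → YP.IsPolynomial.bound (p i) , YP.IsPolynomial.bounded (p i)) D
    ... | E , q = D ℕ.⊔ E , bound
      where
      bound : ∀ i j → D ℕ.⊔ E ℕ.≤ i ⊎ D ℕ.⊔ E ℕ.≤ j → c i j ≡ 0ℤ
      bound i j (inj₁ r) = b i (ℕₚ.m⊔n≤o⇒m≤o D E r) j
      bound i j (inj₂ r) with i ℕ.<? D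
      ... | yes i<D = q i i<D j (ℕₚ.m⊔n≤o⇒n≤o D E r)
      ... | no i≮D  = b i (ℕₚ.≮⇒≥ i≮D) j

    polynomial-bounded : ∀ {c} → Polynomials.Mem c → ∃ λ D → BoundedBy D c
    polynomial-bounded {c} (SP.polynomial p D b)
      with uniformly {λ k E → ∀ i j → E ℕ.≤ i ⊎ E ℕ.≤ j → c k i j ≡ 0ℤ}
             (λ D≤E q i j → λ { (inj₁ r) → q i j (inj₁ (ℕₚ.≤-trans D≤E r)) ; (inj₂ r) → q i j (inj₂ (ℕₚ.≤-trans D≤E r)) })
             (λ k → polynomial-boundedX (p k)) D
    ... | E , q = D ℕ.⊔ E , bound
      where
      bound : BoundedBy (D ℕ.⊔ E) c
      bound k i j (inj₁ r) = b k (ℕₚ.m⊔n≤o⇒m≤o D E r) i j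
      bound k i j (inj₂ r) with k ℕ.<? D
      ... | no k≮D  = b k (ℕₚ.≮⇒≥ k≮D) i j
      ... | yes k<D = q k k<D i j ([ (λ s → inj₁ (ℕₚ.m⊔n≤o⇒n≤o D E s)) , (λ s → inj₂ (ℕₚ.m⊔n≤o⇒n≤o D E s)) ]′ r)

    common-bound : ∀ {n} {cs : Vec Series n} → All Polynomials.Mem cs → ∃ λ D → All (BoundedBy D) cs
    common-bound [] = 0 , []
    common-bound (p ∷ ps) with polynomial-bounded p | common-bound ps
    ... | D , q | E , qs = D ℕ.⊔ E , boundedBy-mono (ℕₚ.m≤m⊔n D E) q ∷ All.map (boundedBy-mono (ℕₚ.m≤n⊔m D E)) qs

    translate-shift : ∀ i j k G n a b →
      CY.translate j (CX.translate i (CS.translate k G n) a) b ≡ shift i j k G n a b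
    translate-shift i j k G n a b with does (k ℕ.≤? n) | does (i ℕ.≤? a) | does (j ℕ.≤? b)
    ... | true  | true  | true  = ≡.refl
    ... | true  | true  | false = ≡.refl
    ... | true  | false | true  = ≡.refl
    ... | true  | false | false = ≡.refl
    ... | false | true  | true  = ≡.refl
    ... | false | true  | false = ≡.refl
    ... | false | false | true  = ≡.refl
    ... | false | false | false = ≡.refl

    bounded-product : ∀ D c G n a b → BoundedBy D c →
      (c S.✶ G) n a b ≡ Σ< D (λ k → Σ< D (λ i → Σ< D (λ j → c k i j ℤ.* shift i j k G n a b)))
    bounded-product D c G n a b p = begin
      (c S.✶ G) n a b
        ≡⟨ CS.cauchy-bounded D c G n (λ k D≤k i j → p k i j (inj₁ D≤k)) a b ⟩
      ∑X.∑ D (λ k → c k X.✶ CS.translate k G n) a b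
        ≡⟨ evalX D (λ k → c k X.✶ CS.translate k G n) a b ⟩
      Σ< D (λ k → (c k X.✶ CS.translate k G n) a b)
        ≡⟨ Σ<-cong D (λ k → ≡.trans
             (CX.cauchy-bounded D (c k) (CS.translate k G n) a (λ i D≤i j → p k i j (inj₂ (inj₁ D≤i))) b)
             (evalY D (λ i → c k i Y.✶ CX.translate i (CS.translate k G n) a) b)) ⟩
      Σ< D (λ k → Σ< D (λ i → (c k i Y.✶ CX.translate i (CS.translate k G n) a) b))
        ≡⟨ Σ<-cong D (λ k → Σ<-cong D (λ i → ≡.trans
             (CY.cauchy-bounded D (c k i) (CX.translate i (CS.translate k G n) a) b (λ j D≤j → p k i j (inj₂ (inj₂ D≤j))))
             (≡.sym (Σ<≡∑ D _)))) ⟩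
      Σ< D (λ k → Σ< D (λ i → Σ< D (λ j → c k i j ℤ.* CY.translate j (CX.translate i (CS.translate k G n) a) b)))
        ≡⟨ Σ<-cong D (λ k → Σ<-cong D (λ i → Σ<-cong D (λ j → ≡.cong (c k i j ℤ.*_) (translate-shift i j k G n a b)))) ⟩
      Σ< D (λ k → Σ< D (λ i → Σ< D (λ j → c k i j ℤ.* shift i j k G n a b))) ∎

    at-bounded : ∀ {D n} {cs : Vec Series n} → All (BoundedBy D) cs → ∀ m → BoundedBy D (at cs m)
    at-bounded []       m       = λ _ _ _ _ → ≡.refl
    at-bounded (p ∷ ps) zero    = p
    at-bounded (p ∷ ps) (suc m) = at-bounded ps m

    one≈1 : one SR.≈ SR.1#
    one≈1 zero    zero    zero    = ≡.refl
    one≈1 zero    zero    (suc b) = ≡.refl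
    one≈1 zero    (suc a) b       = ≡.refl
    one≈1 (suc n) a       b       = ≡.refl

    power≈ : ∀ F m → power F m SR.≈ F ^ₛ m
    power≈ F zero    = SR.sym one≈1
    power≈ F (suc m) = SR.trans (SR.*-congˡ {F} (power≈ F m)) (SR.sym (⊛≈✶ F (F ^ₛ m)))

    horner-Σ : ∀ F {K} D (cs : Vec Series K) → K ℕ.≤ D → ∀ n a b →
               horner cs F n a b ≡ Σ< D (λ m → (at cs m S.✶ (F ^ₛ m)) n a b)
    horner-Σ F D cs K≤D n a b = begin
      horner cs F n a b
        ≡⟨ horner-∑ F D cs K≤D n a b ⟩
      ∑S.∑ D (λ m → at cs m S.✶ power F m) n a b
        ≡⟨ evalS D (λ m → at cs m S.✶ power F m) n a b ⟩
      Σ< D (λ m → (at cs m S.✶ power F m) n a b)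
        ≡⟨ Σ<-cong D (λ m → S.✶-cong {at cs m} {at cs m} (λ _ _ _ → ≡.refl) (power≈ F m) n a b) ⟩
      Σ< D (λ m → (at cs m S.✶ (F ^ₛ m)) n a b) ∎

    -- Moves the power of the unknown outermost and orders the variables as in the tower, t before x
    -- before y, to match `bounded-product`.
    evalPoly≡ : ∀ D P F n a b → evalPoly D P F n a b ≡
      Σ< D (λ m → Σ< D (λ k → Σ< D (λ i → Σ< D (λ j → P i j k m ℤ.* shift i j k (F ^ₛ m) n a b))))
    evalPoly≡ D P F n a b = begin
      Σ< D (λ i → Σ< D (λ j → Σ< D (λ k → Σ< D (λ m → term i j k m))))
        ≡⟨ Σ<-cong D (λ i → Σ<-cong D (λ j → Σ<-swap D D (λ k m → term i j k m))) ⟩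
      Σ< D (λ i → Σ< D (λ j → Σ< D (λ m → Σ< D (λ k → term i j k m))))
        ≡⟨ Σ<-cong D (λ i → Σ<-swap D D (λ j m → Σ< D (λ k → term i j k m))) ⟩
      Σ< D (λ i → Σ< D (λ m → Σ< D (λ j → Σ< D (λ k → term i j k m))))
        ≡⟨ Σ<-swap D D (λ i m → Σ< D (λ j → Σ< D (λ k → term i j k m))) ⟩
      Σ< D (λ m → Σ< D (λ i → Σ< D (λ j → Σ< D (λ k → term i j k m))))
        ≡⟨ Σ<-cong D (λ m → Σ<-cong D (λ i → Σ<-swap D D (λ j k → term i j k m))) ⟩
      Σ< D (λ m → Σ< D (λ i → Σ< D (λ k → Σ< D (λ j → term i j k m))))
        ≡⟨ Σ<-cong D (λ m → Σ<-swap D D (λ i k → Σ< D (λ j → term i j k m))) ⟩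
      Σ< D (λ m → Σ< D (λ k → Σ< D (λ i → Σ< D (λ j → term i j k m)))) ∎
      where
      term : ℕ → ℕ → ℕ → ℕ → ℤ
      term i j k m = P i j k m ℤ.* shift i j k (F ^ₛ m) n a b

    -- The bound confines the non-zero coefficients to a finite box, so a search yields a witness
    -- without excluded middle.
    nonzero-coefficient : ∀ {c} D → BoundedBy D c → ¬ (c SR.≈ SR.0#) →
      ∃[ k ] ∃[ i ] ∃[ j ] (k ℕ.< D × i ℕ.< D × j ℕ.< D × ¬ (c k i j ≡ 0ℤ))
    nonzero-coefficient {c} D p c≉0
      with ℕₚ.anyUpTo? (λ k → ℕₚ.anyUpTo? (λ i → ℕₚ.anyUpTo? (λ j → ¬? (c k i j ℤₚ.≟ 0ℤ)) D) D) D
    ... | yes (k , k<D , i , i<D , j , j<D , nz) = k , i , j , k<D , i<D , j<D , nz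
    ... | no none = contradiction vanishes c≉0
      where
      vanishes : ∀ k i j → c k i j ≡ 0ℤ
      vanishes k i j with k ℕ.<? D | i ℕ.<? D | j ℕ.<? D | c k i j ℤₚ.≟ 0ℤ
      ... | _       | _       | _       | yes e = e
      ... | no q    | _       | _       | no _  = p k i j (inj₁ (ℕₚ.≮⇒≥ q))
      ... | yes _   | no q    | _       | no _  = p k i j (inj₂ (inj₁ (ℕₚ.≮⇒≥ q)))
      ... | yes _   | yes _   | no q    | no _  = p k i j (inj₂ (inj₂ (ℕₚ.≮⇒≥ q)))
      ... | yes k<D | yes i<D | yes j<D | no nz = contradiction (k , k<D , i , i<D , j , j<D , nz) none

    nonzero-at : ∀ {n} {cs : Vec Series n} → NonZero cs → ∃[ m ] (m ℕ.< n × ¬ (at cs m SR.≈ SR.0#))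
    nonzero-at (here p) = 0 , s≤s z≤n , p
    nonzero-at (there p) with nonzero-at p
    ... | m , m<n , q = suc m , s≤s m<n , q

  private
    nonzero-polynomial : ∀ {F K} (cs : Vec Series K) E → All (BoundedBy E) cs → ∀ m → m ℕ.< K →
      (∃[ k ] ∃[ i ] ∃[ j ] (k ℕ.< E ℕ.⊔ K × i ℕ.< E ℕ.⊔ K × j ℕ.< E ℕ.⊔ K × ¬ (at cs m k i j ≡ 0ℤ))) →
      horner cs F SR.≈ SR.0# → Algebraic F
    nonzero-polynomial {F} {K} cs E bounded m m<K (k , i , j , k<D , i<D , j<D , coeff≢0) root =
      D , P , (i , j , k , m , i<D , j<D , k<D , ℕₚ.<-≤-trans m<K (ℕₚ.m≤n⊔m E K) , coeff≢0) , λ n a b → begin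
        evalPoly D P F n a b
          ≡⟨ evalPoly≡ D P F n a b ⟩
        Σ< D (λ m → Σ< D (λ k → Σ< D (λ i → Σ< D (λ j → P i j k m ℤ.* shift i j k (F ^ₛ m) n a b))))
          ≡⟨ Σ<-cong D (λ m → bounded-product D (at cs m) (F ^ₛ m) n a b
               (boundedBy-mono (ℕₚ.m≤m⊔n E K) (at-bounded bounded m))) ⟨
        Σ< D (λ m → (at cs m S.✶ (F ^ₛ m)) n a b)
          ≡⟨ horner-Σ F D cs (ℕₚ.m≤n⊔m E K) n a b ⟨
        horner cs F n a b
          ≡⟨ root n a b ⟩
        0ℤ ∎
      where
      D : ℕ
      -- `E` bounds the exponents of x, y and t, and `K` that of the unknown; `Algebraic` wants a
      -- single bound for all four.
      D = E ℕ.⊔ K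
      P : ℕ → ℕ → ℕ → ℕ → ℤ
      -- Series are indexed in the order t, x, y, but `P` in the order x, y, t.
      P i j k m = at cs m k i j

  root⇒algebraic : ∀ {F} → RootOfPolynomial F → Algebraic F
  root⇒algebraic {F} (K , cs , cs-mem , nz , root) = conclude (common-bound cs-mem) (nonzero-at nz)
    where
    conclude : (∃ λ E → All (BoundedBy E) cs) → (∃[ m ] (m ℕ.< K × ¬ (at cs m SR.≈ SR.0#))) → Algebraic F
    conclude (E , bounded) (m , m<K , at≉0) = nonzero-polynomial cs E bounded m m<K
      (nonzero-coefficient (E ℕ.⊔ K) (boundedBy-mono (ℕₚ.m≤m⊔n E K) (at-bounded bounded m)) at≉0) root

-- Solving the functional equations.

module XR = CommutativeRing X.ring

x₀ y₀ : X.PS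
x₀ = X.var
y₀ = X.const Y.var

module GF = GeneratingFunctions X.ring x₀ y₀
module W = Weights X.ring x₀ y₀

-- What the solution uses of ℤ[[y]][[x]]: P stands for the polynomials and Q for the series free of
-- x. The cancellable elements are those from which the t-free terms of the denominators are built.
record KernelSetting (R : Ring) (x y : CommutativeRing.Carrier R) : Set₁ where
  open CommutativeRing R
  field
    P        : Subdomain R
    Q        : Subring R
    x∈P      : Subdomain.Mem P x
    y∈P      : Subdomain.Mem P y
    y∈Q      : Subring.Mem Q y
    x-root   : KernelRoot R Q x
    xy-root  : KernelRoot R Q (x * y)
    x-cancel       : Cancellable R x
    y-cancel       : Cancellable R y
    two-cancel     : Cancellable R (1# + 1#)
    four-cancel    : Cancellable R (1# + 1# + (1# + 1#))
    1+y-cancel     : Cancellable R (1# + y)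
    1+y²-cancel    : Cancellable R (1# + y * y)
    1+y+2y²-cancel : Cancellable R (1# + y + (y * y + y * y))

module Solution (R : Ring) (x y : CommutativeRing.Carrier R) (setting : KernelSetting R x y) where
  private
    module R = CommutativeRing R
    module PS = PowerSeriesProperties R
    module CR = CancellableProperties R
  open KernelSetting setting
  open PowerSeries R using (ring; PS)
  open CommutativeRing ring hiding (ring; zero)
  open GeneratingFunctions R x y
  open Weights R x y using (wI₀; wII₀; w[0]; w[01]; pow)
  open PowerSeriesSubring R Q
  open CancellableProperties ring
  open Kernels ring using (quadratic; scaled-root)
  open Elimination ring t x̂ ŷ û c GI GI₀ GII GII₀ G[0]
  open Differences ring
  open Roots R using (root; root-≋; root-head; root-mem)
  private
    module P = Subdomain P
    module Q = Subring Q
    module QS = Subring series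
    module PSD = PowerSeriesSubdomain R P
    module PS-P = Subdomain PSD.polynomials
  open AlgebraicExtensions ring PSD.polynomials

  private
    t-polynomial : PS-P.Mem t
    t-polynomial = PSD.var-polynomial

    x̂-polynomial : PS-P.Mem x̂
    x̂-polynomial = PSD.const-polynomial x∈P

    ŷ-polynomial : PS-P.Mem ŷ
    ŷ-polynomial = PSD.const-polynomial y∈P

    û-polynomial : PS-P.Mem û
    û-polynomial = PSD.const-polynomial (P.mem-* x∈P y∈P)

    two-mem : (S : Subring ring) → Subring.Mem S two
    two-mem S = Subring.mem-+ S (Subring.mem-1 S) (Subring.mem-1 S)

    four-mem : (S : Subring ring) → Subring.Mem S four
    four-mem S = Subring.mem-+ S (two-mem S) (two-mem S)

    1+ŷ-mem : (S : Subring ring) → Subring.Mem S ŷ → Subring.Mem S (1# + ŷ)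
    1+ŷ-mem S = Subring.mem-+ S (Subring.mem-1 S)

    t∈Q : QS.Mem t
    t∈Q = coefficientwise var-mem

    ŷ∈Q : QS.Mem ŷ
    ŷ∈Q = coefficientwise (const-mem y∈Q)

    -- The small roots of the kernels of GMax, GMaxII, GII and GI.
    rMax rMaxII rII rI : PS
    rMax   = root 1# two four
    rMaxII = root 1# 1# two
    rII    = root 1+y² 1# 1#
    rI     = root 1+y+2y² (1# + ŷ) 1#

    rMax∈Q : QS.Mem rMax
    rMax∈Q = root-mem 1# two four Q QS.mem-1 (two-mem series) (four-mem series)

    rMaxII∈Q : QS.Mem rMaxII
    rMaxII∈Q = root-mem 1# 1# two Q QS.mem-1 QS.mem-1 (two-mem series)

    rII∈Q : QS.Mem rII
    rII∈Q = root-mem 1+y² 1# 1# Q (1+y²-mem series ŷ∈Q) QS.mem-1 QS.mem-1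

    rI∈Q : QS.Mem rI
    rI∈Q = root-mem 1+y+2y² (1# + ŷ) 1# Q (α-mem series ŷ∈Q) (1+ŷ-mem series ŷ∈Q) QS.mem-1

    rMax-root : rMax ≈ t * quadratic 1# two four rMax
    rMax-root = root-≋ 1# two four

    rMaxII-root : rMaxII ≈ t * quadratic 1# 1# two rMaxII
    rMaxII-root = root-≋ 1# 1# two

    rII-root : rII ≈ t * quadratic 1+y² 1# 1# rII
    rII-root = root-≋ 1+y² 1# 1#

    rI-root : rI ≈ t * quadratic 1+y+2y² (1# + ŷ) 1# rI
    rI-root = root-≋ 1+y+2y² (1# + ŷ) 1#

    gen∈Q : ∀ {w} → (∀ σ → Q.Mem (w σ)) → QS.Mem (gen w)
    gen∈Q p = coefficientwise (gen-closed Q.Mem Q.mem-+ p)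

    pow-mem : ∀ {b} → Q.Mem b → ∀ n → Q.Mem (pow b n)
    pow-mem p zero    = Q.mem-1
    pow-mem p (suc n) = Q.mem-* p (pow-mem p n)

    w[0]∈Q : ∀ σ → Q.Mem (w[0] σ)
    w[0]∈Q dead              = Q.mem-0
    w[0]∈Q (II zero zero)    = Q.mem-1
    w[0]∈Q (II zero (suc d)) = Q.mem-0
    w[0]∈Q (II (suc a) d)    = Q.mem-0
    w[0]∈Q (I a d)           = Q.mem-0

    w[01]∈Q : ∀ σ → Q.Mem (w[01] σ)
    w[01]∈Q dead             = Q.mem-0
    w[01]∈Q (I zero zero)    = Q.mem-1
    w[01]∈Q (I zero (suc d)) = Q.mem-0
    w[01]∈Q (I (suc a) d)    = Q.mem-0
    w[01]∈Q (II a d)         = Q.mem-0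

    wI₀∈Q : ∀ σ → Q.Mem (wI₀ σ)
    wI₀∈Q dead          = Q.mem-0
    wI₀∈Q (I zero d)    = Q.mem-* y∈Q (pow-mem y∈Q d)
    wI₀∈Q (I (suc a) d) = Q.mem-0
    wI₀∈Q (II a d)      = Q.mem-0

    wII₀∈Q : ∀ σ → Q.Mem (wII₀ σ)
    wII₀∈Q dead           = Q.mem-0
    wII₀∈Q (II zero d)    = pow-mem (Q.mem-* y∈Q y∈Q) d
    wII₀∈Q (II (suc a) d) = Q.mem-0
    wII₀∈Q (I a d)        = Q.mem-0

  GI₀∈Q : QS.Mem GI₀
  GI₀∈Q = gen∈Q wI₀∈Q

  GII₀∈Q : QS.Mem GII₀
  GII₀∈Q = gen∈Q wII₀∈Q

  private
    G[0]∈Q : QS.Mem G[0]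
    G[0]∈Q = gen∈Q w[0]∈Q

    tG[0]∈Q : QS.Mem (t * G[0])
    tG[0]∈Q = QS.mem-* t∈Q G[0]∈Q

    c∈Q : QS.Mem c
    c∈Q = QS.mem-+ QS.mem-1 (QS.mem-* t∈Q (QS.mem-+ G[0]∈Q (gen∈Q w[01]∈Q)))

    -- The case c = 1 of the pattern of `rMaxII≈`, which is why factors 1 are inserted.
    rMax≈ : rMax ≈ t * G[0]
    rMax≈ = trans (sym (*-identityʳ rMax)) (difference-zero (x-root {h = proj₁ multiple} rMax∈Q (root-head 1# two four)
      (QS.mem-- (QS.mem-* rMax∈Q QS.mem-1) tG[0]∈Q) (proj₂ multiple)))
      where
      multiple : ∃ λ h → (x̂ - rMax) * h ≈ rMax * 1# - t * G[0]
      multiple = difference-multiple {t} {1#} {two} {four} {f = GMax} rMax-root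
        (trans GMax-equation (+-congʳ (sym (*-identityʳ x̂))))

    rMaxII≈ : rMaxII * c ≈ t * G[0]
    rMaxII≈ = difference-zero (x-root {h = proj₁ multiple} rMaxII∈Q (root-head 1# 1# two)
      (QS.mem-- (QS.mem-* rMaxII∈Q c∈Q) tG[0]∈Q) (proj₂ multiple))
      where
      multiple : ∃ λ h → (x̂ - rMaxII) * h ≈ rMaxII * c - t * G[0]
      multiple = difference-multiple {t} {1#} {1#} {two} {f = GMaxII} rMaxII-root GMaxII-equation

    N-rII : N rII ≈ 0#
    N-rII = xy-root {h = proj₁ multiple} rII∈Q (root-head 1+y² 1# 1#)
      (N-mem series t∈Q ŷ∈Q c∈Q GII₀∈Q G[0]∈Q rII∈Q) (proj₂ multiple)
      where
      multiple : ∃ λ h → (û - rII) * h ≈ N rII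
      multiple = N-multiple û≈ GII-equation rII-root

    Φ-rI : Φ rI ≈ 0#
    Φ-rI = xy-root {h = proj₁ multiple} rI∈Q (root-head 1+y+2y² (1# + ŷ) 1#)
      (Φ-mem series t∈Q ŷ∈Q c∈Q GII₀∈Q G[0]∈Q GI₀∈Q rI∈Q) (proj₂ multiple)
      where
      multiple : ∃ λ h → (û - rI) * h ≈ Φ rI
      multiple = Φ-multiple û≈ GII-equation {rI} {quadratic 1+y+2y² (1# + ŷ) 1# û} rI-root refl GI-equation

    t-cancel : Cancellable ring t
    t-cancel = PS.cancellable-var

    ŷ-cancel : Cancellable ring ŷ
    ŷ-cancel = PS.cancellable-const y-cancel

    -- Both main kernels have this shape, and their coefficient of t⁰ is x y.
    û-t-cancel : ∀ f → Cancellable ring (û - t * f)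
    û-t-cancel f = PS.cancellable-head (CR.cancellable-resp
      (solve 2 (λ u g → u := u :- con 0ℤ :* g) R.refl (x R.* y) (f 0)) (CR.cancellable-* x-cancel y-cancel))
      where open IntegerCoefficients R using (solve; _:=_; _:*_; _:-_; con)

    -- The root is divisible by t, so the last factor starts with -y².
    N-cancel : Cancellable ring (t * (1+y² * (rII * rII - ŷ * ŷ)))
    N-cancel = cancellable-* t-cancel (cancellable-* (PS.cancellable-head 1+y²-cancel) (PS.cancellable-head
      (CR.cancellable-resp (R.sym (R.trans (R.+-congʳ (R.trans (R.*-congʳ (root-head 1+y² 1# 1#)) (R.zeroˡ (rII 0))))
        (R.+-identityˡ _))) (CR.cancellable-neg (CR.cancellable-* y-cancel y-cancel)))))

    -- Since `rI` is divisible by t, the factor `rI - ŷ` starts with -y.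
    L-cancel : Cancellable ring (ŷ * (t * ((rI - ŷ) * α)))
    L-cancel = cancellable-* ŷ-cancel (cancellable-* t-cancel (cancellable-*
      (PS.cancellable-head (CR.cancellable-resp
        (R.sym (R.trans (R.+-congʳ (root-head 1+y+2y² (1# + ŷ) 1#)) (R.+-identityˡ _))) (CR.cancellable-neg y-cancel)))
      (PS.cancellable-head 1+y+2y²-cancel)))

    Φ-cancel : Cancellable ring (t * (1# + ŷ + rI))
    Φ-cancel = cancellable-* t-cancel (PS.cancellable-head (CR.cancellable-resp
      (R.sym (R.trans (R.+-congˡ (root-head 1+y+2y² (1# + ŷ) 1#)) (R.+-identityʳ _))) 1+y-cancel))

    L-N-rI : ŷ * L rI + N rI ≈ 0#
    L-N-rI = Cancellable.cancel Φ-cancel (ŷ * L rI + N rI) (trans (sym (Φ-root rI-root)) Φ-rI)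

    -- By its equation the root is t times a series with constant term 1.
    rMaxII-cancel : Cancellable ring rMaxII
    rMaxII-cancel = cancellable-resp (sym rMaxII-root) (cancellable-* t-cancel
      (PS.cancellable-head (CR.cancellable-resp (R.sym head) CR.cancellable-1)))
      where
      open IntegerCoefficients R using (solve; _:=_; _:+_; _:*_; con)
      head : quadratic 1# 1# two rMaxII 0 R.≈ R.1#
      head = R.trans (R.+-cong (R.+-congˡ (R.*-congˡ r₀)) (R.*-congˡ (R.*-cong r₀ r₀)))
        (solve 1 (λ o → o :+ o :* con 0ℤ :+ (o :+ o) :* (con 0ℤ :* con 0ℤ) := o) R.refl R.1#)
        where
        r₀ : rMaxII 0 R.≈ R.0#
        r₀ = root-head 1# 1# two

  module Adjoin (A : FiniteExtension) {γ δ ε r : PS} (γ∈ : PS-P.Mem γ) (δ∈ : PS-P.Mem δ) (ε∈ : PS-P.Mem ε)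
                (r-root : r ≈ t * quadratic γ δ ε r) where
    private
      p∈ : PS-P.Mem (1# - t * δ)
      p∈ = PS-P.mem-- PS-P.mem-1 (PS-P.mem-* t-polynomial δ∈)
      q∈ : PS-P.Mem (- (t * ε * (t * γ)))
      q∈ = PS-P.mem-neg (PS-P.mem-* (PS-P.mem-* t-polynomial ε∈) (PS-P.mem-* t-polynomial γ∈))
      integral : (t * ε * r) * (t * ε * r) ≈ (1# - t * δ) * (t * ε * r) + - (t * ε * (t * γ))
      integral = scaled-root {t} {γ} {δ} {ε} {r} r-root

    extension : FiniteExtension
    extension = adjoin A p∈ q∈ integral

    ⊇ : ∀ {a} → FiniteExtension._∈ A a → FiniteExtension._∈ extension a
    ⊇ = ∈-adjoin A p∈ q∈ integral

    scaled-root-∈ : FiniteExtension._∈ extension (t * ε * r)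
    scaled-root-∈ = generator-∈ A p∈ q∈ integral

  private
    polys : Subring ring
    polys = PS-P.subring

  -- Each adjunction squares the bound on independent families, taking it from 2 through 4, 16 and
  -- 256 to 65536. Only its existence matters.
  module A₁ = Adjoin base PS-P.mem-1 (two-mem polys) (four-mem polys) rMax-root
  module A₂ = Adjoin A₁.extension PS-P.mem-1 PS-P.mem-1 (two-mem polys) rMaxII-root
  module A₃ = Adjoin A₂.extension (1+y²-mem polys ŷ-polynomial) PS-P.mem-1 PS-P.mem-1 rII-root
  module A₄ = Adjoin A₃.extension (α-mem polys ŷ-polynomial) (1+ŷ-mem polys ŷ-polynomial) PS-P.mem-1 rI-root

  open Fractions A₄.extension public

  private
    unscale : ∀ ε r → PS-P.Mem ε → Cancellable ring ε → FiniteExtension._∈ A₄.extension (t * ε * r) → Fraction r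
    unscale ε r ε∈ ε-cancel p = fraction-÷ (mem⇒fraction (PS-P.mem-* t-polynomial ε∈)) (∈⇒fraction p)
      (cancellable-* t-cancel ε-cancel) refl

    rMax-fraction : Fraction rMax
    rMax-fraction = unscale four rMax (four-mem polys) (PS.cancellable-head four-cancel)
      (A₄.⊇ {t * four * rMax} (A₃.⊇ {t * four * rMax} (A₂.⊇ {t * four * rMax} A₁.scaled-root-∈)))

    rMaxII-fraction : Fraction rMaxII
    rMaxII-fraction = unscale two rMaxII (two-mem polys) (PS.cancellable-head two-cancel)
      (A₄.⊇ {t * two * rMaxII} (A₃.⊇ {t * two * rMaxII} A₂.scaled-root-∈))

    rII-fraction : Fraction rII
    rII-fraction = unscale 1# rII PS-P.mem-1 cancellable-1 (A₄.⊇ {t * 1# * rII} A₃.scaled-root-∈)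

    rI-fraction : Fraction rI
    rI-fraction = unscale 1# rI PS-P.mem-1 cancellable-1 A₄.scaled-root-∈

    module FS = FractionSolutions ring PSD.polynomials A₄.extension t x̂ ŷ û c GI GI₀ GII GII₀ G[0]

    G[0]-fraction : Fraction G[0]
    G[0]-fraction = FS.fraction-G₀₀ t-polynomial x̂-polynomial ŷ-polynomial û-polynomial rMax-fraction t-cancel rMax≈

    c-fraction : Fraction c
    c-fraction = FS.fraction-c t-polynomial x̂-polynomial ŷ-polynomial û-polynomial
      rMaxII-fraction G[0]-fraction rMaxII-cancel rMaxII≈

  GII₀-fraction : Fraction GII₀
  GII₀-fraction = FS.fraction-G₀ t-polynomial x̂-polynomial ŷ-polynomial û-polynomial
    G[0]-fraction c-fraction rII-fraction N-cancel N-rII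

  GI₀-fraction : Fraction GI₀
  GI₀-fraction = FS.fraction-F₀ t-polynomial x̂-polynomial ŷ-polynomial û-polynomial
    G[0]-fraction c-fraction GII₀-fraction rI-fraction L-cancel L-N-rI

  GII-fraction : Fraction GII
  GII-fraction = FS.fraction-G t-polynomial x̂-polynomial ŷ-polynomial û-polynomial
    G[0]-fraction c-fraction GII₀-fraction (û-t-cancel (quadratic 1+y² 1# 1# û)) GII-equation

  GI-fraction : Fraction GI
  GI-fraction = FS.fraction-F t-polynomial x̂-polynomial ŷ-polynomial û-polynomial
    G[0]-fraction c-fraction GII₀-fraction GI₀-fraction GII-fraction
    (û-t-cancel (quadratic 1+y+2y² (1# + ŷ) 1# û)) GI-equation

module KX = KernelMethod Y.ring

setting : KernelSetting X.ring x₀ y₀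
setting = record
  { P = XP.polynomials
  ; Q = KX.constants
  ; x∈P = XP.var-polynomial
  ; y∈P = XP.const-polynomial YP.var-polynomial
  ; y∈Q = KX.constant λ a b → ≡.refl
  -- Multiplication by x, or by x y, raises the power of x by one and multiplies by m = 1, or by m =
  -- y.
  ; x-root = KX.kernel-root x-shift (CancellableProperties.cancellable-1 Y.ring)
  ; xy-root = KX.kernel-root xy-shift PY.cancellable-var
  ; x-cancel = PX.cancellable-var
  ; y-cancel = PX.cancellable-const PY.cancellable-var
  ; two-cancel = leading-cancel (λ ())
  ; four-cancel = leading-cancel (λ ())
  ; 1+y-cancel = leading-cancel (λ ())
  ; 1+y²-cancel = leading-cancel (λ ())
  ; 1+y+2y²-cancel = leading-cancel (λ ())
  }
  where
  module YR = CommutativeRing Y.ring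
  module PY = PowerSeriesProperties ℤ-ring
  module PX = PowerSeriesProperties Y.ring

  x-shift : ∀ g → x₀ X.✶ g X.≋ X.z· (YR.1# X.∙ g)
  x-shift g zero    = X.var-✶ g zero
  x-shift g (suc a) = YR.trans (X.var-✶ g (suc a)) (YR.sym (YR.*-identityˡ (g a)))

  xy-shift : ∀ g → (x₀ X.✶ y₀) X.✶ g X.≋ X.z· (Y.var X.∙ g)
  xy-shift g = XR.trans (XR.*-assoc x₀ y₀ g) (XR.trans (X.var-✶ (y₀ X.✶ g)) λ
    { zero → λ _ → ≡.refl ; (suc a) → X.const-✶ Y.var g a })

  ℤ-cancel : ∀ {i} → ¬ i ≡ 0ℤ → Cancellable ℤ-ring i
  ℤ-cancel {i} i≢0 = cancellable cofactor≡0
    where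
    cofactor≡0 : ∀ j → i ℤ.* j ≡ 0ℤ → j ≡ 0ℤ
    cofactor≡0 j e with ℤₚ.i*j≡0⇒i≡0∨j≡0 i e
    ... | inj₁ i≡0 = contradiction i≡0 i≢0
    ... | inj₂ j≡0 = j≡0

  leading-cancel : ∀ {f : X.PS} → ¬ f 0 0 ≡ 0ℤ → Cancellable X.ring f
  leading-cancel p = PX.cancellable-head (PY.cancellable-head (ℤ-cancel p))

-- Reachable points

open ≡ using (refl; sym; trans; cong; cong₂; subst)

memI memII : ℕ → ℕ → ℕ → Bool
memI (suc a) d zero            = false
memI (suc a) d (suc k)         = memI a d k
memI 0 d       zero            = true
memI 0 0       (suc zero)      = true
memI 0 0       (suc (suc k))   = false
memI 0 (suc d) (suc k)         = memI 0 d k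
memII (suc a) d zero           = false
memII (suc a) d (suc k)        = memII a d k
memII 0 d       zero           = true
memII 0 0       (suc k)        = false
memII 0 (suc d) (suc zero)     = false
memII 0 (suc d) (suc (suc k))  = memII 0 d k

mem before : State → ℕ → Bool
mem dead     k = false
mem (I a d)  k = memI a d k
mem (II a d) k = memII a d k
before σ zero    = false
before σ (suc k) = mem σ k

-- Taking k natural discards negative endpoints; `before` stands for k - 1 and answers false at 0.
arrive : MStep → State → ℕ → Bool
arrive s₋   σ k = mem σ (suc k)
arrive s₀   σ k = mem σ k
arrive s₊   σ k = before σ k
arrive s₋₀  σ k = mem σ (suc k) ∨ mem σ k
arrive s₋₊  σ k = mem σ (suc k) ∨ before σ k
arrive s₀₊  σ k = mem σ k ∨ before σ k
arrive s₋₀₊ σ k = mem σ (suc k) ∨ mem σ k ∨ before σ k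

private
  before-I : ∀ a d k → before (I a d) k ≡ memI (suc a) d k
  before-I a d zero    = refl
  before-I a d (suc k) = refl

  before-II : ∀ a d k → before (II a d) k ≡ memII (suc a) d k
  before-II a d zero    = refl
  before-II a d (suc k) = refl

  II-suc : ∀ d k → memII 0 (suc d) (suc k) ≡ memII 1 d k
  II-suc d zero    = refl
  II-suc d (suc k) = refl

  -- Two progressions of opposite parity interleave to an interval of 2d + 2 points.
  II∪II₁ : ∀ a d k → memI a (double d) k ≡ memII a d k ∨ memII (suc a) d k
  II∪II₁ (suc a) d       zero                = refl
  II∪II₁ (suc a) d       (suc k)             = II∪II₁ a d k
  II∪II₁ 0       d       zero                = refl
  II∪II₁ 0       zero    (suc zero)          = refl
  II∪II₁ 0       zero    (suc (suc k))       = refl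
  II∪II₁ 0       (suc d) (suc zero)          = refl
  II∪II₁ 0       (suc d) (suc (suc zero))    = refl
  II∪II₁ 0       (suc d) (suc (suc (suc k))) = II∪II₁ 0 d (suc k)

  II⊆II-suc : ∀ d k → memII 0 (suc d) k ≡ memII 0 d k ∨ memII 0 (suc d) k
  II⊆II-suc d       zero          = refl
  II⊆II-suc zero    (suc zero)    = refl
  II⊆II-suc (suc d) (suc zero)    = refl
  II⊆II-suc zero    (suc (suc k)) = refl
  II⊆II-suc (suc d) (suc (suc k)) = II⊆II-suc d k

  -- Under `s₋₊` at minimum 0, the copy moved down and cut off at 0 lies inside the copy moved up.
  II-down-up : ∀ d k → memII 0 d k ≡ memII 0 d (suc (suc k)) ∨ memII 0 d k
  II-down-up zero    k = refl
  II-down-up (suc d) k = II⊆II-suc d k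

  1∉II : ∀ d → memII 0 d 1 ≡ false
  1∉II zero    = refl
  1∉II (suc d) = refl

  II∪II₂ : ∀ a d k → memII a (suc d) k ≡ memII a d k ∨ memII (suc (suc a)) d k
  II∪II₂ (suc a) d zero          = refl
  II∪II₂ (suc a) d (suc k)       = II∪II₂ a d k
  II∪II₂ 0       d zero          = refl
  II∪II₂ 0       d (suc zero)    = sym (cong (_∨ false) (1∉II d))
  II∪II₂ 0       d (suc (suc k)) = II-down-up d k

  II-full : ∀ d k → memI 0 (double d) k ≡ memII 0 d (suc k) ∨ memII 0 d k ∨ memII 1 d k
  II-full zero    k             = II∪II₁ 0 0 k
  II-full (suc d) zero          = refl
  II-full (suc d) (suc zero)    = refl
  II-full (suc d) (suc (suc k)) = trans (II-full d k)
    (cong (λ r → memII 0 d (suc k) ∨ memII 0 d k ∨ r) (sym (II-suc d k)))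

  II-full′ : ∀ a d k → memI a (suc (double d)) k ≡ memII a d k ∨ memII (suc a) d k ∨ memII (suc (suc a)) d k
  II-full′ (suc a) d zero    = refl
  II-full′ (suc a) d (suc k) = II-full′ a d k
  II-full′ 0       d zero    = refl
  II-full′ 0       d (suc k) = II-full d k

  I-down : ∀ d k → memI 0 d k ≡ memI 0 d (suc k) ∨ memI 0 d k
  I-down zero    zero          = refl
  I-down zero    (suc zero)    = refl
  I-down zero    (suc (suc k)) = refl
  I-down (suc d) zero          = refl
  I-down (suc d) (suc k)       = I-down d k

  I∪I₁ : ∀ a d k → memI a (suc d) k ≡ memI a d k ∨ memI (suc a) d k
  I∪I₁ (suc a) d zero    = refl
  I∪I₁ (suc a) d (suc k) = I∪I₁ a d k
  I∪I₁ 0       d zero    = refl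
  I∪I₁ 0       d (suc k) = I-down d k

  I-down-up : ∀ d k → memI 0 d k ≡ memI 0 d (suc (suc k)) ∨ memI 0 d k
  I-down-up zero          zero          = refl
  I-down-up zero          (suc zero)    = refl
  I-down-up zero          (suc (suc k)) = refl
  I-down-up (suc zero)    zero          = refl
  I-down-up (suc (suc d)) zero          = refl
  I-down-up (suc d)       (suc k)       = I-down-up d k

  I-all : ∀ d k → memI 0 d k ≡ memI 0 d (suc (suc k)) ∨ memI 0 d (suc k) ∨ memI 0 d k
  I-all d k = trans (I-down-up d k) (cong (memI 0 d (suc (suc k)) ∨_) (I-down d k))

  1∈I : ∀ d → memI 0 d 1 ≡ true
  1∈I zero    = refl
  1∈I (suc d) = refl

  I∪I₂ : ∀ a d k → memI a (suc (suc d)) k ≡ memI a d k ∨ memI (suc (suc a)) d k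
  I∪I₂ (suc a) d zero          = refl
  I∪I₂ (suc a) d (suc k)       = I∪I₂ a d k
  I∪I₂ 0       d zero          = refl
  I∪I₂ 0       d (suc zero)    = sym (cong (_∨ false) (1∈I d))
  I∪I₂ 0       d (suc (suc k)) = I-down-up d k

  I∪I₁∪I₂ : ∀ a d k → memI a (suc (suc d)) k ≡ memI a d k ∨ memI (suc a) d k ∨ memI (suc (suc a)) d k
  I∪I₁∪I₂ (suc a) d zero          = refl
  I∪I₁∪I₂ (suc a) d (suc k)       = I∪I₁∪I₂ a d k
  I∪I₁∪I₂ 0       d zero          = refl
  I∪I₁∪I₂ 0       d (suc zero)    = sym (cong (_∨ (true ∨ false)) (1∈I d))
  I∪I₁∪I₂ 0       d (suc (suc k)) = I-all d k

-- This justifies the table `move`; each entry is one of the unions above.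
step-arrive : ∀ σ s k → mem (step σ s) k ≡ arrive s σ k
step-arrive dead s₋ k = refl
step-arrive dead s₀ k = refl
step-arrive dead s₊ zero = refl
step-arrive dead s₊ (suc k) = refl
step-arrive dead s₋₀ k = refl
step-arrive dead s₋₊ zero = refl
step-arrive dead s₋₊ (suc k) = refl
step-arrive dead s₀₊ zero = refl
step-arrive dead s₀₊ (suc k) = refl
step-arrive dead s₋₀₊ zero = refl
step-arrive dead s₋₀₊ (suc k) = refl
step-arrive (II (suc a) d) s₋ k = refl
step-arrive (II 0 (suc d)) s₋ k = sym (II-suc d k)
step-arrive (II 0 0) s₋ k = refl
step-arrive (II a d) s₀ k = refl
step-arrive (II a d) s₊ k = sym (before-II a d k)
step-arrive (II (suc a) d) s₋₊ k = trans (II∪II₂ a d k) (cong (memII a d k ∨_) (sym (before-II (suc a) d k)))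
step-arrive (II 0 d) s₋₊ zero = sym (cong (_∨ false) (1∉II d))
step-arrive (II 0 d) s₋₊ (suc k) = II-down-up d k
step-arrive (II (suc a) d) s₋₀ k = II∪II₁ a d k
step-arrive (II 0 0) s₋₀ k = refl
step-arrive (II 0 (suc d)) s₋₀ zero = refl
step-arrive (II 0 (suc d)) s₋₀ (suc k) = trans (II∪II₁ 0 d k) (cong (memII 0 d k ∨_) (sym (II-suc d k)))
step-arrive (II a d) s₀₊ k = trans (II∪II₁ a d k) (cong (memII a d k ∨_) (sym (before-II a d k)))
step-arrive (II (suc a) d) s₋₀₊ k = trans (II-full′ a d k)
  (cong (λ r → memII a d k ∨ memII (suc a) d k ∨ r) (sym (before-II (suc a) d k)))
step-arrive (II 0 d) s₋₀₊ k = trans (II-full d k)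
  (cong (λ r → memII 0 d (suc k) ∨ memII 0 d k ∨ r) (sym (before-II 0 d k)))
step-arrive (I (suc a) d) s₋ k = refl
step-arrive (I 0 (suc d)) s₋ k = refl
step-arrive (I 0 0) s₋ zero = refl
step-arrive (I 0 0) s₋ (suc k) = refl
step-arrive (I a d) s₀ k = refl
step-arrive (I a d) s₊ k = sym (before-I a d k)
step-arrive (I (suc a) d) s₋₊ k = trans (I∪I₂ a d k) (cong (memI a d k ∨_) (sym (before-I (suc a) d k)))
step-arrive (I 0 d) s₋₊ zero = sym (cong (_∨ false) (1∈I d))
step-arrive (I 0 d) s₋₊ (suc k) = I-down-up d k
step-arrive (I (suc a) d) s₋₀ k = I∪I₁ a d k
step-arrive (I 0 d) s₋₀ k = I-down d k
step-arrive (I a d) s₀₊ k = trans (I∪I₁ a d k) (cong (memI a d k ∨_) (sym (before-I a d k)))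
step-arrive (I (suc a) d) s₋₀₊ k = trans (I∪I₁∪I₂ a d k)
  (cong (λ r → memI a d k ∨ memI (suc a) d k ∨ r) (sym (before-I (suc a) d k)))
step-arrive (I 0 d) s₋₀₊ zero = sym (cong (_∨ (true ∨ false)) (1∈I d))
step-arrive (I 0 d) s₋₀₊ (suc k) = I-all d k

memℤ : State → ℤ → Bool
memℤ σ (+ k)    = mem σ k
memℤ σ -[1+ k ] = false

private
  memℤ-before : ∀ σ k → memℤ σ (+ k ℤ.- 1ℤ) ≡ before σ k
  memℤ-before σ zero    = refl
  memℤ-before σ (suc k) = refl

  memℤ-here : ∀ σ k → memℤ σ (+ k ℤ.- 0ℤ) ≡ mem σ k
  memℤ-here σ k = cong (mem σ) (ℕₚ.+-identityʳ k)

  memℤ-after : ∀ σ k → memℤ σ (+ k ℤ.- -1ℤ) ≡ mem σ (suc k)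
  memℤ-after σ k = cong (mem σ) (ℕₚ.+-comm k 1)

  arrive-any : ∀ s σ k → any (λ v → memℤ σ (+ k ℤ.- v)) (elems s) ≡ arrive s σ k
  arrive-any s₋   σ k = trans (Boolₚ.∨-identityʳ _) (memℤ-after σ k)
  arrive-any s₀   σ k = trans (Boolₚ.∨-identityʳ _) (memℤ-here σ k)
  arrive-any s₊   σ k = trans (Boolₚ.∨-identityʳ _) (memℤ-before σ k)
  arrive-any s₋₀  σ k = cong₂ _∨_ (memℤ-after σ k) (trans (Boolₚ.∨-identityʳ _) (memℤ-here σ k))
  arrive-any s₋₊  σ k = cong₂ _∨_ (memℤ-after σ k) (trans (Boolₚ.∨-identityʳ _) (memℤ-before σ k))
  arrive-any s₀₊  σ k = cong₂ _∨_ (memℤ-here σ k) (trans (Boolₚ.∨-identityʳ _) (memℤ-before σ k))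
  arrive-any s₋₀₊ σ k = cong₂ _∨_ (memℤ-after σ k)
    (cong₂ _∨_ (memℤ-here σ k) (trans (Boolₚ.∨-identityʳ _) (memℤ-before σ k)))

  step-any : ∀ σ s k → memℤ (step σ s) (+ k) ≡ any (λ v → memℤ σ (+ k ℤ.- v)) (elems s)
  step-any σ s k = trans (step-arrive σ s k) (sym (arrive-any s σ k))

  cancel-+- : ∀ i v → (i ℤ.+ v) ℤ.- v ≡ i
  cancel-+- i v = trans (ℤₚ.+-assoc i v (ℤ.- v)) (trans (cong (λ r → i ℤ.+ r) (ℤₚ.+-inverseʳ v)) (ℤₚ.+-identityʳ i))

  cancel--+ : ∀ i v → (i ℤ.- v) ℤ.+ v ≡ i
  cancel--+ i v = trans (ℤₚ.+-assoc i (ℤ.- v) v) (trans (cong (λ r → i ℤ.+ r) (ℤₚ.+-inverseˡ v)) (ℤₚ.+-identityʳ i))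

  step-sound : ∀ σ s {i v j} → T (memℤ σ i) → v ∈ₛ s → i ℤ.+ v ≡ j → 0ℤ ℤ.≤ j → T (memℤ (step σ s) j)
  step-sound σ s {i} {v} {+ k} p v∈s e _ = ≡.subst T (sym (step-any σ s k))
    (Anyₚ.any⁺ _ (lose v∈s (≡.subst (λ j → T (memℤ σ j)) (trans (sym (cancel-+- i v)) (cong (λ r → r ℤ.- v) e)) p)))

run : State → NWalk → State
run σ []      = σ
run σ (s ∷ w) = run (step σ s) w

run-sound : ∀ σ {w v i} → T (memℤ σ i) → Compatible w v → ListAll.All (ℤ._≤_ 0ℤ) (positionsFrom i v) →
            T (memℤ (run σ w) (endpointFrom i v))
run-sound σ p [] [] = p
run-sound σ {s ∷ w} {v ∷ vs} {i} p (v∈s ∷ c) (0≤ ∷ m) = run-sound (step σ s) (step-sound σ s {i} p v∈s refl 0≤) c m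

-- The walk is built from its end: the remaining steps determine the position j after the current
-- step, and membership of j in the stepped set supplies a predecessor j - v.
run-complete : ∀ σ w {k} → T (memℤ (run σ w) k) → ∃[ i ] ∃[ v ]
               (T (memℤ σ i) × Compatible w v × ListAll.All (ℤ._≤_ 0ℤ) (positionsFrom i v) × endpointFrom i v ≡ k)
run-complete σ [] {k} p = k , [] , p , [] , [] , refl
run-complete σ (s ∷ w) p with run-complete (step σ s) w p
... | + j , vs , q , c , m , e with find (Anyₚ.any⁻ _ (elems s) (≡.subst T (step-any σ s j) q))
... | v , v∈s , r = + j ℤ.- v , v ∷ vs , r , v∈s ∷ c ,
  ≡.subst (λ i → ListAll.All (ℤ._≤_ 0ℤ) (i ∷ positionsFrom i vs)) (sym (cancel--+ (+ j) v)) (ℤ.+≤+ z≤n ∷ m) ,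
  trans (cong (λ i → endpointFrom i vs) (cancel--+ (+ j) v)) e

reachable⇒mem : ∀ {w k} → Reachable w k → T (memℤ (run init w) k)
reachable⇒mem {w} (v , c , m , refl) = run-sound init {w} {v} {0ℤ} _ c m

mem⇒reachable : ∀ {w k} → T (memℤ (run init w) k) → Reachable w k
mem⇒reachable {w} {k} p with run-complete init w {k} p
-- The initial set contains only 0, so the walk found starts there.
... | + zero , v , _ , c , m , e = v , c , m , e

private
  memI-bounds : ∀ a d k → T (memI a d k) → a ℕ.≤ k × k ℕ.≤ a ℕ.+ suc d
  memI-bounds (suc a) d       (suc k)    p = let q , r = memI-bounds a d k p in s≤s q , s≤s r
  memI-bounds 0       d       zero       p = z≤n , z≤n
  memI-bounds 0       0       (suc zero) p = z≤n , s≤s z≤n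
  memI-bounds 0       (suc d) (suc k)    p = z≤n , s≤s (proj₂ (memI-bounds 0 d k p))

  memI-offset : ∀ a d i → i ℕ.≤ suc d → T (memI a d (a ℕ.+ i))
  memI-offset (suc a) d       i          p       = memI-offset a d i p
  memI-offset 0       d       zero       p       = _
  memI-offset 0       zero    (suc zero) p       = _
  memI-offset 0       zero    (suc (suc i)) (s≤s ())
  memI-offset 0       (suc d) (suc i)    (s≤s p) = memI-offset 0 d i p

  memII-offset : ∀ a d i → i ℕ.≤ d → T (memII a d (a ℕ.+ double i))
  memII-offset (suc a) d       i       p       = memII-offset a d i p
  memII-offset 0       d       zero    p       = _
  memII-offset 0       (suc d) (suc i) (s≤s p) = memII-offset 0 d i p

  memII-form : ∀ a d k → T (memII a d k) → ∃ λ i → k ≡ a ℕ.+ double i × i ℕ.≤ d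
  memII-form (suc a) d       (suc k)       p = let i , e , q = memII-form a d k p in i , cong suc e , q
  memII-form 0       d       zero          p = 0 , refl , z≤n
  memII-form 0       (suc d) (suc (suc k)) p = let i , e , q = memII-form 0 d k p in suc i , cong (λ j → suc (suc j)) e , s≤s q

  double≡2* : ∀ n → double n ≡ 2 ℕ.* n
  double≡2* zero    = refl
  double≡2* (suc n) = trans (cong (λ k → suc (suc k)) (double≡2* n)) (cong suc (sym (ℕₚ.+-suc n (n ℕ.+ 0))))

  double-mono : ∀ {m n} → m ℕ.≤ n → double m ℕ.≤ double n
  double-mono z≤n     = z≤n
  double-mono (s≤s p) = s≤s (s≤s (double-mono p))

  double-cancel : ∀ {m n} → double m ℕ.≤ double n → m ℕ.≤ n
  double-cancel {zero}          p             = z≤n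
  double-cancel {suc m} {suc n} (s≤s (s≤s p)) = s≤s (double-cancel p)

  1≢double : ∀ i → ¬ 1 ≡ double i
  1≢double zero    ()
  1≢double (suc i) ()

  memℤ-nat : ∀ σ k → T (memℤ σ k) → ∃ λ m → k ≡ + m × T (mem σ m)
  memℤ-nat σ (+ m) p = m , refl , p

  -- Both types of sets contain their smallest and largest element; this determines a and b.
  bounds-unique : ∀ {w a b lo hi} → IsMin⁺ w (+ a) → IsMax⁺ w (+ b) →
    T (mem (run init w) lo) → T (mem (run init w) hi) →
    (∀ k → T (mem (run init w) k) → lo ℕ.≤ k × k ℕ.≤ hi) → a ≡ lo × b ≡ hi
  bounds-unique {w} {lo = lo} {hi} (a∈ , a≤) (b∈ , ≤b) lo∈ hi∈ bounds =
    ℕₚ.≤-antisym (ℤₚ.drop‿+≤+ (a≤ (+ lo) (mem⇒reachable {w} lo∈))) (proj₁ (bounds _ (reachable⇒mem {w} a∈))) ,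
    ℕₚ.≤-antisym (proj₂ (bounds _ (reachable⇒mem {w} b∈))) (ℤₚ.drop‿+≤+ (≤b (+ hi) (mem⇒reachable {w} hi∈)))

  min-max : ∀ {w lo hi} → T (mem (run init w) lo) → T (mem (run init w) hi) →
    (∀ k → T (mem (run init w) k) → lo ℕ.≤ k × k ℕ.≤ hi) → NMeander w × IsMin⁺ w (+ lo) × IsMax⁺ w (+ hi)
  min-max {w} {lo} {hi} lo∈ hi∈ bounds =
    (let v , c , m , _ = lo-reachable in v , c , m) ,
    (lo-reachable , λ k r → lower k (memℤ-nat _ k (reachable⇒mem {w} r))) ,
    (mem⇒reachable {w} hi∈ , λ k r → upper k (memℤ-nat _ k (reachable⇒mem {w} r)))
    where
    lo-reachable : Reachable w (+ lo)
    lo-reachable = mem⇒reachable {w} lo∈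
    lower : ∀ k → (∃ λ m → k ≡ + m × T (mem (run init w) m)) → + lo ℤ.≤ k
    lower _ (m , refl , p) = ℤ.+≤+ (proj₁ (bounds m p))
    upper : ∀ k → (∃ λ m → k ≡ + m × T (mem (run init w) m)) → k ℤ.≤ + hi
    upper _ (m , refl , p) = ℤ.+≤+ (proj₂ (bounds m p))

  memI-lo : ∀ a d → T (memI a d a)
  memI-lo a d = subst (λ k → T (memI a d k)) (ℕₚ.+-identityʳ a) (memI-offset a d 0 z≤n)

  memI-hi : ∀ a d → T (memI a d (a ℕ.+ suc d))
  memI-hi a d = memI-offset a d (suc d) ℕₚ.≤-refl

  memII-lo : ∀ a d → T (memII a d a)
  memII-lo a d = subst (λ k → T (memII a d k)) (ℕₚ.+-identityʳ a) (memII-offset a d 0 z≤n)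

  memII-hi : ∀ a d → T (memII a d (a ℕ.+ double d))
  memII-hi a d = memII-offset a d d ℕₚ.≤-refl

  memII-bounds : ∀ a d k → T (memII a d k) → a ℕ.≤ k × k ℕ.≤ a ℕ.+ double d
  memII-bounds a d k p with memII-form a d k p
  ... | i , refl , i≤d = ℕₚ.m≤m+n a (double i) , ℕₚ.+-monoʳ-≤ a (double-mono i≤d)

module _ {w : NWalk} where
  -- Minimum and maximum fix the parameters. A type II state is excluded because b - a ≥ 1 makes a +
  -- 1 reachable, which has the wrong parity.
  typeI⇒run : ∀ {a b} → TypeI w a b → ∃ λ d → run init w ≡ I a d × b ≡ a ℕ.+ suc d
  typeI⇒run {a} {b} (_ , lo , hi , reach , 1≤) with run init w in eq
  ... | dead = contradiction (subst (λ σ → T (mem σ a)) eq (reachable⇒mem {w} (proj₁ lo))) (λ ())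
  ... | I a′ d′ with bounds-unique {w} lo hi (subst (λ σ → T (mem σ a′)) (sym eq) (memI-lo a′ d′))
                       (subst (λ σ → T (mem σ _)) (sym eq) (memI-hi a′ d′))
                       (λ k p → memI-bounds a′ d′ k (subst (λ σ → T (mem σ k)) eq p))
  ...   | refl , refl = d′ , refl , refl
  typeI⇒run {a} {b} (_ , lo , hi , reach , 1≤) | II a′ d′
    with bounds-unique {w} lo hi (subst (λ σ → T (mem σ a′)) (sym eq) (memII-lo a′ d′))
           (subst (λ σ → T (mem σ _)) (sym eq) (memII-hi a′ d′))
           (λ k p → memII-bounds a′ d′ k (subst (λ σ → T (mem σ k)) eq p))
  ... | refl , refl with memII-form a d′ (a ℕ.+ 1) (subst (λ σ → T (mem σ (a ℕ.+ 1))) eq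
                           (reachable⇒mem {w} (Equivalence.from (reach (+ (a ℕ.+ 1))) (1 , refl , 1≤))))
  ...   | i , e , _ = contradiction (ℕₚ.+-cancelˡ-≡ a 1 (double i) e) (1≢double i)

  -- A type I state is excluded because it contains a + 1, which is not at even distance from a.
  typeII⇒run : ∀ {a b} → TypeII w a b → ∃ λ d → run init w ≡ II a d × b ≡ a ℕ.+ double d
  typeII⇒run {a} {b} (_ , lo , hi , reach) with run init w in eq
  ... | dead = contradiction (subst (λ σ → T (mem σ a)) eq (reachable⇒mem {w} (proj₁ lo))) (λ ())
  ... | II a′ d′ with bounds-unique {w} lo hi (subst (λ σ → T (mem σ a′)) (sym eq) (memII-lo a′ d′))
                       (subst (λ σ → T (mem σ _)) (sym eq) (memII-hi a′ d′))
                       (λ k p → memII-bounds a′ d′ k (subst (λ σ → T (mem σ k)) eq p))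
  ...   | refl , refl = d′ , refl , refl
  typeII⇒run {a} {b} (_ , lo , hi , reach) | I a′ d′
    with bounds-unique {w} lo hi (subst (λ σ → T (mem σ a′)) (sym eq) (memI-lo a′ d′))
           (subst (λ σ → T (mem σ _)) (sym eq) (memI-hi a′ d′))
           (λ k p → memI-bounds a′ d′ k (subst (λ σ → T (mem σ k)) eq p))
  ... | refl , refl with Equivalence.to (reach (+ (a ℕ.+ 1))) (mem⇒reachable {w}
                           (subst (λ σ → T (mem σ (a ℕ.+ 1))) (sym eq) (memI-offset a d′ 1 (s≤s z≤n))))
  ...   | i , e , _ = contradiction (trans (ℕₚ.+-cancelˡ-≡ a 1 (2 ℕ.* i) (ℤₚ.+-injective e)) (sym (double≡2* i))) (1≢double i)

  run⇒typeI : ∀ {a b} → (∃ λ d → run init w ≡ I a d × b ≡ a ℕ.+ suc d) → TypeI w a b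
  run⇒typeI {a} (d , eq , refl) = let m , lo , hi = extremes in m , lo , hi , reach ,
    subst (λ k → 1 ℕ.≤ k) (sym (ℕₚ.m+n∸m≡n a (suc d))) (s≤s z≤n)
    where
    extremes : NMeander w × IsMin⁺ w (+ a) × IsMax⁺ w (+ (a ℕ.+ suc d))
    extremes = min-max {w} (subst (λ σ → T (mem σ a)) (sym eq) (memI-lo a d))
      (subst (λ σ → T (mem σ _)) (sym eq) (memI-hi a d)) (λ k p → memI-bounds a d k (subst (λ σ → T (mem σ k)) eq p))
    reach : ∀ k → Reachable w k ⇔ (∃[ i ] (k ≡ + a ℤ.+ + i × i ℕ.≤ (a ℕ.+ suc d) ∸ a))
    reach k = mk⇔ (λ r → to k (memℤ-nat _ k (reachable⇒mem {w} r))) from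
      where
      to : ∀ k → (∃ λ m → k ≡ + m × T (mem (run init w) m)) → ∃[ i ] (k ≡ + a ℤ.+ + i × i ℕ.≤ (a ℕ.+ suc d) ∸ a)
      to _ (m , refl , p) with memI-bounds a d m (subst (λ σ → T (mem σ m)) eq p)
      ... | a≤m , m≤ = m ∸ a , cong +_ (sym (ℕₚ.m+[n∸m]≡n a≤m)) , ℕₚ.∸-monoˡ-≤ a m≤
      from : (∃[ i ] (k ≡ + a ℤ.+ + i × i ℕ.≤ (a ℕ.+ suc d) ∸ a)) → Reachable w k
      from (i , refl , i≤) = mem⇒reachable {w} (subst (λ σ → T (mem σ (a ℕ.+ i))) (sym eq)
        (memI-offset a d i (subst (i ℕ.≤_) (ℕₚ.m+n∸m≡n a (suc d)) i≤)))

  run⇒typeII : ∀ {a b} → (∃ λ d → run init w ≡ II a d × b ≡ a ℕ.+ double d) → TypeII w a b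
  run⇒typeII {a} (d , eq , refl) = let m , lo , hi = extremes in m , lo , hi , reach
    where
    extremes : NMeander w × IsMin⁺ w (+ a) × IsMax⁺ w (+ (a ℕ.+ double d))
    extremes = min-max {w} (subst (λ σ → T (mem σ a)) (sym eq) (memII-lo a d))
      (subst (λ σ → T (mem σ _)) (sym eq) (memII-hi a d)) (λ k p → memII-bounds a d k (subst (λ σ → T (mem σ k)) eq p))
    reach : ∀ k → Reachable w k ⇔ (∃[ i ] (k ≡ + a ℤ.+ + (2 ℕ.* i) × 2 ℕ.* i ℕ.≤ (a ℕ.+ double d) ∸ a))
    reach k = mk⇔ (λ r → to k (memℤ-nat _ k (reachable⇒mem {w} r))) from
      where
      to : ∀ k → (∃ λ m → k ≡ + m × T (mem (run init w) m)) → ∃[ i ] (k ≡ + a ℤ.+ + (2 ℕ.* i) × 2 ℕ.* i ℕ.≤ (a ℕ.+ double d) ∸ a)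
      to _ (m , refl , p) with memII-form a d m (subst (λ σ → T (mem σ m)) eq p)
      ... | i , refl , i≤d = i , cong (λ j → + (a ℕ.+ j)) (double≡2* i) ,
        subst (2 ℕ.* i ℕ.≤_) (sym (ℕₚ.m+n∸m≡n a (double d))) (subst (ℕ._≤ double d) (double≡2* i) (double-mono i≤d))
      from : (∃[ i ] (k ≡ + a ℤ.+ + (2 ℕ.* i) × 2 ℕ.* i ℕ.≤ (a ℕ.+ double d) ∸ a)) → Reachable w k
      from (i , refl , i≤) = mem⇒reachable {w} (subst (λ j → T (mem (run init w) (a ℕ.+ j))) (double≡2* i)
        (subst (λ σ → T (mem σ (a ℕ.+ double i))) (sym eq) (memII-offset a d i
          (double-cancel (subst (ℕ._≤ double d) (sym (double≡2* i)) (subst (2 ℕ.* i ℕ.≤_) (ℕₚ.m+n∸m≡n a (double d)) i≤))))))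

-- Counting walks

private
  steps : List MStep
  steps = s₋ ∷ s₀ ∷ s₊ ∷ s₋₀ ∷ s₋₊ ∷ s₀₊ ∷ s₋₀₊ ∷ []

  steps-unique : Unique steps
  steps-unique =
    ((λ ()) ∷ (λ ()) ∷ (λ ()) ∷ (λ ()) ∷ (λ ()) ∷ (λ ()) ∷ []) ∷
    ((λ ()) ∷ (λ ()) ∷ (λ ()) ∷ (λ ()) ∷ (λ ()) ∷ []) ∷
    ((λ ()) ∷ (λ ()) ∷ (λ ()) ∷ (λ ()) ∷ []) ∷
    ((λ ()) ∷ (λ ()) ∷ (λ ()) ∷ []) ∷
    ((λ ()) ∷ (λ ()) ∷ []) ∷
    ((λ ()) ∷ []) ∷ [] ∷ []

  ∈-steps : ∀ s → s ∈ steps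
  ∈-steps s₋   = here refl
  ∈-steps s₀   = there (here refl)
  ∈-steps s₊   = there (there (here refl))
  ∈-steps s₋₀  = there (there (there (here refl)))
  ∈-steps s₋₊  = there (there (there (there (here refl))))
  ∈-steps s₀₊  = there (there (there (there (there (here refl)))))
  ∈-steps s₋₀₊ = there (there (there (there (there (there (here refl))))))

  words : ℕ → List NWalk
  words zero    = [] ∷ []
  words (suc n) = cartesianProductWith _∷_ steps (words n)

  words-unique : ∀ n → Unique (words n)
  words-unique zero    = [] ∷ []
  words-unique (suc n) = Uniqueₚ.cartesianProductWith⁺ _∷_ Listₚ.∷-injective steps-unique (words-unique n)

  ∈-words⁺ : ∀ w → w ∈ words (length w)
  ∈-words⁺ []      = here refl
  ∈-words⁺ (s ∷ w) = ∈-cartesianProductWith⁺ _∷_ (∈-steps s) (∈-words⁺ w)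

  ∈-words⁻ : ∀ n {w} → w ∈ words n → length w ≡ n
  ∈-words⁻ zero (here refl) = refl
  ∈-words⁻ (suc n) p with ∈-cartesianProductWith⁻ _∷_ steps (words n) p
  ... | _ , _ , _ , q , refl = cong suc (∈-words⁻ n q)

  module _ (Q : State → Bool) where
    accepted : State → ℕ → List NWalk
    accepted σ n = filter (λ w → T? (Q (run σ w))) (words n)

    length-filter-map : ∀ σ s ws → length (filter (λ w → T? (Q (run σ w))) (List.map (s ∷_) ws)) ≡
                                   length (filter (λ w → T? (Q (run (step σ s) w))) ws)
    length-filter-map σ s [] = refl
    length-filter-map σ s (w ∷ ws) with Q (run (step σ s) w)
    ... | true  = cong suc (length-filter-map σ s ws)
    ... | false = length-filter-map σ s ws

    -- Sorting words by their first step gives the recursion that defines `transfer^`.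
    length-product : ∀ σ ss ws → length (filter (λ w → T? (Q (run σ w))) (cartesianProductWith _∷_ ss ws)) ≡
                     sum (List.map (λ s → length (filter (λ w → T? (Q (run (step σ s) w))) ws)) ss)
    length-product σ [] ws = refl
    length-product σ (s ∷ ss) ws = trans (cong length (Listₚ.filter-++ _ (List.map (s ∷_) ws) _))
      (trans (Listₚ.length-++ (filter (λ w → T? (Q (run σ w))) (List.map (s ∷_) ws)))
        (cong₂ ℕ._+_ (length-filter-map σ s ws) (length-product σ ss ws)))

    -- `IsCounting` may use any list. Two lists without repetitions and with the same elements are
    -- permutations of each other, so its length can be computed from the canonical enumeration.
    count-unique : ∀ {P : NWalk → ℕ → ℕ → Set} {a b} → (∀ w → P w a b ⇔ T (Q (run init w))) → ∀ {n L} → Unique L →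
                   (∀ w → w ∈ L ⇔ (length w ≡ n × P w a b)) → length L ≡ length (accepted init n)
    count-unique P⇔Q {n} {L} L! ∈L = ↭-length (∼bag⇒↭ (unique∧set⇒bag L! (Uniqueₚ.filter⁺ _ (words-unique n))
      (λ {w} → mk⇔ (to w) (from w))))
      where
      to : ∀ w → w ∈ L → w ∈ accepted init n
      to w p with Equivalence.to (∈L w) p
      ... | refl , q = ∈-filter⁺ _ (∈-words⁺ w) (Equivalence.to (P⇔Q w) q)
      from : ∀ w → w ∈ accepted init n → w ∈ L
      from w p with ∈-filter⁻ _ {xs = words n} p
      ... | q , r = Equivalence.from (∈L w) (∈-words⁻ n q , Equivalence.from (P⇔Q w) r)

-- Coefficients of the weights, and the assembly of the result.

open GF
open W

private
  indicator : Bool → ℤ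
  indicator b = if b then 1ℤ else 0ℤ

  module _ (Q : State → Bool) (w : State → X.PS) {a b : ℕ} (w≡Q : ∀ σ → w σ a b ≡ indicator (Q σ)) where
    transfer^-count : ∀ n σ → transfer^ n w σ a b ≡ + length (accepted Q σ n)
    transfer^-count zero σ with Q σ | w≡Q σ
    ... | true  | e = e
    ... | false | e = e
    transfer^-count (suc n) σ = trans
      (cong₂ ℤ._+_ (cong₂ ℤ._+_ (cong₂ ℤ._+_ (cong₂ ℤ._+_ (cong₂ ℤ._+_ (cong₂ ℤ._+_
        (ih s₋) (ih s₀)) (ih s₊)) (ih s₋₀)) (ih s₋₊)) (ih s₀₊)) (ih s₋₀₊))
      (trans (solve 7 (λ a b c d e f g → a :+ b :+ c :+ d :+ e :+ f :+ g := a :+ (b :+ (c :+ (d :+ (e :+ (f :+ (g :+ con 0ℤ))))))) refl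
        (l s₋) (l s₀) (l s₊) (l s₋₀) (l s₋₊) (l s₀₊) (l s₋₀₊))
        (cong +_ (sym (length-product Q σ steps (words n)))))
      where
      open IntegerCoefficients ℤ-ring using (solve; _:=_; _:+_; con)
      ih : ∀ s → transfer^ n w (step σ s) a b ≡ + length (accepted Q (step σ s) n)
      ih s = transfer^-count n (step σ s)
      l : MStep → ℤ
      l s = + length (accepted Q (step σ s) n)

  counting≡gen : ∀ {P F} (Q : ℕ → ℕ → State → Bool) (w : State → X.PS) → (∀ {a b} v → P v a b ⇔ T (Q a b (run init v))) →
    (∀ σ a b → w σ a b ≡ indicator (Q a b σ)) → IsCounting P F → toSeries F SR.≈ gen w
  counting≡gen {P} Q w P⇔Q w≡Q counting n a b with counting n a b
  ... | L , L! , ∈L , e = trans (cong +_ (trans (sym e) (count-unique (Q a b) {P} P⇔Q L! ∈L)))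
    (sym (transfer^-count (Q a b) w (λ σ → w≡Q σ a b) n init))

  isI isII : ℕ → ℕ → State → Bool
  isI a b (I a′ d)   = (a′ ℕ.+ suc d ≡ᵇ b) ∧ (a′ ≡ᵇ a)
  isI a b _          = false
  isII a b (II a′ d) = (a′ ℕ.+ double d ≡ᵇ b) ∧ (a′ ≡ᵇ a)
  isII a b _         = false

  isI-spec : ∀ {a b} σ → (∃ λ d → σ ≡ I a d × b ≡ a ℕ.+ suc d) ⇔ T (isI a b σ)
  isI-spec {a} {b} σ = mk⇔ to (from σ)
    where
    to : (∃ λ d → σ ≡ I a d × b ≡ a ℕ.+ suc d) → T (isI a b σ)
    to (d , refl , refl) = Equivalence.from T-∧ (ℕₚ.≡⇒≡ᵇ (a ℕ.+ suc d) _ refl , ℕₚ.≡⇒≡ᵇ a a refl)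
    from : ∀ σ → T (isI a b σ) → ∃ λ d → σ ≡ I a d × b ≡ a ℕ.+ suc d
    from (I a′ d) p with Equivalence.to T-∧ p
    ... | q , r with ℕₚ.≡ᵇ⇒≡ (a′ ℕ.+ suc d) b q | ℕₚ.≡ᵇ⇒≡ a′ a r
    ...   | refl | refl = d , refl , refl

  isII-spec : ∀ {a b} σ → (∃ λ d → σ ≡ II a d × b ≡ a ℕ.+ double d) ⇔ T (isII a b σ)
  isII-spec {a} {b} σ = mk⇔ to (from σ)
    where
    to : (∃ λ d → σ ≡ II a d × b ≡ a ℕ.+ double d) → T (isII a b σ)
    to (d , refl , refl) = Equivalence.from T-∧ (ℕₚ.≡⇒≡ᵇ (a ℕ.+ double d) _ refl , ℕₚ.≡⇒≡ᵇ a a refl)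
    from : ∀ σ → T (isII a b σ) → ∃ λ d → σ ≡ II a d × b ≡ a ℕ.+ double d
    from (II a′ d) p with Equivalence.to T-∧ p
    ... | q , r with ℕₚ.≡ᵇ⇒≡ (a′ ℕ.+ double d) b q | ℕₚ.≡ᵇ⇒≡ a′ a r
    ...   | refl | refl = d , refl , refl

  -- That f is x^i y^j, phrased with the Boolean tests of `isI` and `isII` so that weights and
  -- acceptance conditions agree directly.
  record Monomial (f : X.PS) (i j : ℕ) : Set where
    constructor monomial
    field coefficients : ∀ a b → f a b ≡ indicator ((j ≡ᵇ b) ∧ (i ≡ᵇ a))
  open Monomial

  monomial-resp : ∀ {f g i j} → f XR.≈ g → Monomial g i j → Monomial f i j
  monomial-resp e m = monomial λ a b → trans (e a b) (coefficients m a b)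

  monomial-1 : Monomial XR.1# 0 0
  monomial-1 = monomial λ
    { zero zero → refl ; zero (suc b) → refl ; (suc a) zero → refl ; (suc a) (suc b) → refl }

  monomial-y : ∀ {f i j} → Monomial f i j → Monomial (y₀ X.✶ f) i (suc j)
  monomial-y {f} m = monomial λ
    { a zero    → trans (X.const-✶ Y.var f a zero) (Y.var-✶ (f a) zero)
    ; a (suc b) → trans (X.const-✶ Y.var f a (suc b)) (trans (Y.var-✶ (f a) (suc b)) (coefficients m a b)) }

  monomial-x : ∀ {f i j} → Monomial f i j → Monomial (x₀ X.✶ f) (suc i) j
  monomial-x {f} {j = j} m = monomial λ
    { zero    b → trans (X.var-✶ f zero b) (sym (cong indicator (Boolₚ.∧-zeroʳ (j ≡ᵇ b))))
    ; (suc a) b → trans (X.var-✶ f (suc a) b) (coefficients m a b) }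

  monomial-u^ : ∀ k {f i j} → Monomial f i j → Monomial (pow (x₀ X.✶ y₀) k X.✶ f) (k ℕ.+ i) (k ℕ.+ j)
  monomial-u^ zero    {f} m = monomial-resp (XR.*-identityˡ f) m
  monomial-u^ (suc k) {f} m = monomial-resp
    (XR.trans (XR.*-assoc (x₀ X.✶ y₀) (pow (x₀ X.✶ y₀) k) f) (XR.*-assoc x₀ y₀ (pow (x₀ X.✶ y₀) k X.✶ f)))
    (monomial-x (monomial-y (monomial-u^ k m)))

  monomial-y^ : ∀ d → Monomial (pow y₀ d) 0 d
  monomial-y^ zero    = monomial-1
  monomial-y^ (suc d) = monomial-y (monomial-y^ d)

  monomial-y²^ : ∀ d → Monomial (pow (y₀ X.✶ y₀) d) 0 (double d)
  monomial-y²^ zero    = monomial-1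
  monomial-y²^ (suc d) = monomial-resp (XR.*-assoc y₀ y₀ (pow (y₀ X.✶ y₀) d)) (monomial-y (monomial-y (monomial-y²^ d)))

  wI≡isI : ∀ σ a b → wI σ a b ≡ indicator (isI a b σ)
  wI≡isI dead      a b = refl
  wI≡isI (II _ _)  a b = refl
  wI≡isI (I a′ d)  a b = trans (coefficients (monomial-u^ a′ (monomial-y (monomial-y^ d))) a b)
    (cong (λ k → indicator ((a′ ℕ.+ suc d ≡ᵇ b) ∧ (k ≡ᵇ a))) (ℕₚ.+-identityʳ a′))

  wII≡isII : ∀ σ a b → wII σ a b ≡ indicator (isII a b σ)
  wII≡isII dead      a b = refl
  wII≡isII (I _ _)   a b = refl
  wII≡isII (II a′ d) a b = trans (coefficients (monomial-u^ a′ (monomial-y²^ d)) a b)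
    (cong (λ k → indicator ((a′ ℕ.+ double d ≡ᵇ b) ∧ (k ≡ᵇ a))) (ℕₚ.+-identityʳ a′))

typeI-gen : ∀ {F} → IsCounting TypeI F → toSeries F SR.≈ GI
typeI-gen = counting≡gen isI wI (λ v → mk⇔ (Equivalence.to (isI-spec (run init v)) ∘ typeI⇒run)
  (run⇒typeI ∘ Equivalence.from (isI-spec (run init v)))) wI≡isI

typeII-gen : ∀ {F} → IsCounting TypeII F → toSeries F SR.≈ GII
typeII-gen = counting≡gen isII wII (λ v → mk⇔ (Equivalence.to (isII-spec (run init v)) ∘ typeII⇒run)
  (run⇒typeII ∘ Equivalence.from (isII-spec (run init v)))) wII≡isII

wI-atX0 : ∀ b σ → wI σ 0 b ≡ wI₀ σ 0 b
wI-atX0 b dead          = refl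
wI-atX0 b (II a d)      = refl
wI-atX0 b (I zero d)    = XR.*-identityˡ (y₀ X.✶ pow y₀ d) 0 b
wI-atX0 b (I (suc a) d) = trans (wI≡isI (I (suc a) d) 0 b) (cong indicator (Boolₚ.∧-zeroʳ (suc (a ℕ.+ suc d) ≡ᵇ b)))

wII-atX0 : ∀ b σ → wII σ 0 b ≡ wII₀ σ 0 b
wII-atX0 b dead           = refl
wII-atX0 b (I a d)        = refl
wII-atX0 b (II zero d)    = XR.*-identityˡ (pow (y₀ X.✶ y₀) d) 0 b
wII-atX0 b (II (suc a) d) = trans (wII≡isII (II (suc a) d) 0 b) (cong indicator (Boolₚ.∧-zeroʳ (suc (a ℕ.+ double d) ≡ᵇ b)))

-- `transfer` only adds weights, so it commutes with taking the coefficient of x⁰. In positive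
-- degrees of x, `atX0` is 0, which matches a boundary series free of x.
gen-atX0 : ∀ {F w w₀} → (∀ b σ → w σ 0 b ≡ w₀ σ 0 b) → (∀ n a b → gen w₀ n (suc a) b ≡ 0ℤ) →
           F SR.≈ gen w → atX0 F SR.≈ gen w₀
gen-atX0 w₀≡ free e n zero    b = trans (e n 0 b)
  (transfer^-related (λ f g → f 0 b ≡ g 0 b) (cong₂ ℤ._+_) (w₀≡ b) n init)
gen-atX0 w₀≡ free e n (suc a) b = sym (free n a b)

theorem3p7 : (MI MII : ℕ → ℕ → ℕ → ℕ) → IsCounting TypeI MI → IsCounting TypeII MII →
    Algebraic (toSeries MI) × Algebraic (toSeries MII) ×
    Algebraic (toSeries MI ⊕ toSeries MII) ×
    Algebraic (atX0 (toSeries MI)) × Algebraic (atX0 (toSeries MII))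
theorem3p7 MI MII countI countII =
  algebraic fraction-MI , algebraic fraction-MII , algebraic (fraction-+ fraction-MI fraction-MII) ,
  algebraic (fraction-resp (SR.sym (gen-atX0 wI-atX0 (free-of-x GI₀∈Q) (typeI-gen countI))) GI₀-fraction) ,
  algebraic (fraction-resp (SR.sym (gen-atX0 wII-atX0 (free-of-x GII₀∈Q) (typeII-gen countII))) GII₀-fraction)
  where
  open Solution X.ring x₀ y₀ setting
  open PolynomialRoots using (root⇒algebraic)
  open PowerSeriesSubring X.ring KX.constants using (Coefficientwise; module Coefficientwise)

  algebraic : ∀ {F} → Fraction F → Algebraic F
  algebraic p = root⇒algebraic (fraction⇒root p)

  free-of-x : ∀ {f} → Coefficientwise f → ∀ n a b → f n (ℕ.suc a) b ≡ ℤ.0ℤ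
  free-of-x p n a = KX.Constant.tail-zero (Coefficientwise.coefficients p n) a

  fraction-MI : Fraction (toSeries MI)
  fraction-MI = fraction-resp (SR.sym (typeI-gen countI)) GI-fraction

  fraction-MII : Fraction (toSeries MII)
  fraction-MII = fraction-resp (SR.sym (typeII-gen countII)) GII-fraction
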